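{- (1) There are continuum many (i.e. $2^{\aleph_0}$) monoid varieties $\mathbb{W}$ with $\mathbb{M}(\mathbf{z}_\infty)\subseteq \mathbb{W}\subseteq [\![x^2y\approx yx^2]\!]\wedge \mathbb{B}_2^1$. (2) The monoid variety $\mathbb{M}(\mathbf{z}_\infty)$ is not defined within $\mathbb{B}_2^1$ by any finite system of identities; that is, there is no finite set $\Sigma$ of monoid identities such that $\mathbb{M}(\mathbf{z}_\infty)=\mathbb{B}_2^1\cap[\![\Sigma]\!]$.
   Context: ${\bf B}_2^1$ is the six-element Brandt monoid, with monoid presentation $\langle \mathsf{a},\mathsf{b}\mid \mathsf{a}\mathsf{b}\mathsf{a}=\mathsf{a},\ \mathsf{b}\mathsf{a}\mathsf{b}=\mathsf{b},\ \mathsf{a}\mathsf{a}=\mathsf{b}\mathsf{b}=0\rangle$, and $\mathbb{B}_2^1$ is the monoid variety it generates. Let $x_0,x_1,\dots$ be pairwise distinct letters; the Zimin words are $\mathbf{z}_0=x_0$, $\mathbf{z}_{n+1}=\mathbf{z}_nx_{n+1}\mathbf{z}_n$, and $\mathbf{z}_\infty$ is the right-infinite word that is their limit. $S(\mathbf{z}_\infty)$ is the semigroup whose elements are a zero $0$ together with all finite nonempty factors (contiguous subwords) of $\mathbf{z}_\infty$, with product $\mathbf{u}\cdot\mathbf{v}=\mathbf{u}\mathbf{v}$ if $\mathbf{u}\mathbf{v}$ is a factor of $\mathbf{z}_\infty$ and $0$ otherwise; $M(\mathbf{z}_\infty)$ is $S(\mathbf{z}_\infty)$ with an identity element adjoined,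 and $\mathbb{M}(\mathbf{z}_\infty)$ is the monoid variety generated by $M(\mathbf{z}_\infty)$. For a set $\Sigma$ of monoid identities, $[\![\Sigma]\!]$ is the monoid variety it defines; $\wedge$ denotes intersection of varieties. -}

module Defs where

open import Level using (0ℓ)
open import Algebra.Bundles using (Monoid)
open import Algebra.Structures using (IsMonoid)
open import Data.Nat using (ℕ; zero; suc)
open import Data.List using (List; []; _∷_; _++_; [_])
open import Data.List.Properties using (++-assoc; ++-identityˡ; ++-identityʳ)
open import Data.List.Membership.Propositional using (_∈_)
open import Data.Product using (Σ; Σ-syntax; ∃; _×_; _,_)
open import Data.Sum using (_⊎_; inj₁; inj₂)
open import Relation.Nullary using (¬_)
open import Relation.Binary.PropositionalEquality
  using (_≡_; refl; sym; trans; cong; cong₂; isEquivalence)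

Word : Set
Word = List ℕ

Identity : Set
Identity = Word × Word

eval : (M : Monoid 0ℓ 0ℓ) → (ℕ → Monoid.Carrier M) → Word → Monoid.Carrier M
eval M θ [] = Monoid.ε M
eval M θ (x ∷ w) = Monoid._∙_ M (θ x) (eval M θ w)

_⊨_ : Monoid 0ℓ 0ℓ → Identity → Set
M ⊨ (u , v) = ∀ (θ : ℕ → Monoid.Carrier M) → Monoid._≈_ M (eval M θ u) (eval M θ v)

Class : Set₁
Class = Monoid 0ℓ 0ℓ → Set

⟦_⟧ : (Identity → Set) → Class
⟦ Σ' ⟧ M = ∀ e → Σ' e → M ⊨ e

⟦_⟧fin : List Identity → Class
⟦ Σ' ⟧fin M = ∀ e → e ∈ Σ' → M ⊨ e

Id : Monoid 0ℓ 0ℓ → Identity → Set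
Id N e = N ⊨ e

-- the monoid variety generated by N  (= HSP(N) = [[Id N]] by Birkhoff)
Var : Monoid 0ℓ 0ℓ → Class
Var N = ⟦ Id N ⟧

_⊆_ : Class → Class → Set₁
C ⊆ D = ∀ M → C M → D M

_≋_ : Class → Class → Set₁
C ≋ D = (C ⊆ D) × (D ⊆ C)

_∧_ : Class → Class → Class
(C ∧ D) M = C M × D M

x²y≈yx² : Identity → Set
x²y≈yx² e = e ≡ ((0 ∷ 0 ∷ 1 ∷ []) , (1 ∷ 0 ∷ 0 ∷ []))

data B₂¹-El : Set where
  e1 ea eb eab eba e0 : B₂¹-El

_·B_ : B₂¹-El → B₂¹-El → B₂¹-El
e1 ·B e1 = e1
e1 ·B ea = ea
e1 ·B eb = eb
e1 ·B eab = eab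
e1 ·B eba = eba
e1 ·B e0 = e0
ea ·B e1 = ea
ea ·B ea = e0
ea ·B eb = eab
ea ·B eab = e0
ea ·B eba = ea
ea ·B e0 = e0
eb ·B e1 = eb
eb ·B ea = eba
eb ·B eb = e0
eb ·B eab = eb
eb ·B eba = e0
eb ·B e0 = e0
eab ·B e1 = eab
eab ·B ea = ea
eab ·B eb = e0
eab ·B eab = eab
eab ·B eba = e0
eab ·B e0 = e0
eba ·B e1 = eba
eba ·B ea = e0
eba ·B eb = eb
eba ·B eab = e0
eba ·B eba = eba
eba ·B e0 = e0
e0 ·B e1 = e0
e0 ·B ea = e0
e0 ·B eb = e0
e0 ·B eab = e0
e0 ·B eba = e0
e0 ·B e0 = e0

·B-assoc : ∀ x y z → (x ·B y) ·B z ≡ x ·B (y ·B z)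
·B-assoc e1 e1 e1 = refl
·B-assoc e1 e1 ea = refl
·B-assoc e1 e1 eb = refl
·B-assoc e1 e1 eab = refl
·B-assoc e1 e1 eba = refl
·B-assoc e1 e1 e0 = refl
·B-assoc e1 ea e1 = refl
·B-assoc e1 ea ea = refl
·B-assoc e1 ea eb = refl
·B-assoc e1 ea eab = refl
·B-assoc e1 ea eba = refl
·B-assoc e1 ea e0 = refl
·B-assoc e1 eb e1 = refl
·B-assoc e1 eb ea = refl
·B-assoc e1 eb eb = refl
·B-assoc e1 eb eab = refl
·B-assoc e1 eb eba = refl
·B-assoc e1 eb e0 = refl
·B-assoc e1 eab e1 = refl
·B-assoc e1 eab ea = refl
·B-assoc e1 eab eb = refl
·B-assoc e1 eab eab = refl
·B-assoc e1 eab eba = refl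
·B-assoc e1 eab e0 = refl
·B-assoc e1 eba e1 = refl
·B-assoc e1 eba ea = refl
·B-assoc e1 eba eb = refl
·B-assoc e1 eba eab = refl
·B-assoc e1 eba eba = refl
·B-assoc e1 eba e0 = refl
·B-assoc e1 e0 e1 = refl
·B-assoc e1 e0 ea = refl
·B-assoc e1 e0 eb = refl
·B-assoc e1 e0 eab = refl
·B-assoc e1 e0 eba = refl
·B-assoc e1 e0 e0 = refl
·B-assoc ea e1 e1 = refl
·B-assoc ea e1 ea = refl
·B-assoc ea e1 eb = refl
·B-assoc ea e1 eab = refl
·B-assoc ea e1 eba = refl
·B-assoc ea e1 e0 = refl
·B-assoc ea ea e1 = refl
·B-assoc ea ea ea = refl
·B-assoc ea ea eb = refl
·B-assoc ea ea eab = refl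
·B-assoc ea ea eba = refl
·B-assoc ea ea e0 = refl
·B-assoc ea eb e1 = refl
·B-assoc ea eb ea = refl
·B-assoc ea eb eb = refl
·B-assoc ea eb eab = refl
·B-assoc ea eb eba = refl
·B-assoc ea eb e0 = refl
·B-assoc ea eab e1 = refl
·B-assoc ea eab ea = refl
·B-assoc ea eab eb = refl
·B-assoc ea eab eab = refl
·B-assoc ea eab eba = refl
·B-assoc ea eab e0 = refl
·B-assoc ea eba e1 = refl
·B-assoc ea eba ea = refl
·B-assoc ea eba eb = refl
·B-assoc ea eba eab = refl
·B-assoc ea eba eba = refl
·B-assoc ea eba e0 = refl
·B-assoc ea e0 e1 = refl
·B-assoc ea e0 ea = refl
·B-assoc ea e0 eb = refl
·B-assoc ea e0 eab = refl
·B-assoc ea e0 eba = refl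
·B-assoc ea e0 e0 = refl
·B-assoc eb e1 e1 = refl
·B-assoc eb e1 ea = refl
·B-assoc eb e1 eb = refl
·B-assoc eb e1 eab = refl
·B-assoc eb e1 eba = refl
·B-assoc eb e1 e0 = refl
·B-assoc eb ea e1 = refl
·B-assoc eb ea ea = refl
·B-assoc eb ea eb = refl
·B-assoc eb ea eab = refl
·B-assoc eb ea eba = refl
·B-assoc eb ea e0 = refl
·B-assoc eb eb e1 = refl
·B-assoc eb eb ea = refl
·B-assoc eb eb eb = refl
·B-assoc eb eb eab = refl
·B-assoc eb eb eba = refl
·B-assoc eb eb e0 = refl
·B-assoc eb eab e1 = refl
·B-assoc eb eab ea = refl
·B-assoc eb eab eb = refl
·B-assoc eb eab eab = refl
·B-assoc eb eab eba = refl
·B-assoc eb eab e0 = refl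
·B-assoc eb eba e1 = refl
·B-assoc eb eba ea = refl
·B-assoc eb eba eb = refl
·B-assoc eb eba eab = refl
·B-assoc eb eba eba = refl
·B-assoc eb eba e0 = refl
·B-assoc eb e0 e1 = refl
·B-assoc eb e0 ea = refl
·B-assoc eb e0 eb = refl
·B-assoc eb e0 eab = refl
·B-assoc eb e0 eba = refl
·B-assoc eb e0 e0 = refl
·B-assoc eab e1 e1 = refl
·B-assoc eab e1 ea = refl
·B-assoc eab e1 eb = refl
·B-assoc eab e1 eab = refl
·B-assoc eab e1 eba = refl
·B-assoc eab e1 e0 = refl
·B-assoc eab ea e1 = refl
·B-assoc eab ea ea = refl
·B-assoc eab ea eb = refl
·B-assoc eab ea eab = refl
·B-assoc eab ea eba = refl
·B-assoc eab ea e0 = refl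
·B-assoc eab eb e1 = refl
·B-assoc eab eb ea = refl
·B-assoc eab eb eb = refl
·B-assoc eab eb eab = refl
·B-assoc eab eb eba = refl
·B-assoc eab eb e0 = refl
·B-assoc eab eab e1 = refl
·B-assoc eab eab ea = refl
·B-assoc eab eab eb = refl
·B-assoc eab eab eab = refl
·B-assoc eab eab eba = refl
·B-assoc eab eab e0 = refl
·B-assoc eab eba e1 = refl
·B-assoc eab eba ea = refl
·B-assoc eab eba eb = refl
·B-assoc eab eba eab = refl
·B-assoc eab eba eba = refl
·B-assoc eab eba e0 = refl
·B-assoc eab e0 e1 = refl
·B-assoc eab e0 ea = refl
·B-assoc eab e0 eb = refl
·B-assoc eab e0 eab = refl
·B-assoc eab e0 eba = refl
·B-assoc eab e0 e0 = refl
·B-assoc eba e1 e1 = refl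
·B-assoc eba e1 ea = refl
·B-assoc eba e1 eb = refl
·B-assoc eba e1 eab = refl
·B-assoc eba e1 eba = refl
·B-assoc eba e1 e0 = refl
·B-assoc eba ea e1 = refl
·B-assoc eba ea ea = refl
·B-assoc eba ea eb = refl
·B-assoc eba ea eab = refl
·B-assoc eba ea eba = refl
·B-assoc eba ea e0 = refl
·B-assoc eba eb e1 = refl
·B-assoc eba eb ea = refl
·B-assoc eba eb eb = refl
·B-assoc eba eb eab = refl
·B-assoc eba eb eba = refl
·B-assoc eba eb e0 = refl
·B-assoc eba eab e1 = refl
·B-assoc eba eab ea = refl
·B-assoc eba eab eb = refl
·B-assoc eba eab eab = refl
·B-assoc eba eab eba = refl
·B-assoc eba eab e0 = refl
·B-assoc eba eba e1 = refl
·B-assoc eba eba ea = refl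
·B-assoc eba eba eb = refl
·B-assoc eba eba eab = refl
·B-assoc eba eba eba = refl
·B-assoc eba eba e0 = refl
·B-assoc eba e0 e1 = refl
·B-assoc eba e0 ea = refl
·B-assoc eba e0 eb = refl
·B-assoc eba e0 eab = refl
·B-assoc eba e0 eba = refl
·B-assoc eba e0 e0 = refl
·B-assoc e0 e1 e1 = refl
·B-assoc e0 e1 ea = refl
·B-assoc e0 e1 eb = refl
·B-assoc e0 e1 eab = refl
·B-assoc e0 e1 eba = refl
·B-assoc e0 e1 e0 = refl
·B-assoc e0 ea e1 = refl
·B-assoc e0 ea ea = refl
·B-assoc e0 ea eb = refl
·B-assoc e0 ea eab = refl
·B-assoc e0 ea eba = refl
·B-assoc e0 ea e0 = refl
·B-assoc e0 eb e1 = refl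
·B-assoc e0 eb ea = refl
·B-assoc e0 eb eb = refl
·B-assoc e0 eb eab = refl
·B-assoc e0 eb eba = refl
·B-assoc e0 eb e0 = refl
·B-assoc e0 eab e1 = refl
·B-assoc e0 eab ea = refl
·B-assoc e0 eab eb = refl
·B-assoc e0 eab eab = refl
·B-assoc e0 eab eba = refl
·B-assoc e0 eab e0 = refl
·B-assoc e0 eba e1 = refl
·B-assoc e0 eba ea = refl
·B-assoc e0 eba eb = refl
·B-assoc e0 eba eab = refl
·B-assoc e0 eba eba = refl
·B-assoc e0 eba e0 = refl
·B-assoc e0 e0 e1 = refl
·B-assoc e0 e0 ea = refl
·B-assoc e0 e0 eb = refl
·B-assoc e0 e0 eab = refl
·B-assoc e0 e0 eba = refl
·B-assoc e0 e0 e0 = refl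

·B-identityˡ : ∀ x → e1 ·B x ≡ x
·B-identityˡ e1 = refl
·B-identityˡ ea = refl
·B-identityˡ eb = refl
·B-identityˡ eab = refl
·B-identityˡ eba = refl
·B-identityˡ e0 = refl

·B-identityʳ : ∀ x → x ·B e1 ≡ x
·B-identityʳ e1 = refl
·B-identityʳ ea = refl
·B-identityʳ eb = refl
·B-identityʳ eab = refl
·B-identityʳ eba = refl
·B-identityʳ e0 = refl

B₂¹ : Monoid 0ℓ 0ℓ
B₂¹ = record
  { Carrier = B₂¹-El
  ; _≈_ = _≡_
  ; _∙_ = _·B_
  ; ε = e1
  ; isMonoid = record
    { isSemigroup = record
      { isMagma = record { isEquivalence = isEquivalence ; ∙-cong = cong₂ _·B_ }
      ; assoc = ·B-assoc }
    ; identity = ·B-identityˡ , ·B-identityʳ }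
  }

𝔹₂¹ : Class
𝔹₂¹ = Var B₂¹

zimin : ℕ → Word
zimin zero = [ 0 ]
zimin (suc n) = zimin n ++ (suc n ∷ zimin n)

-- u is a (possibly empty) factor of z∞, i.e. a factor of some zₙ
-- (each zₙ is a prefix of z∞ and every finite factor of z∞ lies in some zₙ)
IsFactor : Word → Set
IsFactor u = Σ[ n ∈ ℕ ] Σ[ p ∈ Word ] Σ[ s ∈ Word ] p ++ (u ++ s) ≡ zimin n

-- M(z∞) is realised as the Rees quotient of the free monoid on ℕ by the
-- ideal of words that are not factors of z∞: the empty word is the
-- identity, each nonempty factor is its own class, and all non-factors
-- form the single class 0.  Product = concatenation.
_≈Z_ : Word → Word → Set
u ≈Z v = (u ≡ v) ⊎ ((¬ IsFactor u) × (¬ IsFactor v))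

private
  nf-ext-r : ∀ u v → ¬ IsFactor u → ¬ IsFactor (u ++ v)
  nf-ext-r u v nu (n , p , s , eq) =
    nu (n , p , v ++ s , trans (cong (p ++_) (sym (++-assoc u v s))) eq)

  nf-ext-l : ∀ u v → ¬ IsFactor v → ¬ IsFactor (u ++ v)
  nf-ext-l u v nv (n , p , s , eq) =
    nv (n , p ++ u , s ,
        trans (++-assoc p u (v ++ s))
              (trans (cong (p ++_) (sym (++-assoc u v s))) eq))

  ≈Z-sym : ∀ {u v} → u ≈Z v → v ≈Z u
  ≈Z-sym (inj₁ eq) = inj₁ (sym eq)
  ≈Z-sym (inj₂ (a , b)) = inj₂ (b , a)

  ≈Z-trans : ∀ {u v w} → u ≈Z v → v ≈Z w → u ≈Z w
  ≈Z-trans (inj₁ refl) q = q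
  ≈Z-trans (inj₂ (a , b)) (inj₁ refl) = inj₂ (a , b)
  ≈Z-trans (inj₂ (a , b)) (inj₂ (c , d)) = inj₂ (a , d)

  ≈Z-cong : ∀ {u u' v v'} → u ≈Z u' → v ≈Z v' → (u ++ v) ≈Z (u' ++ v')
  ≈Z-cong {u} {u'} {v} {v'} (inj₂ (a , b)) _ =
    inj₂ (nf-ext-r u v a , nf-ext-r u' v' b)
  ≈Z-cong {u} {u'} {v} {v'} (inj₁ refl) (inj₂ (c , d)) =
    inj₂ (nf-ext-l u v c , nf-ext-l u v' d)
  ≈Z-cong (inj₁ refl) (inj₁ refl) = inj₁ refl

M-z∞ : Monoid 0ℓ 0ℓ
M-z∞ = record
  { Carrier = Word
  ; _≈_ = _≈Z_
  ; _∙_ = _++_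
  ; ε = []
  ; isMonoid = record
    { isSemigroup = record
      { isMagma = record
        { isEquivalence = record { refl = inj₁ refl ; sym = ≈Z-sym ; trans = ≈Z-trans }
        ; ∙-cong = ≈Z-cong }
      ; assoc = λ x y z → inj₁ (++-assoc x y z) }
    ; identity = (λ x → inj₁ (++-identityˡ x)) , (λ x → inj₁ (++-identityʳ x)) }
  }

𝕄z∞ : Class
𝕄z∞ = Var M-z∞

{-# OPTIONS --safe #-}
module Submission where

-- Let w_n be the product over i = 0, …, n of sᵢ Bᵢ tᵢ with Bᵢ = yᵢ yᵢ₋₁ yᵢ₊₁ yᵢ (letters out of range omitted),
-- and let w′_n have yᵢ yᵢ in place of Bᵢ.  In a factor of z∞ every second letter is x₀, and deleting x₀ gives a
-- factor of z∞ again, so by descent a substitution that sends w_n into z∞ erases every yᵢ; hence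
-- M(z∞) ⊨ w_n ≈ w′_n.  The Brandt monoid sees more: an assignment of partial maps of a two-element set traces a
-- path along a word, and for n ≡ 1 (mod 3) these paths determine w_n, so that the syntactic monoid N_n of {w_n}
-- lies in 𝔹₂¹.  An isoterm for B₂¹ is square-free because x² ≈ x³ holds there, whence N_n ⊨ x²y ≈ yx².
--
-- For k ≠ n each w_n ≈ w′_n holds in N_k: a factor U V U of w_k without separators is a whole block, so an
-- instance of w_n in w_k that keeps some yᵢ spreads to all of w_k and forces n = k.  As w_n ≈ w′_n fails in N_n,
-- these identities are independent over 𝔹₂¹ and x²y ≈ yx², which gives continuum many varieties.
--
-- If n is large compared with an identity u ≈ v of M(z∞), some two neighbouring chunks sᵢ Bᵢ tᵢ of an instance of u
-- in w_n lie inside the value of one letter.  Once they are contracted, the yᵢ can be removed one by one from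
-- the two ends towards the gap, each being free at its turn; so the rest of w_n is an isoterm for M(z∞),
-- and N_n ⊨ u ≈ v.  No finite set of identities of M(z∞) therefore implies w_n ≈ w′_n within 𝔹₂¹ for all n.

open import Defs
open import Level using (0ℓ)
open import Algebra.Bundles using (Monoid)
open import Data.Bool using (Bool; true; false; if_then_else_; T)
import Data.Bool.Properties as Bool
open import Data.Empty using (⊥-elim)
open import Data.List using (List; []; _∷_; _++_; concatMap; filterᵇ; length; map)
open import Data.List.Properties
  using (++-assoc; ++-identityʳ; ++-cancelˡ; ++-cancelʳ; ++-conicalˡ; ++-conicalʳ; ∷-injective; ∷-injectiveʳ;
         concatMap-++; concatMap-cong; concatMap-map; filter-++; map-++; length-++; length-map; ≡-dec)
open import Data.List.Relation.Unary.All as All using (All; []; _∷_)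
import Data.List.Relation.Unary.All.Properties as All
open import Data.List.Relation.Unary.AllPairs using ([]; _∷_)
open import Data.List.Relation.Unary.Any using (here; there)
open import Data.List.Relation.Unary.Unique.Propositional using (Unique)
import Data.List.Relation.Unary.Unique.Propositional.Properties as Unique
open import Data.List.Membership.Propositional using (_∈_)
open import Data.List.Membership.Propositional.Properties
  using (∈-++⁺ˡ; ∈-++⁺ʳ; ∈-++⁻; ∈-∃++; ∈-map⁺; ∈-map⁻)
open import Data.Maybe using (Maybe; just; nothing; is-just; _>>=_)
import Data.Maybe.Properties as Maybe
open import Data.Nat using (ℕ; zero; suc; _+_; _≤_; _<_; _<ᵇ_; _≤ᵇ_; z≤n; s≤s)
import Data.Nat as Nat
import Data.Nat.Properties as ℕ
open import Algebra.Properties.CommutativeSemigroup ℕ.+-commutativeSemigroup using (xy∙z≈xz∙y)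
open import Data.Product using (Σ-syntax; ∃; ∃₂; _×_; _,_; proj₁; proj₂; swap)
open import Data.Sum using (_⊎_; inj₁; inj₂)
open import Function using (_∘_; id)
open import Relation.Nullary using (¬_; yes; no; does)
open import Relation.Nullary.Decidable using (from-yes; map′; _×-dec_)
open import Relation.Binary using (DecidableEquality)
open import Relation.Binary.PropositionalEquality

-- The words must be isoterms for `B₂¹` but not for M(z∞). Every block has its own separators, so a
-- colouring of the yᵢ by edges on two vertices only has to kill no block. For `B₂¹` such colourings
-- combine freely: those using two consecutive letters fix how often each letter occurs in a block
-- and leave open only the order of yᵢ₋₁ and yᵢ₊₁, which one further colouring, `κ`, settles. For
-- M(z∞) the colourings must be nested (`Good`): each colours exactly the letters still present, and
-- one of these, coloured from `false` to `true`, is then dropped. No such sequence can exist for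
-- the intact w_n, as w_n ≈ w′_n holds in M(z∞). The colouring that drops the lowest letter relies
-- on right neighbours and may break at block n; the one that drops the highest relies on left
-- neighbours and may break at block 0. A gap spares both the far end. It takes two chunks, because
-- blocks b and b+1 are exactly those that contain letters from both sides of the cut between y_b
-- and y_{b+1}.

private variable
  A B I K : Set
  c d e : Bool
  u v w   : List A
  p q     : A → Bool

-- B₂¹ as partial maps of the two-element set Bool

act : B₂¹-El → Bool → Maybe Bool
act e1  c     = just c
act ea  false = just true
act eb  true  = just false
act eab false = just false
act eba true  = just true
act _   _     = nothing

elements : List B₂¹-El
elements = e1 ∷ ea ∷ eb ∷ eab ∷ eba ∷ e0 ∷ []

∈-elements : ∀ x → x ∈ elements
∈-elements e1  = here refl
∈-elements ea  = there (here refl)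
∈-elements eb  = there (there (here refl))
∈-elements eab = there (there (there (here refl)))
∈-elements eba = there (there (there (there (here refl))))
∈-elements e0  = there (there (there (there (there (here refl)))))

-- Maps compose from left to right, so that reading a word letter by letter traces a path. The 36
-- products are decided by evaluation.
act-· : ∀ x y c → act (x ·B y) c ≡ (act x c >>= act y)
act-· x y c = pick c (All.lookup (All.lookup table (∈-elements x)) (∈-elements y))
  where
  Hom : B₂¹-El → B₂¹-El → Bool → Set
  Hom x y c = act (x ·B y) c ≡ (act x c >>= act y)
  hom? : ∀ x y c → _
  hom? x y c = Maybe.≡-dec Bool._≟_ (act (x ·B y) c) (act x c >>= act y)
  table : All (λ x → All (λ y → Hom x y false × Hom x y true) elements) elements
  table = from-yes (All.all? (λ x → All.all? (λ y → hom? x y false ×-dec hom? x y true) elements) elements)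
  pick : ∀ c → Hom x y false × Hom x y true → Hom x y c
  pick false = proj₁
  pick true  = proj₂

prod : (A → B₂¹-El) → List A → B₂¹-El
prod χ []      = e1
prod χ (z ∷ w) = χ z ·B prod χ w

prod-++ : (χ : A → B₂¹-El) (u v : List A) → prod χ (u ++ v) ≡ prod χ u ·B prod χ v
prod-++ χ []      v = sym (·B-identityˡ _)
prod-++ χ (z ∷ u) v = trans (cong (χ z ·B_) (prod-++ χ u v)) (sym (·B-assoc (χ z) _ _))

prod-cong : {χ χ′ : A → B₂¹-El} → (∀ z → z ∈ w → χ z ≡ χ′ z) → prod χ w ≡ prod χ′ w
prod-cong {w = []}    eq = refl
prod-cong {w = z ∷ w} eq = cong₂ _·B_ (eq z (here refl)) (prod-cong (λ z′ i → eq z′ (there i)))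

prod-concatMap : {B : Set} (χ : B → B₂¹-El) (θ : A → List B) (w : List A) →
                 prod χ (concatMap θ w) ≡ prod (prod χ ∘ θ) w
prod-concatMap χ θ []      = refl
prod-concatMap χ θ (z ∷ w) =
  trans (prod-++ χ (θ z) _) (cong (prod χ (θ z) ·B_) (prod-concatMap χ θ w))

-- A letter is either ignored or an edge of the graph with vertex set Bool.
Colour : Set
Colour = Maybe (Bool × Bool)

pattern _⟶_ c d = just (c , d)

el : Colour → B₂¹-El
el nothing           = e1
el (false ⟶ true)  = ea
el (true  ⟶ false) = eb
el (false ⟶ false) = eab
el (true  ⟶ true)  = eba

data Step : Colour → Bool → Bool → Set where
  stay : ∀ {c} → Step nothing c c
  move : ∀ {c d} → Step (c ⟶ d) c d

data Path {A : Set} (χ : A → Colour) : List A → Bool → Bool → Set where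
  []  : ∀ {c} → Path χ [] c c
  _∷_ : ∀ {z w c d e} → Step (χ z) c d → Path χ w d e → Path χ (z ∷ w) c e

step⇒act : ∀ {k} → Step k c d → act (el k) c ≡ just d
step⇒act stay = refl
step⇒act {false} {false} move = refl
step⇒act {false} {true}  move = refl
step⇒act {true}  {false} move = refl
step⇒act {true}  {true}  move = refl

act⇒step : ∀ k → act (el k) c ≡ just d → Step k c d
act⇒step nothing refl = stay
act⇒step {false} (false ⟶ false) refl = move
act⇒step {false} (false ⟶ true)  refl = move
act⇒step {true}  (true  ⟶ false) refl = move
act⇒step {true}  (true  ⟶ true)  refl = move

path⇒act : {χ : A → Colour} → Path χ w c d → act (prod (el ∘ χ) w) c ≡ just d
path⇒act [] = refl
path⇒act {c = c} {χ = χ} (_∷_ {z} {w} σ π)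
  rewrite act-· (el (χ z)) (prod (el ∘ χ) w) c | step⇒act σ = path⇒act π

act⇒path : {χ : A → Colour} (w : List A) → act (prod (el ∘ χ) w) c ≡ just d → Path χ w c d
act⇒path [] refl = []
act⇒path {c = c} {χ = χ} (z ∷ w) eq
  rewrite act-· (el (χ z)) (prod (el ∘ χ) w) c with act (el (χ z)) c in step
... | just _ = act⇒step (χ z) step ∷ act⇒path w eq

path-++ : {χ : A → Colour} → Path χ w c d → Path χ v d e → Path χ (w ++ v) c e
path-++ []      ρ = ρ
path-++ (σ ∷ π) ρ = σ ∷ path-++ π ρ

path-split : {χ : A → Colour} (w : List A) → Path χ (w ++ v) c e →
             ∃ λ d → Path χ w c d × Path χ v d e
path-split []      π       = _ , [] , π
path-split (z ∷ w) (σ ∷ π) with _ , ρ , τ ← path-split w π = _ , σ ∷ ρ , τ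

-- This is the identity w ≈ v of `B₂¹` over an arbitrary alphabet; structured letters are coded as
-- numbers only at the very end.
_∼_ : List A → List A → Set
w ∼ v = ∀ χ → prod χ w ≡ prod χ v

path-∼ : {χ : A → Colour} → w ∼ v → Path χ w c d → Path χ v c d
path-∼ {v = v} {χ = χ} w∼v π =
  act⇒path v (trans (cong (λ x → act x _) (sym (w∼v (el ∘ χ)))) (path⇒act π))

-- Zimin words

expand : Word → Word
expand = concatMap (λ a → suc a ∷ 0 ∷ [])

shrink : Word → Word
shrink []          = []
shrink (zero  ∷ w) = shrink w
shrink (suc a ∷ w) = a ∷ shrink w

shrink-++ : ∀ u v → shrink (u ++ v) ≡ shrink u ++ shrink v
shrink-++ []          v = refl
shrink-++ (zero  ∷ u) v = shrink-++ u v
shrink-++ (suc a ∷ u) v = cong (a ∷_) (shrink-++ u v)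

shrink-concatMap : (θ : A → Word) (w : List A) →
                   shrink (concatMap θ w) ≡ concatMap (shrink ∘ θ) w
shrink-concatMap θ []      = refl
shrink-concatMap θ (z ∷ w) =
  trans (shrink-++ (θ z) _) (cong (shrink (θ z) ++_) (shrink-concatMap θ w))

shrink-expand : ∀ w → shrink (expand w) ≡ w
shrink-expand []      = refl
shrink-expand (a ∷ w) = cong (a ∷_) (shrink-expand w)

-- The definition inserts the new letter in the middle. This other recursion raises all indices and
-- interleaves x₀; the inductions below run on it.
zimin-suc : ∀ n → zimin (suc n) ≡ 0 ∷ expand (zimin n)
zimin-suc zero    = refl
zimin-suc (suc n) = begin
  zimin (suc n) ++ (suc (suc n) ∷ zimin (suc n))
    ≡⟨ cong (λ z → z ++ (suc (suc n) ∷ z)) (zimin-suc n) ⟩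
  0 ∷ (expand (zimin n) ++ expand (suc n ∷ zimin n))
    ≡⟨ cong (0 ∷_) (sym (concatMap-++ _ (zimin n) _)) ⟩
  0 ∷ expand (zimin (suc n)) ∎
  where open ≡-Reasoning

alternate : ℕ → Colour
alternate zero    = false ⟶ true
alternate (suc _) = true  ⟶ false

path-expand : ∀ w → Path alternate (expand w) true true
path-expand []      = []
path-expand (a ∷ w) = move ∷ move ∷ path-expand w

path-zimin : ∀ n → Path alternate (zimin n) false true
path-zimin zero    = move ∷ []
path-zimin (suc n) rewrite zimin-suc n = move ∷ path-expand (zimin n)

path⇒expand : Path alternate w true true → w ≡ expand (shrink w)
path⇒expand [] = refl
path⇒expand (_∷_ {suc a} move (_∷_ {zero} move π)) = cong (λ v → suc a ∷ 0 ∷ v) (path⇒expand π)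

path⇒expand-prefix : Path alternate w true d → ∃ λ s → w ++ s ≡ expand (shrink w)
path⇒expand-prefix [] = [] , refl
path⇒expand-prefix (_∷_ {suc a} move []) = 0 ∷ [] , refl
path⇒expand-prefix (_∷_ {suc a} move (_∷_ {zero} move π)) with s , eq ← path⇒expand-prefix π =
  s , cong (λ v → suc a ∷ 0 ∷ v) eq

path⇒0∷expand : Path alternate w false true → w ≡ 0 ∷ expand (shrink w)
path⇒0∷expand (_∷_ {zero} move π) = cong (0 ∷_) (path⇒expand π)

Factor : Word → Word → Set
Factor u w = Σ[ p ∈ Word ] Σ[ s ∈ Word ] p ++ (u ++ s) ≡ w

shrink-factor : ∀ {u w} → Factor u w → Factor (shrink u) (shrink w)
shrink-factor {u} (p , s , refl) =
  shrink p , shrink s , sym (trans (shrink-++ p _) (cong (shrink p ++_) (shrink-++ u s)))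

shrink-zimin : ∀ n → shrink (zimin (suc n)) ≡ zimin n
shrink-zimin n = trans (cong shrink (zimin-suc n)) (shrink-expand (zimin n))

factor⇒path : ∀ {u} → IsFactor u → ∃₂ (Path alternate u)
factor⇒path {u} (n , p , s , eq)
  with _ , _ , π ← path-split p (subst (λ z → Path alternate z false true) (sym eq) (path-zimin n))
  with _ , ρ , _ ← path-split u π = _ , _ , ρ

0∷expand-snoc : ∀ p → ∃ λ q → 0 ∷ expand p ≡ q ++ (0 ∷ [])
0∷expand-snoc []      = [] , refl
0∷expand-snoc (a ∷ p) with q , eq ← 0∷expand-snoc p = 0 ∷ suc a ∷ q , cong (λ v → 0 ∷ suc a ∷ v) eq

-- Together with `factor⇒path` and `shrink-factor` this characterises factors of z∞: alternation
-- plus a shrunken factor. If u starts with x₀, that letter is the last one of `0 ∷ expand p`;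
-- otherwise u follows `0 ∷ expand p`. The word r supplies the final x₀ that u may lack.
unshrink-factor : ∀ {u} → Path alternate u c d → IsFactor (shrink u) → IsFactor u
unshrink-factor [] _ = 0 , [] , 0 ∷ [] , refl
unshrink-factor {true} {u = u} π (n , p , s , eq) with r , eq′ ← path⇒expand-prefix π =
  suc n , 0 ∷ expand p , r ++ expand s , (begin
    0 ∷ (expand p ++ (u ++ (r ++ expand s)))       ≡⟨ cong (λ v → 0 ∷ (expand p ++ v)) (sym (++-assoc u r _)) ⟩
    0 ∷ (expand p ++ ((u ++ r) ++ expand s))       ≡⟨ cong (λ v → 0 ∷ (expand p ++ (v ++ expand s))) eq′ ⟩
    0 ∷ (expand p ++ (expand (shrink u) ++ expand s)) ≡⟨ cong (λ v → 0 ∷ (expand p ++ v)) (sym (concatMap-++ _ (shrink u) s)) ⟩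
    0 ∷ (expand p ++ expand (shrink u ++ s))       ≡⟨ cong (0 ∷_) (sym (concatMap-++ _ p _)) ⟩
    0 ∷ expand (p ++ (shrink u ++ s))              ≡⟨ cong (λ v → 0 ∷ expand v) eq ⟩
    0 ∷ expand (zimin n)                           ≡⟨ sym (zimin-suc n) ⟩
    zimin (suc n) ∎)
  where open ≡-Reasoning
unshrink-factor {false} (_∷_ {zero} {u} move π) (n , p , s , eq)
  with r , eq′ ← path⇒expand-prefix π | q , eq″ ← 0∷expand-snoc p =
  suc n , q , r ++ expand s , (begin
    q ++ ((0 ∷ u) ++ (r ++ expand s))              ≡⟨ sym (++-assoc q (0 ∷ []) _) ⟩
    (q ++ (0 ∷ [])) ++ (u ++ (r ++ expand s))      ≡⟨ cong₂ _++_ (sym eq″) (sym (++-assoc u r _)) ⟩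
    0 ∷ (expand p ++ ((u ++ r) ++ expand s))       ≡⟨ cong (λ v → 0 ∷ (expand p ++ (v ++ expand s))) eq′ ⟩
    0 ∷ (expand p ++ (expand (shrink u) ++ expand s)) ≡⟨ cong (λ v → 0 ∷ (expand p ++ v)) (sym (concatMap-++ _ (shrink u) s)) ⟩
    0 ∷ (expand p ++ expand (shrink u ++ s))       ≡⟨ cong (0 ∷_) (sym (concatMap-++ _ p _)) ⟩
    0 ∷ expand (p ++ (shrink u ++ s))              ≡⟨ cong (λ v → 0 ∷ expand v) eq ⟩
    0 ∷ expand (zimin n)                           ≡⟨ sym (zimin-suc n) ⟩
    zimin (suc n) ∎)
  where open ≡-Reasoning

_◂_ : B₂¹-El → (ℕ → B₂¹-El) → ℕ → B₂¹-El
(x ◂ χ) zero    = x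
(x ◂ χ) (suc a) = χ a

prod-shrink : ∀ χ w → prod (e1 ◂ χ) w ≡ prod χ (shrink w)
prod-shrink χ []          = refl
prod-shrink χ (zero  ∷ w) = trans (·B-identityˡ _) (prod-shrink χ w)
prod-shrink χ (suc a ∷ w) = cong (χ a ·B_) (prod-shrink χ w)

shrink-∼ : w ∼ v → shrink w ∼ shrink v
shrink-∼ {w} {v} w∼v χ =
  trans (sym (prod-shrink χ w)) (trans (w∼v (e1 ◂ χ)) (prod-shrink χ v))

e0·B : ∀ x → e0 ·B x ≡ e0
e0·B e1  = refl
e0·B ea  = refl
e0·B eb  = refl
e0·B eab = refl
e0·B eba = refl
e0·B e0  = refl

[]∼⇒[] : [] ∼ w → w ≡ []
[]∼⇒[] {w = []}    _   = refl
[]∼⇒[] {w = z ∷ w} []∼ with () ← trans ([]∼ (λ _ → e0)) (e0·B _)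

-- The colouring `alternate` forces x₀ into every second place of w, and setting x₀ to 1 leaves the
-- same claim for the preceding Zimin word.
zimin-isoterm : ∀ n → zimin n ∼ w → w ≡ zimin n
zimin-isoterm {w} zero z∼w =
  trans (path⇒0∷expand (path-∼ z∼w (path-zimin 0)))
        (cong (λ v → 0 ∷ expand v) ([]∼⇒[] {w = shrink w} (shrink-∼ {0 ∷ []} {w} z∼w)))
zimin-isoterm {w} (suc n) z∼w = begin
  w                      ≡⟨ path⇒0∷expand (path-∼ z∼w (path-zimin (suc n))) ⟩
  0 ∷ expand (shrink w)  ≡⟨ cong (λ v → 0 ∷ expand v) (zimin-isoterm {shrink w} n (subst (_∼ shrink w) (shrink-zimin n) (shrink-∼ {zimin (suc n)} {w} z∼w))) ⟩
  0 ∷ expand (zimin n)   ≡⟨ sym (zimin-suc n) ⟩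
  zimin (suc n)          ∎
  where open ≡-Reasoning

-- Words determined by nested colourings

-- A good word is built up by inserting one letter x at a time: relative to the letters already present,
-- the places of x are forced because x is the only edge from false to true that the colouring adds.
-- (p selects the letters present so far.)
data Good {A : Set} (w : List A) : (A → Bool) → Set where
  none   : ∀ {p} → filterᵇ p w ≡ [] → Good w p
  insert : ∀ {p q} x χ {c d} → χ x ≡ (false ⟶ true) →
           (∀ z → p z ≡ is-just (χ z)) →
           q x ≡ false → (∀ z → p z ≡ true → z ≡ x ⊎ q z ≡ true) → (∀ z → q z ≡ true → p z ≡ true) →
           Path χ w c d → Good w q → Good w p

filterᵇ-true : ∀ (p : A → Bool) z w → p z ≡ true → filterᵇ p (z ∷ w) ≡ z ∷ filterᵇ p w
filterᵇ-true p z w pz rewrite pz = refl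

filterᵇ-false : ∀ (p : A → Bool) z w → p z ≡ false → filterᵇ p (z ∷ w) ≡ filterᵇ p w
filterᵇ-false p z w pz rewrite pz = refl

filterᵇ-⊆ : (∀ z → q z ≡ true → p z ≡ true) → ∀ w → filterᵇ q (filterᵇ p w) ≡ filterᵇ q w
filterᵇ-⊆ q⊆p [] = refl
filterᵇ-⊆ {q = q} {p = p} q⊆p (z ∷ w) with p z in pz | q z in qz
... | true  | true  rewrite qz = cong (z ∷_) (filterᵇ-⊆ q⊆p w)
... | true  | false rewrite qz = filterᵇ-⊆ q⊆p w
... | false | false = filterᵇ-⊆ q⊆p w
... | false | true  with () ← trans (sym pz) (q⊆p z qz)

filterᵇ-All : ∀ (p : A → Bool) w → All (λ z → p z ≡ true) (filterᵇ p w)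
filterᵇ-All p [] = []
filterᵇ-All p (z ∷ w) with p z in pz
... | true  = pz ∷ filterᵇ-All p w
... | false = filterᵇ-All p w

path-filterᵇ : {χ : A → Colour} → (∀ z → p z ≡ is-just (χ z)) →
               Path χ w c d → Path χ (filterᵇ p w) c d
path-filterᵇ p≡ [] = []
path-filterᵇ {χ = χ} p≡ (_∷_ {z} σ π) rewrite p≡ z with χ z in χz
... | just _ = subst (λ k → Step k _ _) (sym χz) σ ∷ path-filterᵇ p≡ π
path-filterᵇ {χ = χ} p≡ (_∷_ {z} stay π) | nothing = path-filterᵇ p≡ π

path-unfilterᵇ : {χ : A → Colour} → (∀ z → p z ≡ is-just (χ z)) → (w : List A) →
                 Path χ (filterᵇ p w) c d → Path χ w c d
path-unfilterᵇ p≡ [] π = π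
path-unfilterᵇ {χ = χ} p≡ (z ∷ w) π rewrite p≡ z with χ z in χz
path-unfilterᵇ {χ = χ} p≡ (z ∷ w) (σ ∷ π) | just _ = σ ∷ path-unfilterᵇ p≡ w π
... | nothing = subst (λ k → Step k _ _) (sym χz) stay ∷ path-unfilterᵇ p≡ w π

module Insertion {A : Set} {p q : A → Bool} (x : A) (χ : A → Colour)
  (χx : χ x ≡ (false ⟶ true)) (p≡ : ∀ z → p z ≡ is-just (χ z)) (qx : q x ≡ false)
  (split : ∀ z → p z ≡ true → z ≡ x ⊎ q z ≡ true) where

  private
    ft : ∀ {c d} → Step (χ x) c d → c ≡ false × d ≡ true
    ft σ rewrite χx with move ← σ = refl , refl

    step-det : ∀ z {c d c′ d′} → p z ≡ true → Step (χ z) c d → Step (χ z) c′ d′ → c ≡ c′ × d ≡ d′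
    step-det z pz σ τ rewrite p≡ z with χ z
    step-det z pz move move | just _ = refl , refl

    next : ∀ {w z r d} → All (λ z → p z ≡ true) w → Path χ w true d →
           filterᵇ q w ≡ z ∷ r → p z ≡ true → ∀ {e} → ¬ Step (χ z) false e
    next {z′ ∷ w} (pz′ ∷ _) (σ ∷ π) eq pz τ with split z′ pz′
    ... | inj₁ refl with () ← proj₁ (ft σ)
    ... | inj₂ qz′ with refl ← proj₁ (∷-injective (trans (sym (filterᵇ-true q z′ w qz′)) eq))
          with () ← proj₁ (step-det z′ pz′ σ τ)

    -- Where the path stands before a common next letter decides whether an x comes first.
    nothing-left : ∀ {z w c d} → All (λ z → p z ≡ true) (z ∷ w) → Path χ (z ∷ w) c d →
                   filterᵇ q (z ∷ w) ≡ [] → c ≡ false × d ≡ true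
    nothing-left {z} {w} (pz ∷ pw) (σ ∷ π) eq with split z pz
    ... | inj₂ qz with () ← trans (sym (filterᵇ-true q z w qz)) eq
    ... | inj₁ refl with refl , refl ← ft σ with w | π | pw
    ...   | [] | [] | _ = refl , refl
    ...   | _ ∷ _ | π | pw with () ← proj₁ (nothing-left pw π (trans (sym (filterᵇ-false q x _ qx)) eq))

  -- Two x never stand side by side. If one word continues with x and the other with a letter z kept
  -- by `q`, then z is read from `true` in the first, where it follows x, and from `false` in the
  -- second.
  insertion-unique : ∀ {w v c d} → All (λ z → p z ≡ true) w → All (λ z → p z ≡ true) v →
                     Path χ w c d → Path χ v c d → filterᵇ q w ≡ filterᵇ q v → w ≡ v
  insertion-unique {[]} {[]} _ _ _ _ _ = refl
  insertion-unique {[]} {_ ∷ _} _ pv [] ρ eq with refl , () ← nothing-left pv ρ (sym eq)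
  insertion-unique {_ ∷ _} {[]} pw _ π [] eq with refl , () ← nothing-left pw π eq
  insertion-unique {z ∷ w} {z′ ∷ v} (pz ∷ pw) (pz′ ∷ pv) (σ ∷ π) (τ ∷ ρ) eq
    with split z pz | split z′ pz′
  ... | inj₁ refl | inj₁ refl with refl , refl ← ft σ | _ , refl ← ft τ =
        cong (x ∷_) (insertion-unique pw pv π ρ
          (trans (sym (filterᵇ-false q x w qx)) (trans eq (filterᵇ-false q x v qx))))
  ... | inj₁ refl | inj₂ qz′ with refl , refl ← ft σ =
        ⊥-elim (next pw π (trans (sym (filterᵇ-false q x w qx)) (trans eq (filterᵇ-true q z′ v qz′))) pz′ τ)
  ... | inj₂ qz | inj₁ refl with refl , refl ← ft τ =
        ⊥-elim (next pv ρ (trans (sym (filterᵇ-false q x v qx)) (trans (sym eq) (filterᵇ-true q z w qz))) pz σ)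
  ... | inj₂ qz | inj₂ qz′
        with refl , eq′ ← ∷-injective (trans (sym (filterᵇ-true q z w qz)) (trans eq (filterᵇ-true q z′ v qz′)))
        with refl ← proj₂ (step-det z pz σ τ) = cong (z ∷_) (insertion-unique pw pv π ρ eq′)

  insertion-filter : ∀ {w v c d} → (∀ z → q z ≡ true → p z ≡ true) → Path χ w c d → Path χ v c d →
                     filterᵇ q w ≡ filterᵇ q v → filterᵇ p w ≡ filterᵇ p v
  insertion-filter {w} {v} q⊆p π ρ eq =
    insertion-unique (filterᵇ-All p w) (filterᵇ-All p v) (path-filterᵇ p≡ π) (path-filterᵇ p≡ ρ)
      (trans (filterᵇ-⊆ q⊆p w) (trans eq (sym (filterᵇ-⊆ q⊆p v))))

concatMap-[] : {B : Set} (p : A → Bool) (θ : A → List B) → (∀ z → p z ≡ false → θ z ≡ []) →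
               ∀ w → filterᵇ p w ≡ [] → concatMap θ w ≡ []
concatMap-[] p θ θ[] [] _ = refl
concatMap-[] p θ θ[] (z ∷ w) eq with p z in pz
... | false = trans (cong (_++ concatMap θ w) (θ[] z pz)) (concatMap-[] p θ θ[] w eq)

good⇒isoterm-B : Good w p → w ∼ v → filterᵇ p w ≡ filterᵇ p v
good⇒isoterm-B {w = w} {p = p} {v = v} (none eq) w∼v = trans eq (sym (absent v v∼))
  where
  -- Sending the letters of `p` to 0 and all others to 1 detects whether one of them occurs.
  χ = λ z → if p z then e0 else e1
  trivial : ∀ u → filterᵇ p u ≡ [] → prod χ u ≡ e1
  trivial [] _ = refl
  trivial (z ∷ u) eq with p z
  ... | false = trans (·B-identityˡ _) (trivial u eq)
  v∼ : prod χ v ≡ e1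
  v∼ = trans (sym (w∼v χ)) (trivial w eq)
  absent : ∀ u → prod χ u ≡ e1 → filterᵇ p u ≡ []
  absent [] _ = refl
  absent (z ∷ u) eq with p z
  ... | false = absent u (trans (sym (·B-identityˡ _)) eq)
  ... | true  with () ← trans (sym (e0·B (prod χ u))) eq
good⇒isoterm-B {w = w} {v = v} (insert x χ χx p≡ qx split q⊆p π good) w∼v =
  Insertion.insertion-filter x χ χx p≡ qx split q⊆p π (path-∼ {v = v} w∼v π) (good⇒isoterm-B {v = v} good w∼v)

-- Isoterms for M(z∞)

-- For w over ℕ, M(z∞) ⊨ (w , v) amounts to w ≲ v and v ≲ w.
_≲_ : List A → List A → Set
w ≲ v = ∀ (ψ : _ → Word) → IsFactor (concatMap ψ w) → concatMap ψ v ≡ concatMap ψ w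

-- A new letter x of colour (false ⟶ true) is sent to x₀; the image of any other letter is shifted
-- and interleaved with x₀, beginning and ending with x₀ or not as its colour prescribes.
padᵗ : Word → Bool → Word
padᵗ []                r = []
padᵗ (a ∷ [])          r = suc a ∷ (if r then 0 ∷ [] else [])
padᵗ (a ∷ m@(_ ∷ _))   r = suc a ∷ 0 ∷ padᵗ m r

paint : Colour → Word → Word
paint nothing   m = []
paint (false ⟶ r) m = 0 ∷ padᵗ m r
paint (true  ⟶ r) m = padᵗ m r

data Paintable : Colour → Word → Set where
  blank  : Paintable nothing []
  letter : Paintable (false ⟶ true) []
  other  : ∀ {k a m} → Paintable (just k) (a ∷ m)

shrink-padᵗ : ∀ r a m → shrink (padᵗ (a ∷ m) r) ≡ a ∷ m
shrink-padᵗ false a []      = refl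
shrink-padᵗ true  a []      = refl
shrink-padᵗ false a (b ∷ m) = cong (a ∷_) (shrink-padᵗ false b m)
shrink-padᵗ true  a (b ∷ m) = cong (a ∷_) (shrink-padᵗ true b m)

shrink-paint : ∀ {k m} → Paintable k m → shrink (paint k m) ≡ m
shrink-paint blank  = refl
shrink-paint letter = refl
shrink-paint (other {false , r} {a} {m}) = shrink-padᵗ r a m
shrink-paint (other {true  , r} {a} {m}) = shrink-padᵗ r a m

path-padᵗ : ∀ r a m → Path alternate (padᵗ (a ∷ m) r) true r
path-padᵗ false a []      = move ∷ []
path-padᵗ true  a []      = move ∷ move ∷ []
path-padᵗ false a (b ∷ m) = move ∷ move ∷ path-padᵗ false b m
path-padᵗ true  a (b ∷ m) = move ∷ move ∷ path-padᵗ true b m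

path-paint : ∀ {k m} → Paintable k m → Step k c d → Path alternate (paint k m) c d
path-paint blank  stay = []
path-paint letter move = move ∷ []
path-paint (other {false , r} {a} {m}) move = move ∷ path-padᵗ r a m
path-paint (other {true  , r} {a} {m}) move = path-padᵗ r a m

alternate-det : ∀ {u c d c′ d′} → Path alternate u c d → Path alternate u c′ d′ →
                u ≡ [] ⊎ (c ≡ c′ × d ≡ d′)
alternate-det [] _ = inj₁ refl
alternate-det (_∷_ {zero} move π) (move ∷ ρ) with alternate-det π ρ
alternate-det (_∷_ {zero} move []) (move ∷ []) | inj₁ refl = inj₂ (refl , refl)
... | inj₂ (_ , refl) = inj₂ (refl , refl)
alternate-det (_∷_ {suc _} move π) (move ∷ ρ) with alternate-det π ρ
alternate-det (_∷_ {suc _} move []) (move ∷ []) | inj₁ refl = inj₂ (refl , refl)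
... | inj₂ (_ , refl) = inj₂ (refl , refl)

paint≢[] : ∀ {k m} → Paintable (just k) m → paint (just k) m ≢ []
paint≢[] letter ()
paint≢[] (other {false , _}) ()
paint≢[] (other {true , _} {m = []}) ()
paint≢[] (other {true , _} {m = _ ∷ _}) ()

path-paint⁻¹ : ∀ {k m} → Paintable k m → Path alternate (paint k m) c d → Step k c d
path-paint⁻¹ blank [] = stay
path-paint⁻¹ {k = l ⟶ r} φ π with alternate-det (path-paint φ move) π
... | inj₁ eq = ⊥-elim (paint≢[] φ eq)
... | inj₂ (refl , refl) = move

record Embedding {A : Set} (w : List A) (p : A → Bool) : Set where
  field
    ψ      : A → Word
    alive  : ∀ z → p z ≡ true → ψ z ≢ []
    dead   : ∀ z → p z ≡ false → ψ z ≡ []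
    factor : IsFactor (concatMap ψ w)

module Extend {A : Set} {p q : A → Bool} {w : List A} (x : A) (χ : A → Colour)
  (χx : χ x ≡ (false ⟶ true)) (p≡ : ∀ z → p z ≡ is-just (χ z)) (qx : q x ≡ false)
  (split : ∀ z → p z ≡ true → z ≡ x ⊎ q z ≡ true) (q⊆p : ∀ z → q z ≡ true → p z ≡ true)
  {c d} (π : Path χ w c d) (E : Embedding w q) where
  open Embedding E

  private
    ignored : ∀ {k} → is-just k ≡ false → Paintable k []
    ignored {nothing} _ = blank

    coloured : ∀ {k m} → is-just k ≡ true → m ≢ [] → Paintable k m
    coloured {just _} {[]}    _ m≢[] = ⊥-elim (m≢[] refl)
    coloured {just _} {_ ∷ _} _ _    = other

    paintable : ∀ z → Paintable (χ z) (ψ z)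
    paintable z with p z in pz | q z in qz
    ... | _     | true  = coloured (trans (sym (p≡ z)) (q⊆p z qz)) (alive z qz)
    ... | false | false = subst (Paintable (χ z)) (sym (dead z qz)) (ignored (trans (sym (p≡ z)) pz))
    ... | true  | false with split z pz
    ...   | inj₁ refl = subst₂ Paintable (sym χx) (sym (dead x qx)) letter
    ...   | inj₂ qz′ with () ← trans (sym qz) qz′

  ψ′ : A → Word
  ψ′ z = paint (χ z) (ψ z)

  path-ψ′ : ∀ {v c d} → Path χ v c d → Path alternate (concatMap ψ′ v) c d
  path-ψ′ [] = []
  path-ψ′ (_∷_ {z} σ π) = path-++ (path-paint (paintable z) σ) (path-ψ′ π)

  -- A nonempty alternating word determines its two end vertices, and coloured letters have nonempty
  -- images; hence alternation of the image gives back a path for χ.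
  path-ψ′⁻¹ : ∀ v {c d} → Path alternate (concatMap ψ′ v) c d → Path χ v c d
  path-ψ′⁻¹ [] [] = []
  path-ψ′⁻¹ (z ∷ v) π with _ , ρ , σ ← path-split (ψ′ z) π =
    path-paint⁻¹ (paintable z) ρ ∷ path-ψ′⁻¹ v σ

  concatMap-shrink : ∀ v → shrink (concatMap ψ′ v) ≡ concatMap ψ v
  concatMap-shrink [] = refl
  concatMap-shrink (z ∷ v) =
    trans (shrink-++ (ψ′ z) _) (cong₂ _++_ (shrink-paint (paintable z)) (concatMap-shrink v))

  extension : Embedding w p
  extension = record
    { ψ = ψ′
    ; alive = λ z pz → alive′ z (trans (sym (p≡ z)) pz) (paintable z)
    ; dead = λ z pz → dead′ z (trans (sym (p≡ z)) pz)
    ; factor = unshrink-factor (path-ψ′ π) (subst IsFactor (sym (concatMap-shrink w)) factor) }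
    where
    alive′ : ∀ z → is-just (χ z) ≡ true → Paintable (χ z) (ψ z) → ψ′ z ≢ []
    alive′ z j φ with just _ ← χ z = paint≢[] φ
    dead′ : ∀ z → is-just (χ z) ≡ false → ψ′ z ≡ []
    dead′ z j with nothing ← χ z = refl

-- Each insertion climbs one level in z∞: the image so far moves to x₁, x₂, ... and the inserted
-- letter takes the place of x₀.
good⇒embedding : Good w p → Embedding w p
good⇒embedding {w = w} {p = p} (none eq) = record
  -- The letters of `p` do not occur in w, so any nonempty value keeps them alive without changing
  -- the image.
  { ψ = λ z → if p z then 0 ∷ [] else []
  ; alive = λ z pz → subst (λ b → (if b then 0 ∷ [] else []) ≢ []) (sym pz) (λ ())
  ; dead = dead
  ; factor = subst IsFactor (sym (concatMap-[] p _ dead w eq)) (0 , [] , 0 ∷ [] , refl) }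
  where
  dead : ∀ z → p z ≡ false → (if p z then 0 ∷ [] else []) ≡ []
  dead z pz rewrite pz = refl
good⇒embedding (insert x χ χx p≡ qx split q⊆p π good) =
  Extend.extension x χ χx p≡ qx split q⊆p π (good⇒embedding good)

good⇒isoterm-Z : Good w p → w ≲ v → filterᵇ p w ≡ filterᵇ p v
good⇒isoterm-Z {w = w} {p = p} {v = v} good@(none eq) w≲v =
  trans eq (sym (absent v (trans (w≲v ψ factor) (concatMap-[] p ψ dead w eq))))
  where
  open Embedding (good⇒embedding good)
  absent : ∀ u → concatMap ψ u ≡ [] → filterᵇ p u ≡ []
  absent [] _ = refl
  absent (z ∷ u) eq with p z
  ... | false = absent u eq
good⇒isoterm-Z {w = w} {v = v} (insert x χ χx p≡ qx split q⊆p π good) w≲v =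
  Insertion.insertion-filter x χ χx p≡ qx split q⊆p π
    (path-ψ′⁻¹ v (subst (λ u → Path alternate u _ _) (sym (w≲v ψ′ (Embedding.factor extension))) (path-ψ′ π)))
    (good⇒isoterm-Z {v = v} good w≲v)
  where open Extend x χ χx p≡ qx split q⊆p π (good⇒embedding good)

module _ (_≟_ : DecidableEquality A) where

  private
    module First (p : A → Bool) (x : A) where
      rest : A → Bool
      rest z = if does (z ≟ x) then false else p z

      χ : A → Colour
      χ z = if p z then (if does (z ≟ x) then (false ⟶ true) else (true ⟶ true)) else nothing

      p≡ : ∀ z → p z ≡ is-just (χ z)
      p≡ z with p z | z ≟ x
      ... | true  | yes _ = refl
      ... | true  | no _  = refl
      ... | false | _     = refl

      restx : rest x ≡ false
      restx with x ≟ x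
      ... | yes _ = refl
      ... | no x≢x = ⊥-elim (x≢x refl)

      χx : p x ≡ true → χ x ≡ (false ⟶ true)
      χx px rewrite px with x ≟ x
      ... | yes _ = refl
      ... | no x≢x = ⊥-elim (x≢x refl)

      χ≢x : ∀ z → p z ≡ true → x ≢ z → χ z ≡ (true ⟶ true)
      χ≢x z pz x≢z rewrite pz with z ≟ x
      ... | yes z≡x = ⊥-elim (x≢z (sym z≡x))
      ... | no _ = refl

      split : ∀ z → p z ≡ true → z ≡ x ⊎ rest z ≡ true
      split z pz with z ≟ x
      ... | yes z≡x = inj₁ z≡x
      ... | no _    = inj₂ pz

      q⊆p : ∀ z → rest z ≡ true → p z ≡ true
      q⊆p z qz with z ≟ x
      ... | no _ = qz

      loops : ∀ r → All (λ z → p z ≡ true) r → All (x ≢_) r → Path χ r true true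
      loops [] _ _ = []
      loops (z ∷ r) (pz ∷ pr) (x≢z ∷ x≢r) =
        subst (λ k → Step k true true) (sym (χ≢x z pz x≢z)) move ∷ loops r pr x≢r

      q-≢ : ∀ r → All (x ≢_) r → All (λ z → p z ≡ true) r → filterᵇ rest r ≡ r
      q-≢ [] _ _ = refl
      q-≢ (z ∷ r) (x≢z ∷ x≢r) (pz ∷ pr) with split z pz
      ... | inj₁ z≡x = ⊥-elim (x≢z (sym z≡x))
      ... | inj₂ qz  = trans (filterᵇ-true rest z r qz) (cong (z ∷_) (q-≢ r x≢r pr))

  -- The first of the remaining letters gets the edge from `false` to `true`, all later ones get
  -- loops at `true`; then the first is dropped.
  distinct⇒good : ∀ {w p r} → filterᵇ p w ≡ r → Unique r → Good w p
  distinct⇒good eq [] = none eq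
  distinct⇒good {w} {p} {x ∷ r} eq (x≢r ∷ unique) with px ∷ pr ← subst (All _) eq (filterᵇ-All p w) =
    insert x χ (χx px) p≡ restx split q⊆p
      (path-unfilterᵇ p≡ w (subst (λ u → Path χ u false true) (sym eq)
        (subst (λ k → Step k false true) (sym (χx px)) move ∷ loops r pr x≢r)))
      (distinct⇒good
        (trans (sym (filterᵇ-⊆ q⊆p w)) (trans (cong (filterᵇ rest) eq) (trans (filterᵇ-false rest x r restx) (q-≢ r x≢r pr))))
        unique)
    where open First p x

-- The words w_n: letters, chunks and blocks

-- yᵢ is the repeated letter of the i-th block; sᵢ and tᵢ enclose that block and occur only once.
data Letter (I : Set) : Set where
  y   : ℕ → Letter I
  s t : I → Letter I

y-injective : ∀ {i j} → y {I} i ≡ y j → i ≡ j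
y-injective refl = refl

s-injective : {i j : I} → s i ≡ s j → i ≡ j
s-injective refl = refl

t-injective : {i j : I} → t i ≡ t j → i ≡ j
t-injective refl = refl

letter-≟ : DecidableEquality I → DecidableEquality (Letter I)
letter-≟ _≟_ (y i) (y j) = map′ (cong y) y-injective (i Nat.≟ j)
letter-≟ _≟_ (s i) (s j) = map′ (cong s) s-injective (i ≟ j)
letter-≟ _≟_ (t i) (t j) = map′ (cong t) t-injective (i ≟ j)
letter-≟ _≟_ (y _) (s _) = no λ ()
letter-≟ _≟_ (y _) (t _) = no λ ()
letter-≟ _≟_ (s _) (y _) = no λ ()
letter-≟ _≟_ (s _) (t _) = no λ ()
letter-≟ _≟_ (t _) (y _) = no λ ()
letter-≟ _≟_ (t _) (s _) = no λ ()

chunk : (I → List ℕ) → I → List (Letter I)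
chunk b i = s i ∷ map y (b i) ++ (t i ∷ [])

chunks : (I → List ℕ) → List I → List (Letter I)
chunks b = concatMap (chunk b)

left : ℕ → List ℕ
left zero    = []
left (suc i) = i ∷ []

blockᵇ : Bool → ℕ → List ℕ
blockᵇ r i = i ∷ left i ++ ((if r then suc i ∷ [] else []) ++ (i ∷ []))

block : ℕ → ℕ → List ℕ
block n i = blockᵇ (i <ᵇ n) i

range : ℕ → ℕ → List ℕ
range a zero    = []
range a (suc k) = a ∷ range (suc a) k

range-++ : ∀ a j k → range a (j + k) ≡ range a j ++ range (j + a) k
range-++ a zero    k = refl
range-++ a (suc j) k =
  cong (a ∷_) (trans (range-++ (suc a) j k) (cong (λ m → range (suc a) j ++ range m k) (ℕ.+-suc j a)))

range-bounds : ∀ a k → All (λ i → a ≤ i × i < k + a) (range a k)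
range-bounds a zero    = []
range-bounds a (suc k) =
  (ℕ.≤-refl , s≤s (ℕ.m≤n+m a k)) ∷
  All.map (λ { {i} (a<i , i<) → ℕ.<⇒≤ a<i , subst (i <_) (ℕ.+-suc k a) i< }) (range-bounds (suc a) k)

range-unique : ∀ a k → Unique (range a k)
range-unique a zero    = []
range-unique a (suc k) = All.map (λ { (a<i , _) → ℕ.<⇒≢ a<i }) (range-bounds (suc a) k) ∷ range-unique (suc a) k

blockᵇ-bounds : ∀ r i {z} → z ∈ blockᵇ r i → i ≤ suc z × (z ≤ i ⊎ z ≡ suc i × r ≡ true)
blockᵇ-bounds r i (here refl) = ℕ.n≤1+n i , inj₁ ℕ.≤-refl
blockᵇ-bounds r zero (there z∈) with r | z∈
... | true  | here refl         = z≤n , inj₂ (refl , refl)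
... | true  | there (here refl) = z≤n , inj₁ z≤n
... | false | here refl         = z≤n , inj₁ z≤n
blockᵇ-bounds r (suc i) (there (here refl)) = ℕ.≤-refl , inj₁ (ℕ.n≤1+n i)
blockᵇ-bounds r (suc i) (there (there z∈)) with r | z∈
... | true  | here refl         = ℕ.m≤n+m (suc i) 2 , inj₂ (refl , refl)
... | true  | there (here refl) = ℕ.n≤1+n (suc i) , inj₁ ℕ.≤-refl
... | false | here refl         = ℕ.n≤1+n (suc i) , inj₁ ℕ.≤-refl

block-bounds : ∀ n i {z} → z ∈ block n i → i ≤ suc z × z ≤ suc i × (i ≤ n → z ≤ n)
block-bounds n i z∈ with blockᵇ-bounds (i <ᵇ n) i z∈
... | i≤ , inj₁ z≤i          = i≤ , ℕ.m≤n⇒m≤1+n z≤i , ℕ.≤-trans z≤i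
... | i≤ , inj₂ (refl , i<n) = i≤ , ℕ.≤-refl , λ _ → ℕ.<ᵇ⇒< i n (subst T (sym i<n) _)

-- Extending a colouring of the yᵢ to the separators

source target : Bool → B₂¹-El → Bool
source g ea  = false
source g eb  = true
source g eab = false
source g eba = true
source g _   = g
target g ea  = true
target g eb  = false
target g eab = false
target g eba = true
target g _   = g

act-source : ∀ g x → x ≢ e0 → act x (source g x) ≡ just (target g x)
act-source g e1  _ = refl
act-source g ea  _ = refl
act-source g eb  _ = refl
act-source g eab _ = refl
act-source g eba _ = refl
act-source g e0  x≢e0 = ⊥-elim (x≢e0 refl)

Admits : (ℕ → Colour) → List ℕ → Set
Admits χ b = prod (el ∘ χ) b ≢ e0

-- h is the vertex between chunks, and g the vertex at which a block of product 1 is read. Both stay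
-- free: varying g shows that letters are absent from a block, varying h that the space between
-- chunks is empty.
separate : (ℕ → Colour) → (g h : Bool) → (I → List ℕ) → Letter I → Colour
separate χ g h b (y m) = χ m
separate χ g h b (s i) = h ⟶ source g (prod (el ∘ χ) (b i))
separate χ g h b (t i) = target g (prod (el ∘ χ) (b i)) ⟶ h

path-map : {χ : A → Colour} {f : K → A} {w : List K} {c d : Bool} → Path (χ ∘ f) w c d → Path χ (map f w) c d
path-map []      = []
path-map (σ ∷ π) = σ ∷ path-map π

path-map⁻¹ : {χ : A → Colour} {f : K → A} (w : List K) {c d : Bool} → Path χ (map f w) c d → Path (χ ∘ f) w c d
path-map⁻¹ []      []      = []
path-map⁻¹ (_ ∷ w) (σ ∷ π) = σ ∷ path-map⁻¹ w π

-- The separators of a block can be coloured to fit its two end vertices, so the blocks impose no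
-- conditions on each other.
path-chunks : ∀ {χ g h} {b : I → List ℕ} {is} → All (Admits χ ∘ b) is →
              Path (separate χ g h b) (chunks b is) h h
path-chunks [] = []
path-chunks {χ = χ} {g} {h} {b} {i ∷ _} (ok ∷ oks) =
  path-++ (move ∷ path-++ (path-map (act⇒path (b i) (act-source g _ ok))) (move ∷ [])) (path-chunks oks)

-- Removing the letters of a chain from its lower or its upper end

-- Once y₀ leads from `false` to `true` and every letter is an edge, the blocks force all other
-- colours: y₀ y₁ y₀ determines y₁, then y₁ y₀ y₂ y₁ makes y₂ a loop at `true`, and so on with
-- period 3.
low₃ : ℕ → Colour
low₃ 0 = false ⟶ true
low₃ 1 = true ⟶ false
low₃ 2 = true ⟶ true
low₃ (suc (suc (suc i))) = low₃ i

low : ℕ → ℕ → Colour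
low zero    i       = low₃ i
low (suc k) zero    = nothing
low (suc k) (suc i) = low k i

Admitsᵇ : (ℕ → Colour) → Bool → ℕ → Set
Admitsᵇ χ r i = Admits χ (blockᵇ r i)

admits-low₃ : ∀ i → Admitsᵇ low₃ true i
admits-low₃ 0 ()
admits-low₃ 1 ()
admits-low₃ 2 ()
admits-low₃ 3 ()
admits-low₃ (suc (suc (suc (suc i)))) = admits-low₃ (suc i)

-- The right neighbour matters: in a final block yᵢ yᵢ₋₁ yᵢ with yᵢ a loop and yᵢ₋₁ an edge between
-- different vertices, the path breaks.
admits-low : ∀ k i → Admitsᵇ (low k) true i
admits-low zero i = admits-low₃ i
admits-low 1 0 ()
admits-low (suc (suc _)) 0 ()
admits-low 1 1 ()
admits-low 2 1 ()
admits-low (suc (suc (suc _))) 1 ()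
admits-low (suc k) (suc (suc i)) = admits-low k (suc i)

-- The colours forced from the upper end. A block lists the left neighbour before the right one, so
-- the two ends differ: here the loop is at `false`.
high₃ : ℕ → Colour
high₃ 0 = false ⟶ true
high₃ 1 = true ⟶ false
high₃ 2 = false ⟶ false
high₃ (suc (suc (suc i))) = high₃ i

high : ℕ → ℕ → Colour
high k       zero    = high₃ k
high zero    (suc i) = nothing
high (suc k) (suc i) = high k i

admits-high₁ : ∀ k → Admitsᵇ (high (suc (suc k))) true 1
admits-high₁ 0 ()
admits-high₁ 1 ()
admits-high₁ 2 ()
admits-high₁ (suc (suc (suc k))) = admits-high₁ k

-- From block k on, the right neighbour carries no colour, so its presence matters only below k.
-- Block 0 is excluded because it has no left neighbour.
admits-high : ∀ k r i → (suc i < k → r ≡ true) → Admitsᵇ (high k) r (suc i)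
admits-high 0 true  0 _ ()
admits-high 0 false 0 _ ()
admits-high 1 true  0 _ ()
admits-high 1 false 0 _ ()
admits-high (suc (suc k)) r 0 r≡true rewrite r≡true (s≤s (s≤s z≤n)) = admits-high₁ k
admits-high zero true (suc i) _ = λ ()
admits-high zero false (suc i) _ = λ ()
admits-high (suc k) true  (suc i) r≡true = admits-high k true  i (λ <k → r≡true (s≤s <k))
admits-high (suc k) false (suc i) r≡true = admits-high k false i (λ <k → r≡true (s≤s <k))

alive : (ℕ → Colour) → Letter I → Bool
alive χ (y m) = is-just (χ m)
alive χ (s _) = true
alive χ (t _) = true

-- One `insert` step for a product of chunks. Separators survive every such step; they are left for
-- `distinct⇒good` when no y is alive any more.
remove : ∀ {b : I → List ℕ} {is χ χ′ p} m → All (Admits χ ∘ b) is →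
         χ m ≡ (false ⟶ true) → χ′ m ≡ nothing →
         (∀ z → is-just (χ z) ≡ true → z ≡ m ⊎ is-just (χ′ z) ≡ true) →
         (∀ z → is-just (χ′ z) ≡ true → is-just (χ z) ≡ true) →
         (∀ z → p z ≡ alive χ z) → Good (chunks b is) (alive χ′) → Good (chunks b is) p
remove {b = b} {χ = χ} {χ′} {p} m ok χm χ′m split χ′⊆χ p≡ good =
  insert (y m) (separate χ true true b) χm p≡′ (cong is-just χ′m) split′ ⊆′ (path-chunks ok) good
  where
  p≡′ : ∀ z → p z ≡ is-just (separate χ true true b z)
  p≡′ z with z | p≡ z
  ... | y _ | eq = eq
  ... | s _ | eq = eq
  ... | t _ | eq = eq
  split′ : ∀ z → p z ≡ true → z ≡ y m ⊎ alive χ′ z ≡ true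
  split′ z pz with z | trans (sym (p≡ z)) pz
  ... | s _ | _ = inj₂ refl
  ... | t _ | _ = inj₂ refl
  ... | y i | eq with split i eq
  ...   | inj₁ i≡m = inj₁ (cong y i≡m)
  ...   | inj₂ χ′i = inj₂ χ′i
  ⊆′ : ∀ z → alive χ′ z ≡ true → p z ≡ true
  ⊆′ z qz = trans (p≡ z) (⊆ z qz)
    where
    ⊆ : ∀ z → alive χ′ z ≡ true → alive χ z ≡ true
    ⊆ (y i) = χ′⊆χ i
    ⊆ (s _) = λ _ → refl
    ⊆ (t _) = λ _ → refl

separators : List I → List (Letter I)
separators = concatMap (λ i → s i ∷ t i ∷ [])

filter-chunks : ∀ (p : Letter I → Bool) (b : I → List ℕ) is →
                (∀ i → p (s i) ≡ true) → (∀ i → p (t i) ≡ true) →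
                All (λ i → All (λ m → p (y m) ≡ false) (b i)) is →
                filterᵇ p (chunks b is) ≡ separators is
filter-chunks p b [] ps pt [] = refl
filter-chunks p b (i ∷ is) ps pt (dead ∷ deads) =
  trans (filterᵇ-true p (s i) _ (ps i)) (cong (s i ∷_) (go (b i) dead))
  where
  go : ∀ w → All (λ m → p (y m) ≡ false) w →
       filterᵇ p ((map y w ++ (t i ∷ [])) ++ chunks b is) ≡ t i ∷ separators is
  go [] [] = trans (filterᵇ-true p (t i) _ (pt i)) (cong (t i ∷_) (filter-chunks p b is ps pt deads))
  go (m ∷ w) (pm ∷ pw) = trans (filterᵇ-false p (y m) _ pm) (go w pw)

separators-unique : {is : List I} → Unique is → Unique (separators is)
separators-unique [] = []
separators-unique {is = i ∷ is} (i≢ ∷ unique) =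
  ((λ ()) ∷ s≢ i≢) ∷ t≢ i≢ ∷ separators-unique unique
  where
  s≢ : ∀ {is} → All (i ≢_) is → All (s i ≢_) (separators is)
  s≢ [] = []
  s≢ (i≢j ∷ i≢) = (λ eq → i≢j (s-injective eq)) ∷ (λ ()) ∷ s≢ i≢
  t≢ : ∀ {is} → All (i ≢_) is → All (t i ≢_) (separators is)
  t≢ [] = []
  t≢ (i≢j ∷ i≢) = (λ ()) ∷ (λ eq → i≢j (t-injective eq)) ∷ t≢ i≢

≤ᵇ-true : ∀ {m n} → m ≤ n → (m ≤ᵇ n) ≡ true
≤ᵇ-true {m} {n} m≤n with m ≤ᵇ n | ℕ.≤⇒≤ᵇ m≤n
... | true | _ = refl

≤ᵇ-false : ∀ {m n} → n < m → (m ≤ᵇ n) ≡ false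
≤ᵇ-false {m} {n} n<m with m ≤ᵇ n in eq
... | false = refl
... | true  = ⊥-elim (ℕ.<⇒≱ n<m (ℕ.≤ᵇ⇒≤ m n (subst T (sym eq) _)))

path⇒admits : ∀ {χ w c d} → Path χ w c d → Admits χ w
path⇒admits π eq with () ← trans (cong (λ x → act x _) (sym eq)) (path⇒act π)

admits-cong : ∀ {χ χ′ w} → (∀ z → z ∈ w → χ z ≡ χ′ z) → Admits χ′ w → Admits χ w
admits-cong eq ok e = ok (trans (sym (prod-cong (λ z z∈ → cong el (eq z z∈)))) e)

admits-loops : ∀ w → Admits (λ _ → true ⟶ true) w
admits-loops w = path⇒admits (loops w)
  where
  loops : ∀ w → Path (λ _ → true ⟶ true) w true true
  loops []      = []
  loops (_ ∷ w) = move ∷ loops w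

low-self : ∀ k → low k k ≡ (false ⟶ true)
low-self zero    = refl
low-self (suc k) = low-self k

low-next : ∀ k → low (suc k) k ≡ nothing
low-next zero    = refl
low-next (suc k) = low-next k

is-just-low₃ : ∀ z → is-just (low₃ z) ≡ true
is-just-low₃ 0 = refl
is-just-low₃ 1 = refl
is-just-low₃ 2 = refl
is-just-low₃ (suc (suc (suc z))) = is-just-low₃ z

low-split : ∀ k z → is-just (low k z) ≡ true → z ≡ k ⊎ is-just (low (suc k) z) ≡ true
low-split zero    zero    _ = inj₁ refl
low-split zero    (suc z) _ = inj₂ (is-just-low₃ z)
low-split (suc k) (suc z) j with low-split k z j
... | inj₁ z≡k = inj₁ (cong suc z≡k)
... | inj₂ j′  = inj₂ j′

low-mono : ∀ k z → is-just (low (suc k) z) ≡ true → is-just (low k z) ≡ true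
low-mono zero    z       _ = is-just-low₃ z
low-mono (suc k) (suc z) j = low-mono k z j

low-dead : ∀ {z k} → z < k → low k z ≡ nothing
low-dead {zero}  (s≤s _)   = refl
low-dead {suc z} (s≤s z<k) = low-dead z<k

high-self : ∀ k → high k k ≡ (false ⟶ true)
high-self zero    = refl
high-self (suc k) = high-self k

high-dead : ∀ {k z} → k < z → high k z ≡ nothing
high-dead {zero}  (s≤s _)   = refl
high-dead {suc k} (s≤s k<z) = high-dead k<z

is-just-high₃ : ∀ z → is-just (high₃ z) ≡ true
is-just-high₃ 0 = refl
is-just-high₃ 1 = refl
is-just-high₃ 2 = refl
is-just-high₃ (suc (suc (suc z))) = is-just-high₃ z

high-alive : ∀ {z k} → z ≤ k → is-just (high k z) ≡ true
high-alive {zero}  {k} _       = is-just-high₃ k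
high-alive {suc z} (s≤s z≤k) = high-alive z≤k

high-split : ∀ k z → is-just (high (suc k) z) ≡ true → z ≡ suc k ⊎ is-just (high k z) ≡ true
high-split k       zero    _ = inj₂ (is-just-high₃ k)
high-split zero    (suc zero) _ = inj₁ refl
high-split (suc k) (suc z) j with high-split k z j
... | inj₁ eq = inj₁ (cong suc eq)
... | inj₂ j′ = inj₂ j′

high-mono : ∀ k z → is-just (high k z) ≡ true → is-just (high (suc k) z) ≡ true
high-mono k       zero    _ = is-just-high₃ (suc k)
high-mono (suc k) (suc z) j = high-mono k z j

-- Contracting two neighbouring chunks yields an isoterm for M(z∞)

-- The blocks b and b+1 are replaced by one empty block, enclosed in separators of the fresh index nothing.
-- What remains on the two sides has disjoint sets of letters y: those up to b, and those above b.
contracted : ℕ → Maybe ℕ → List ℕ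
contracted n nothing  = []
contracted n (just i) = block n i

contracted-indices : ℕ → ℕ → List (Maybe ℕ)
contracted-indices b k = map just (range 0 b) ++ (nothing ∷ map just (range (2 + b) k))

module Contraction (b k : ℕ) where

  n : ℕ
  n = suc (k + b)

  is : List (Maybe ℕ)
  is = contracted-indices b k

  all-is : {P : Maybe ℕ → Set} → P nothing → (∀ i → i < b → P (just i)) →
           (∀ i → suc b < i → i ≤ n → P (just i)) → All P is
  all-is {P} p∅ p< p> =
    All.++⁺ (All.map⁺ (All.map (λ { (_ , i<) → p< _ (subst (_ <_) (ℕ.+-identityʳ b) i<) }) (range-bounds 0 b)))
      (p∅ ∷ All.map⁺ (All.map (λ { {i} (b< , i<) → p> i b< (ℕ.≤-pred (subst (i <_) (+-shift k) i<)) }) (range-bounds (2 + b) k)))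
    where
    +-shift : ∀ k → k + (2 + b) ≡ suc (suc (k + b))
    +-shift k = trans (ℕ.+-suc k (suc b)) (cong suc (ℕ.+-suc k b))

  -- While the lower side is dismantled, the letters above b are loops at `true`, which break no
  -- block.
  lower : ℕ → ℕ → Colour
  lower m z = if z ≤ᵇ b then low m z else (true ⟶ true)

  -- At this stage the letters up to b are gone. Those above n do not occur in the word, but they
  -- belong to the initial selection of all letters, and a loop keeps them in it.
  upper : ℕ → ℕ → Colour
  upper m z = if z ≤ᵇ b then nothing else (if z ≤ᵇ n then high m z else (true ⟶ true))

  b≤n : b ≤ n
  b≤n = ℕ.m≤n⇒m≤1+n (ℕ.m≤n+m b k)

  below : ∀ {i z} → i < b → z ∈ block n i → z ≤ b
  below i<b z∈ = ℕ.≤-trans (proj₁ (proj₂ (block-bounds n _ z∈))) i<b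

  above : ∀ {i z} → suc b < i → z ∈ block n i → b < z
  above b<i z∈ = ℕ.≤-pred (ℕ.≤-trans b<i (proj₁ (block-bounds n _ z∈)))

  interior : ∀ {i} → i < n → block n i ≡ blockᵇ true i
  interior {i} i<n with i <ᵇ n | ℕ.<⇒<ᵇ i<n
  ... | true | _ = refl

  admits-lower : ∀ m → All (Admits (lower m) ∘ contracted n) is
  admits-lower m = all-is (λ ())
    (λ i i<b → admits-cong (λ z z∈ → cong (λ c → if c then low m z else (true ⟶ true)) (≤ᵇ-true (below i<b z∈)))
      (subst (Admits (low m)) (sym (interior (ℕ.<-≤-trans i<b b≤n))) (admits-low m i)))
    (λ i b<i _ → admits-cong (λ z z∈ → cong (λ c → if c then low m z else (true ⟶ true)) (≤ᵇ-false (above b<i z∈)))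
      (admits-loops (block n i)))

  admits-upper : ∀ m → m ≤ n → All (Admits (upper m) ∘ contracted n) is
  admits-upper m m≤n = all-is (λ ())
    (λ i i<b → admits-cong
      (λ z z∈ → cong (λ c → if c then nothing else (if z ≤ᵇ n then high m z else (true ⟶ true))) (≤ᵇ-true (below i<b z∈)))
      (ignored (block n i)))
    λ { (suc i) b<i i≤n → admits-cong
          (λ z z∈ → trans
            (cong (λ c → if c then nothing else (if z ≤ᵇ n then high m z else (true ⟶ true))) (≤ᵇ-false (above b<i z∈)))
            (cong (λ c → if c then high m z else (true ⟶ true)) (≤ᵇ-true (proj₂ (proj₂ (block-bounds n (suc i) z∈)) i≤n))))
          (admits-high m (suc i <ᵇ n) i (λ i<m → T⇒≡ (ℕ.<⇒<ᵇ (ℕ.<-≤-trans i<m m≤n)))) }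
    where
    ignored : ∀ w → Admits (λ _ → nothing) w
    ignored w = path⇒admits (stays w)
      where
      stays : ∀ w → Path (λ _ → nothing) w true true
      stays []      = []
      stays (_ ∷ w) = stay ∷ stays w
    T⇒≡ : ∀ {c} → T c → c ≡ true
    T⇒≡ {true} _ = refl

  upper-good : ∀ m {p} → m + b ≤ n → (∀ z → p z ≡ alive (upper (m + b)) z) → Good (chunks (contracted n) is) p
  upper-good zero {p} _ p≡ =
    distinct⇒good (letter-≟ (Maybe.≡-dec Nat._≟_))
      (filter-chunks p (contracted n) is (λ i → p≡ (s i)) (λ i → p≡ (t i))
        (all-is [] (λ i i<b → All.tabulate (λ z∈ → dead (ℕ.≤-trans (below i<b z∈) b≤n)))
                   (λ i b<i i≤n → All.tabulate (λ z∈ → dead (proj₂ (proj₂ (block-bounds n i z∈)) i≤n)))))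
      (separators-unique unique)
    where
    upper-dead : ∀ z → z ≤ n → is-just (upper b z) ≡ false
    upper-dead z ≤n with z ≤ᵇ b in below?
    ... | true  = refl
    ... | false rewrite ≤ᵇ-true ≤n = cong is-just (high-dead {b} {z} (ℕ.≰⇒> not-below))
      where
      not-below : ¬ z ≤ b
      not-below z≤b with () ← trans (sym below?) (≤ᵇ-true z≤b)
    dead : ∀ {z} → z ≤ n → p (y z) ≡ false
    dead {z} ≤n = trans (p≡ (y z)) (upper-dead z ≤n)
    unique : Unique is
    unique = Unique.++⁺ (Unique.map⁺ Maybe.just-injective (range-unique 0 b))
      (All.map⁺ (All.map (λ _ ()) (range-bounds (2 + b) k)) ∷ Unique.map⁺ Maybe.just-injective (range-unique (2 + b) k))
      disjoint
      where
      disjoint : ∀ {x} → ¬ (x ∈ map just (range 0 b) × x ∈ nothing ∷ map just (range (2 + b) k))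
      disjoint (x∈ , here refl) with _ , _ , () ← ∈-map⁻ just x∈
      disjoint (x∈ , there x∈′) with i , i∈ , refl ← ∈-map⁻ just x∈ | .i , i∈′ , refl ← ∈-map⁻ just x∈′ =
        ℕ.<-asym
          (subst (i <_) (ℕ.+-identityʳ b) (proj₂ (All.lookup (range-bounds 0 b) i∈)))
          (ℕ.<⇒≤ (proj₁ (All.lookup (range-bounds (2 + b) k) i∈′)))
  upper-good (suc m) m≤n p≡ =
    remove (suc (m + b)) (admits-upper _ m≤n) upper-self upper-next split mono p≡
      (upper-good m (ℕ.<⇒≤ m≤n) (λ _ → refl))
    where
    b<m : b < suc (m + b)
    b<m = s≤s (ℕ.m≤n+m b m)
    upper-self : upper (suc (m + b)) (suc (m + b)) ≡ (false ⟶ true)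
    upper-self rewrite ≤ᵇ-false b<m | ≤ᵇ-true m≤n = high-self (m + b)
    upper-next : upper (m + b) (suc (m + b)) ≡ nothing
    upper-next rewrite ≤ᵇ-false b<m | ≤ᵇ-true m≤n = high-dead {m + b} ℕ.≤-refl
    split : ∀ z → is-just (upper (suc (m + b)) z) ≡ true → z ≡ suc (m + b) ⊎ is-just (upper (m + b) z) ≡ true
    split z j with z ≤ᵇ b | z ≤ᵇ n
    ... | false | true  = high-split (m + b) z j
    ... | false | false = inj₂ refl
    mono : ∀ z → is-just (upper (m + b) z) ≡ true → is-just (upper (suc (m + b)) z) ≡ true
    mono z j with z ≤ᵇ b | z ≤ᵇ n
    ... | false | true  = high-mono (m + b) z j
    ... | false | false = refl

  -- j counts the letters left below the gap. They go from the bottom up; then the letters still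
  -- alive are those coloured by `upper n`, which go from the top down.
  lower-good : ∀ j m {p} → j + m ≡ suc b → (∀ z → p z ≡ alive (lower m) z) → Good (chunks (contracted n) is) p
  lower-good zero m refl p≡ = upper-good (suc k) ℕ.≤-refl (λ z → trans (p≡ z) (agree z))
    where
    agree : ∀ z → alive (lower (suc b)) z ≡ alive (upper n) z
    agree (s _) = refl
    agree (t _) = refl
    agree (y z) with z ≤ᵇ b in below? | z ≤ᵇ n in within?
    ... | true  | _     = cong is-just (low-dead (s≤s (ℕ.≤ᵇ⇒≤ z b (subst T (sym below?) _))))
    ... | false | true  = sym (high-alive (ℕ.≤ᵇ⇒≤ z n (subst T (sym within?) _)))
    ... | false | false = refl
  lower-good (suc j) m eq p≡ =
    remove m (admits-lower m) lower-self lower-next split mono p≡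
      (lower-good j (suc m) (trans (ℕ.+-suc j m) eq) (λ _ → refl))
    where
    m≤b : m ≤ b
    m≤b = subst (m ≤_) (ℕ.suc-injective eq) (ℕ.m≤n+m m j)
    lower-self : lower m m ≡ (false ⟶ true)
    lower-self rewrite ≤ᵇ-true m≤b = low-self m
    lower-next : lower (suc m) m ≡ nothing
    lower-next rewrite ≤ᵇ-true m≤b = low-next m
    split : ∀ z → is-just (lower m z) ≡ true → z ≡ m ⊎ is-just (lower (suc m) z) ≡ true
    split z j with z ≤ᵇ b
    ... | true  = low-split m z j
    ... | false = inj₂ refl
    mono : ∀ z → is-just (lower (suc m) z) ≡ true → is-just (lower m z) ≡ true
    mono z j with z ≤ᵇ b
    ... | true  = low-mono m z j
    ... | false = refl

  contraction-isoterm : ∀ {v} → chunks (contracted n) is ≲ v → v ≡ chunks (contracted n) is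
  contraction-isoterm {v} w≲v =
    sym (trans (sym (filter-true _)) (trans (good⇒isoterm-Z {v = v} (lower-good (suc b) 0 (ℕ.+-identityʳ _) all-alive) w≲v) (filter-true v)))
    where
    filter-true : ∀ w → filterᵇ (λ (_ : Letter (Maybe ℕ)) → true) w ≡ w
    filter-true []      = refl
    filter-true (z ∷ w) = cong (z ∷_) (filter-true w)
    all-alive : ∀ z → true ≡ alive (lower 0) z
    all-alive (s _) = refl
    all-alive (t _) = refl
    all-alive (y z) with z ≤ᵇ b
    ... | true  = sym (is-just-low₃ z)
    ... | false = refl

-- For n ≡ 1 (mod 3) the word w_n is an isoterm for B₂¹

-- In every block except the last one for m = n, the letters y_m and y_{m+1} alternate.
pair : ℕ → ℕ → Colour
pair zero    0             = false ⟶ true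
pair zero    1             = true ⟶ false
pair zero    (suc (suc _)) = nothing
pair (suc m) zero          = nothing
pair (suc m) (suc z)       = pair m z

admits-pair : ∀ m r i → (i ≡ m → r ≡ true) → Admitsᵇ (pair m) r i
admits-pair 0 r     0 ok with ok refl
... | refl = λ ()
admits-pair 0 true  1 _ ()
admits-pair 0 false 1 _ ()
admits-pair 0 true  2 _ ()
admits-pair 0 false 2 _ ()
admits-pair 0 true  (suc (suc (suc i))) _ ()
admits-pair 0 false (suc (suc (suc i))) _ ()
admits-pair 1 true  0 _ ()
admits-pair 1 false 0 _ ()
admits-pair (suc (suc m)) true  0 _ ()
admits-pair (suc (suc m)) false 0 _ ()
admits-pair 1 r     1 ok with ok refl
... | refl = λ ()
admits-pair 2 true  1 _ ()
admits-pair 2 false 1 _ ()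
admits-pair (suc (suc (suc m))) true  1 _ ()
admits-pair (suc (suc (suc m))) false 1 _ ()
admits-pair (suc m) true  (suc (suc i)) ok = admits-pair m true  (suc i) (λ eq → ok (cong suc eq))
admits-pair (suc m) false (suc (suc i)) ok = admits-pair m false (suc i) (λ eq → ok (cong suc eq))

-- The only colouring used that separates the order y_{i-1} y_{i+1} inside a block from the reverse order;
-- it survives the last block exactly when n ≡ 1 (mod 3).
κ : ℕ → Colour
κ 0 = true ⟶ false
κ 1 = false ⟶ true
κ 2 = false ⟶ false
κ (suc (suc (suc i))) = κ i

admits-κ : ∀ r i → (r ≡ false → κ i ≡ (false ⟶ true)) → Admitsᵇ κ r i
admits-κ true  0 _ ()
admits-κ false 0 ok with () ← ok refl
admits-κ true  1 _ ()
admits-κ false 1 _ ()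
admits-κ true  2 _ ()
admits-κ false 2 ok with () ← ok refl
admits-κ true  3 _ ()
admits-κ false 3 ok with () ← ok refl
admits-κ true  (suc (suc (suc (suc i)))) ok = admits-κ true  (suc i) ok
admits-κ false (suc (suc (suc (suc i)))) ok = admits-κ false (suc i) ok

κ-order : ∀ a {r c d} → ¬ Path κ (suc a ∷ suc (suc a) ∷ a ∷ r) c d
κ-order 0 (move ∷ () ∷ _)
κ-order 1 (move ∷ () ∷ _)
κ-order 2 (move ∷ move ∷ () ∷ _)
κ-order (suc (suc (suc a))) (σ ∷ τ ∷ υ ∷ π) = κ-order a (σ ∷ τ ∷ υ ∷ nil π)
  where
  nil : ∀ {r c d} → Path κ r c d → Path κ [] c c
  nil _ = []

pair-fst : ∀ m → pair m m ≡ (false ⟶ true)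
pair-fst zero    = refl
pair-fst (suc m) = pair-fst m

pair-snd : ∀ m → pair m (suc m) ≡ (true ⟶ false)
pair-snd zero    = refl
pair-snd (suc m) = pair-snd m

pair-< : ∀ {m z} → z < m → pair m z ≡ nothing
pair-< {suc m} {zero}  _         = refl
pair-< {suc m} {suc z} (s≤s z<m) = pair-< z<m

pair-> : ∀ {m z} → suc m < z → pair m z ≡ nothing
pair-> {zero}  {suc (suc z)} _         = refl
pair-> {suc m} {suc z}       (s≤s m<z) = pair-> m<z
pair-> {zero}  {suc zero}    (s≤s ())

δ : ℕ → ℕ → ℕ
δ zero    zero    = 1
δ zero    (suc z) = 0
δ (suc m) zero    = 0
δ (suc m) (suc z) = δ m z

count : ℕ → List ℕ → ℕ
count m []      = 0
count m (z ∷ w) = δ m z + count m w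

δ-refl : ∀ m → δ m m ≡ 1
δ-refl zero    = refl
δ-refl (suc m) = δ-refl m

δ≢0 : ∀ m z → δ m z ≢ 0 → m ≡ z
δ≢0 zero    zero    _  = refl
δ≢0 zero    (suc z) ≢0 = ⊥-elim (≢0 refl)
δ≢0 (suc m) zero    ≢0 = ⊥-elim (≢0 refl)
δ≢0 (suc m) (suc z) ≢0 = cong suc (δ≢0 m z ≢0)

count≢0 : ∀ m w → count m w ≢ 0 → m ∈ w
count≢0 m []      ≢0 = ⊥-elim (≢0 refl)
count≢0 m (z ∷ w) ≢0 with δ m z in eq
... | suc _ = here (δ≢0 m z (λ eq′ → ℕ.1+n≢0 (trans (sym eq) eq′)))
... | zero  = there (count≢0 m w ≢0)

∈⇒count≢0 : ∀ {m w} → m ∈ w → count m w ≢ 0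
∈⇒count≢0 {m} (here {xs = w} refl) eq rewrite δ-refl m with () ← eq
∈⇒count≢0 {m} (there {x = z} z∈) eq = ∈⇒count≢0 z∈ (ℕ.m+n≡0⇒n≡0 (δ m z) eq)

bit : Bool → ℕ
bit false = 0
bit true  = 1

step-balance : ∀ m z {c d} → Step (pair m z) c d → bit c + δ m z ≡ bit d + δ (suc m) z
step-balance zero    0             move = refl
step-balance zero    1             move = refl
step-balance zero    (suc (suc z)) stay = refl
step-balance (suc m) zero          stay = refl
step-balance (suc m) (suc z)       σ    = step-balance m z σ

-- Every yₘ leads from `false` to `true` and every y_{m+1} leads back, so the ends of the path fix
-- the difference of the two counts.
path-balance : ∀ {m w c d} → Path (pair m) w c d → bit c + count m w ≡ bit d + count (suc m) w
path-balance [] = refl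
path-balance {m} {_} {c} {d} (_∷_ {z} {w} {_} {e} σ π) = begin
  bit c + (δ m z + count m w)            ≡⟨ sym (ℕ.+-assoc (bit c) _ _) ⟩
  (bit c + δ m z) + count m w            ≡⟨ cong (_+ count m w) (step-balance m z σ) ⟩
  (bit e + δ (suc m) z) + count m w      ≡⟨ xy∙z≈xz∙y (bit e) _ _ ⟩
  (bit e + count m w) + δ (suc m) z      ≡⟨ cong (_+ δ (suc m) z) (path-balance π) ⟩
  (bit d + count (suc m) w) + δ (suc m) z ≡⟨ ℕ.+-assoc (bit d) _ _ ⟩
  bit d + (count (suc m) w + δ (suc m) z) ≡⟨ cong (bit d +_) (ℕ.+-comm _ (δ (suc m) z)) ⟩
  bit d + (δ (suc m) z + count (suc m) w) ∎
  where open ≡-Reasoning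

pair-nothing : ∀ m z → pair m z ≡ nothing → δ m z ≡ 0 × δ (suc m) z ≡ 0
pair-nothing zero    (suc (suc z)) _  = refl , refl
pair-nothing (suc m) zero          _  = refl , refl
pair-nothing (suc m) (suc z)       eq = pair-nothing m z eq

-- A word that closes a loop at both vertices uses no edge.
absent : ∀ m w → Path (pair m) w false false → Path (pair m) w true true →
         count m w ≡ 0 × count (suc m) w ≡ 0
absent m [] _ _ = refl , refl
absent m (z ∷ w) (σ ∷ π) (τ ∷ ρ) with pair m z in eq
absent m (z ∷ w) (stay ∷ π) (stay ∷ ρ) | nothing
  with δ₁ , δ₂ ← pair-nothing m z eq | c₁ , c₂ ← absent m w π ρ = cong₂ _+_ δ₁ c₁ , cong₂ _+_ δ₂ c₂
absent m (z ∷ w) (move ∷ π) (() ∷ ρ) | just _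

-- One word is a prefix of the other. Paths fix the letters one after another but cannot tell where
-- a word stops; `comparable⇒≡` gets that from the counts.
data Comparable {A : Set} : List A → List A → Set where
  []ˡ : ∀ {w} → Comparable [] w
  []ʳ : ∀ {w} → Comparable w []
  _∷_ : ∀ z {w v} → Comparable w v → Comparable (z ∷ w) (z ∷ v)

comparable⇒≡ : ∀ {w v} → Comparable w v → (∀ m → count m w ≡ count m v) → w ≡ v
comparable⇒≡ {v = []} []ˡ eq = refl
comparable⇒≡ {v = z ∷ v} []ˡ eq = ⊥-elim (∈⇒count≢0 {z} {z ∷ v} (here refl) (sym (eq z)))
comparable⇒≡ {w = []} []ʳ eq = refl
comparable⇒≡ {w = z ∷ w} []ʳ eq = ⊥-elim (∈⇒count≢0 {z} {z ∷ w} (here refl) (eq z))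
comparable⇒≡ (z ∷ cmp) eq = cong (z ∷_) (comparable⇒≡ cmp (λ m → ℕ.+-cancelˡ-≡ (δ m z) _ _ (eq m)))

edge-step : ∀ {k c d c′ d′} → k ≡ (c ⟶ d) → Step k c′ d′ → c′ ≡ c × d′ ≡ d
edge-step refl move = refl , refl

stay-step : ∀ {k c d} → k ≡ nothing → Step k c d → d ≡ c
stay-step refl stay = refl

head-start : ∀ {χ : A → Colour} {w z r c d c′ d′} → w ≡ z ∷ r → χ z ≡ (c ⟶ d) → Path χ w c′ d′ → c′ ≡ c
head-start refl χz (σ ∷ _) = proj₁ (edge-step χz σ)

module Ends {χ : ℕ → Colour} {m a : ℕ} {c d : Bool}
  (χm : χ m ≡ (c ⟶ d)) (χa : χ a ≡ (d ⟶ c)) (c≢d : c ≢ d) where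

  private
    Over : List ℕ → Set
    Over = All (λ z → z ≡ m ⊎ z ≡ a)

    third : ∀ {w e} → Over w → Path χ w c e → Comparable w (m ∷ [])
    third []              _       = []ˡ
    third (inj₁ refl ∷ _) _       = m ∷ []ʳ
    third (inj₂ refl ∷ _) (σ ∷ _) = ⊥-elim (c≢d (proj₁ (edge-step χa σ)))

    second : ∀ {w e} → Over w → Path χ w d e → Comparable w (a ∷ m ∷ [])
    second []               _       = []ˡ
    second (inj₁ refl ∷ _)  (σ ∷ _) = ⊥-elim (c≢d (sym (proj₁ (edge-step χm σ))))
    second (inj₂ refl ∷ ow) (σ ∷ π) with _ , refl ← edge-step χa σ = a ∷ third ow π

  comparable-end : ∀ {w e} → Over w → Path χ w c e → Comparable w (m ∷ a ∷ m ∷ [])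
  comparable-end []               _       = []ˡ
  comparable-end (inj₁ refl ∷ ow) (σ ∷ π) with _ , refl ← edge-step χm σ = m ∷ second ow π
  comparable-end (inj₂ refl ∷ ow) (σ ∷ _) = ⊥-elim (c≢d (proj₁ (edge-step χa σ)))

module Interior (a : ℕ) where

  private
    m b : ℕ
    m = suc a
    b = suc (suc a)

    Over : List ℕ → Set
    Over = All (λ z → z ≡ m ⊎ z ≡ a ⊎ z ≡ b)

    true≢false : true ≢ false
    true≢false ()

    false≢true : false ≢ true
    false≢true ()

    fourth : ∀ {w d e} → Over w → Path (pair a) w true d → Path (pair m) w false e → Comparable w (m ∷ [])
    fourth []                      _       _       = []ˡ
    fourth (inj₁ refl ∷ _)         _       _       = m ∷ []ʳ
    fourth (inj₂ (inj₁ refl) ∷ _)  (σ ∷ _) _       = ⊥-elim (true≢false (proj₁ (edge-step (pair-fst a) σ)))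
    fourth (inj₂ (inj₂ refl) ∷ _)  _       (τ ∷ _) = ⊥-elim (false≢true (proj₁ (edge-step (pair-snd m) τ)))

    third : ∀ {w d e} → Over w → Path (pair a) w true d → Path (pair m) w true e → Comparable w (b ∷ m ∷ [])
    third []                      _       _       = []ˡ
    third (inj₁ refl ∷ _)         _       (τ ∷ _) = ⊥-elim (true≢false (proj₁ (edge-step (pair-fst m) τ)))
    third (inj₂ (inj₁ refl) ∷ _)  (σ ∷ _) _       = ⊥-elim (true≢false (proj₁ (edge-step (pair-fst a) σ)))
    third (inj₂ (inj₂ refl) ∷ ow) (σ ∷ π) (τ ∷ ρ)
      with refl ← stay-step (pair-> {a} ℕ.≤-refl) σ | _ , refl ← edge-step (pair-snd m) τ = b ∷ fourth ow π ρ

    -- After the first m the pair colourings allow both a and b. Suppose b comes. Then a is excluded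
    -- by `κ`, m and b by the pair colourings, and the word cannot stop, since a has to occur.
    swapped : ∀ {w d e f g} → Over w → a ∈ m ∷ b ∷ w → Path (pair a) w false d → Path (pair m) w false e →
              ¬ Path κ (m ∷ b ∷ w) f g
    swapped [] (here a≡m) _ _ _ = ℕ.1+n≢n (sym a≡m)
    swapped [] (there (here a≡c)) _ _ _ = ℕ.<⇒≢ (ℕ.m≤n+m m 1) a≡c
    swapped (inj₁ refl ∷ _) _ (σ ∷ _) _ _ = false≢true (proj₁ (edge-step (pair-snd a) σ))
    swapped (inj₂ (inj₁ refl) ∷ _) _ _ _ π = κ-order a π
    swapped (inj₂ (inj₂ refl) ∷ _) _ _ (τ ∷ _) _ = false≢true (proj₁ (edge-step (pair-snd m) τ))

    second : ∀ {w d e f g} → Over w → a ∈ m ∷ w → Path (pair a) w false d → Path (pair m) w true e →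
             Path κ (m ∷ w) f g → Comparable w (a ∷ b ∷ m ∷ [])
    second [] _ _ _ _ = []ˡ
    second (inj₁ refl ∷ _) _ (σ ∷ _) _ _ = ⊥-elim (false≢true (proj₁ (edge-step (pair-snd a) σ)))
    second (inj₂ (inj₁ refl) ∷ ow) _ (σ ∷ π) (τ ∷ ρ) _
      with _ , refl ← edge-step (pair-fst a) σ | refl ← stay-step (pair-< {m} ℕ.≤-refl) τ = a ∷ third ow π ρ
    second (inj₂ (inj₂ refl) ∷ ow) a∈ (σ ∷ π) (τ ∷ ρ) υ
      with refl ← stay-step (pair-> {a} ℕ.≤-refl) σ | _ , refl ← edge-step (pair-snd m) τ =
      ⊥-elim (swapped ow a∈ π ρ υ)

  comparable-interior : ∀ {w d e f g} → Over w → a ∈ w → Path (pair a) w true d → Path (pair m) w false e →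
                        Path κ w f g → Comparable w (m ∷ a ∷ b ∷ m ∷ [])
  comparable-interior [] _ _ _ _ = []ˡ
  comparable-interior (inj₁ refl ∷ ow) a∈ (σ ∷ π) (τ ∷ ρ) υ
    with _ , refl ← edge-step (pair-snd a) σ | _ , refl ← edge-step (pair-fst m) τ = m ∷ second ow a∈ π ρ υ
  comparable-interior (inj₂ (inj₁ refl) ∷ _) _ (σ ∷ _) _ _ = ⊥-elim (true≢false (proj₁ (edge-step (pair-fst a) σ)))
  comparable-interior (inj₂ (inj₂ refl) ∷ _) _ _ (τ ∷ _) _ = ⊥-elim (false≢true (proj₁ (edge-step (pair-snd m) τ)))

word : ℕ → List (Letter ℕ)
word n = chunks (block n) (range 0 (suc n))

indices-≤ : ∀ n → All (_≤ n) (range 0 (suc n))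
indices-≤ n =
  All.map (λ { {i} (_ , i<) → ℕ.≤-pred (subst (i <_) (ℕ.+-identityʳ (suc n)) i<) }) (range-bounds 0 (suc n))

separator? : Letter I → Bool
separator? (y _) = false
separator? (s _) = true
separator? (t _) = true

filter-word : ∀ n → filterᵇ separator? (word n) ≡ separators (range 0 (suc n))
filter-word n = filter-chunks separator? (block n) (range 0 (suc n)) (λ _ → refl) (λ _ → refl)
  (All.universal (λ i → All.universal (λ _ → refl) (block n i)) (range 0 (suc n)))

module Isoterm (p : ℕ) (4≤p : 4 ≤ p) (κn : κ (suc p) ≡ (false ⟶ true)) where

  n : ℕ
  n = suc p

  Valid : (ℕ → Colour) → Set
  Valid χ = ∀ i → i ≤ n → Admits χ (block n i)

  Valid-pair : ∀ {m} → m ≢ n → Valid (pair m)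
  Valid-pair {m} m≢n i i≤n = admits-pair m (i <ᵇ n) i interior
    where
    interior : i ≡ m → (i <ᵇ n) ≡ true
    interior refl with i <ᵇ n | ℕ.<⇒<ᵇ (ℕ.≤∧≢⇒< i≤n m≢n)
    ... | true | _ = refl

  Valid-κ : Valid κ
  Valid-κ i i≤n = admits-κ (i <ᵇ n) i end
    where
    end : (i <ᵇ n) ≡ false → κ i ≡ (false ⟶ true)
    end eq with i Nat.≟ n
    ... | yes refl = κn
    ... | no i≢n with i <ᵇ n | ℕ.<⇒<ᵇ (ℕ.≤∧≢⇒< i≤n i≢n)
    end () | no _ | true | _

  prod-ignored : ∀ {χ : ℕ → Colour} w → (∀ z → z ∈ w → χ z ≡ nothing) → prod (el ∘ χ) w ≡ e1
  prod-ignored []      _  = refl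
  prod-ignored (z ∷ w) eq rewrite eq z (here refl) =
    trans (·B-identityˡ _) (prod-ignored w (λ z′ z∈ → eq z′ (there z∈)))

  -- All that is known about the letters A which a word equivalent to w_n has between sᵢ and tᵢ. A
  -- block of product 1 gives loops at both vertices, whence the quantifier over g.
  BlockPaths : ℕ → List ℕ → Set
  BlockPaths i A = ∀ χ g → Valid χ → let x = prod (el ∘ χ) (block n i) in Path χ A (source g x) (target g x)

  module Block (i : ℕ) (i≤n : i ≤ n) (A : List ℕ) (paths : BlockPaths i A) where

    Bᵢ : List ℕ
    Bᵢ = block n i

    Agree : ℕ → Set
    Agree m = count m A ≡ count m Bᵢ

    paths-B : BlockPaths i Bᵢ
    paths-B χ g valid = act⇒path Bᵢ (act-source g _ (valid i i≤n))

    agree-absent : ∀ {m} → m ≢ n → (∀ z → z ∈ Bᵢ → z < m ⊎ suc m < z) → Agree m × Agree (suc m)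
    agree-absent {m} m≢n far = trans (proj₁ inA) (sym (proj₁ inB)) , trans (proj₂ inA) (sym (proj₂ inB))
      where
      trivial : prod (el ∘ pair m) Bᵢ ≡ e1
      trivial = prod-ignored Bᵢ λ z z∈ → ignored z (far z z∈)
        where
        ignored : ∀ z → z < m ⊎ suc m < z → pair m z ≡ nothing
        ignored z (inj₁ z<m) = pair-< z<m
        ignored z (inj₂ m<z) = pair-> m<z
      loop : ∀ {w} g → Path (pair m) w (source g (prod (el ∘ pair m) Bᵢ)) (target g (prod (el ∘ pair m) Bᵢ)) →
             Path (pair m) w g g
      loop g π rewrite trivial = π
      inA = absent m A (loop false (paths _ false (Valid-pair m≢n))) (loop true (paths _ true (Valid-pair m≢n)))
      inB = absent m Bᵢ (loop false (paths-B _ false (Valid-pair m≢n))) (loop true (paths-B _ true (Valid-pair m≢n)))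

    agree-up : ∀ {m} → m ≢ n → Agree m → Agree (suc m)
    agree-up {m} m≢n eq = ℕ.+-cancelˡ-≡ (bit _) _ _
      (trans (sym (path-balance (paths (pair m) true (Valid-pair m≢n))))
        (trans (cong (bit _ +_) eq) (path-balance (paths-B (pair m) true (Valid-pair m≢n)))))

    agree-down : ∀ {m} → m ≢ n → Agree (suc m) → Agree m
    agree-down {m} m≢n eq = ℕ.+-cancelˡ-≡ (bit _) _ _
      (trans (path-balance (paths (pair m) true (Valid-pair m≢n)))
        (trans (cong (bit _ +_) eq) (sym (path-balance (paths-B (pair m) true (Valid-pair m≢n))))))

    agree-from-0 : Agree 0 → ∀ m → m ≤ n → Agree m
    agree-from-0 agree zero    _   = agree
    agree-from-0 agree (suc m) m<n = agree-up (ℕ.<⇒≢ m<n) (agree-from-0 agree m (ℕ.<⇒≤ m<n))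

    agree-from-n : Agree n → ∀ j m → j + m ≡ n → Agree m
    agree-from-n agree zero    m refl = agree
    agree-from-n agree (suc j) m eq   =
      agree-down (λ { refl → ℕ.m≢1+n+m m (sym eq) }) (agree-from-n agree j (suc m) (trans (ℕ.+-suc j m) eq))

    -- Balance only links the counts of consecutive letters, so the induction needs a starting pair
    -- that misses block i: y₀, y₁ if i ≥ 3, and otherwise y_p, y_n, because blocks 0, 1, 2 use
    -- letters up to y₃ only and p ≥ 4.
    agree-≤ : ∀ m → m ≤ n → Agree m
    agree-≤ m m≤n with 3 Nat.≤? i
    ... | yes 3≤i = agree-from-0 (proj₁ (agree-absent (λ ()) far)) m m≤n
      where
      far : ∀ z → z ∈ Bᵢ → z < 0 ⊎ 1 < z
      far z z∈ = inj₂ (ℕ.≤-pred (ℕ.≤-trans 3≤i (proj₁ (block-bounds n i z∈))))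
    ... | no 3≰i = agree-from-n (proj₂ (agree-absent (ℕ.1+n≢n ∘ sym) far)) (n Nat.∸ m) m (ℕ.m∸n+n≡m m≤n)
      where
      far : ∀ z → z ∈ Bᵢ → z < p ⊎ n < z
      far z z∈ = inj₁ (ℕ.≤-trans (s≤s (proj₁ (proj₂ (block-bounds n i z∈)))) (ℕ.≤-trans (s≤s (ℕ.≰⇒> 3≰i)) 4≤p))

    agree : ∀ m → Agree m
    agree m with m Nat.≤? n
    ... | yes m≤n = agree-≤ m m≤n
    ... | no m≰n = proj₁ (agree-absent (λ { refl → m≰n ℕ.≤-refl })
                     (λ z z∈ → inj₁ (ℕ.≤-<-trans (proj₂ (proj₂ (block-bounds n i z∈)) i≤n) (ℕ.≰⇒> m≰n))))

    A⊆B : All (_∈ Bᵢ) A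
    A⊆B = All.tabulate λ {z} z∈ → count≢0 z Bᵢ (subst (_≢ 0) (agree z) (∈⇒count≢0 z∈))

    B⊆A : ∀ {z} → z ∈ Bᵢ → z ∈ A
    B⊆A {z} z∈ = count≢0 z A (subst (_≢ 0) (sym (agree z)) (∈⇒count≢0 z∈))

    start : ∀ {χ z r c d} → Valid χ → Bᵢ ≡ z ∷ r → χ z ≡ (c ⟶ d) →
            ∃ λ e → Path χ A c e
    start {χ} valid eq χz =
      target true (prod (el ∘ χ) Bᵢ) , subst (λ c → Path χ A c _) (head-start eq χz (paths-B χ true valid)) (paths χ true valid)

  block-unique-interior : ∀ j A → suc j < n → BlockPaths (suc j) A → A ≡ block n (suc j)
  block-unique-interior j A j<n paths = trans (comparable⇒≡ cmp (λ m → trans (agree m) (cong (count m) B≡))) (sym B≡)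
    where
    open Block (suc j) (ℕ.<⇒≤ j<n) A paths
    B≡ : Bᵢ ≡ suc j ∷ j ∷ suc (suc j) ∷ suc j ∷ []
    B≡ with suc j <ᵇ n | ℕ.<⇒<ᵇ j<n
    ... | true | _ = refl
    over : All (λ z → z ≡ suc j ⊎ z ≡ j ⊎ z ≡ suc (suc j)) A
    over = All.map (λ {z} → place ∘ subst (z ∈_) B≡) A⊆B
      where
      place : ∀ {z} → z ∈ suc j ∷ j ∷ suc (suc j) ∷ suc j ∷ [] → z ≡ suc j ⊎ z ≡ j ⊎ z ≡ suc (suc j)
      place (here refl) = inj₁ refl
      place (there (here refl)) = inj₂ (inj₁ refl)
      place (there (there (here refl))) = inj₂ (inj₂ refl)
      place (there (there (there (here refl)))) = inj₁ refl
    cmp : Comparable A (suc j ∷ j ∷ suc (suc j) ∷ suc j ∷ [])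
    cmp = Interior.comparable-interior j over (B⊆A (there (here refl)))
      (proj₂ (start (Valid-pair (ℕ.<⇒≢ (ℕ.<⇒≤ j<n))) B≡ (pair-snd j)))
      (proj₂ (start (Valid-pair (ℕ.<⇒≢ j<n)) B≡ (pair-fst (suc j))))
      (paths κ true Valid-κ)

  block-unique-last : ∀ A → BlockPaths n A → A ≡ block n n
  block-unique-last A paths = trans (comparable⇒≡ cmp (λ m → trans (agree m) (cong (count m) B≡))) (sym B≡)
    where
    open Block n ℕ.≤-refl A paths
    B≡ : Bᵢ ≡ n ∷ p ∷ n ∷ []
    B≡ with n <ᵇ n in eq
    ... | false = refl
    ... | true = ⊥-elim (ℕ.<-irrefl refl (ℕ.<ᵇ⇒< n n (subst T (sym eq) _)))
    over : All (λ z → z ≡ n ⊎ z ≡ p) A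
    over = All.map (λ {z} → place ∘ subst (z ∈_) B≡) A⊆B
      where
      place : ∀ {z} → z ∈ n ∷ p ∷ n ∷ [] → z ≡ n ⊎ z ≡ p
      place (here refl) = inj₁ refl
      place (there (here refl)) = inj₂ refl
      place (there (there (here refl))) = inj₁ refl
    cmp : Comparable A (n ∷ p ∷ n ∷ [])
    cmp = Ends.comparable-end {pair p} (pair-snd p) (pair-fst p) (λ ()) over
      (proj₂ (start (Valid-pair (ℕ.1+n≢n ∘ sym)) B≡ (pair-snd p)))

  block-unique : ∀ i → i ≤ n → ∀ A → BlockPaths i A → A ≡ block n i
  block-unique zero i≤n A paths =
    comparable⇒≡ (Ends.comparable-end {pair 0} refl refl (λ ()) over (paths (pair 0) true (Valid-pair {0} λ ()))) agree
    where
    open Block zero i≤n A paths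
    over : All (λ z → z ≡ 0 ⊎ z ≡ 1) A
    over = All.map (λ { (here refl) → inj₁ refl ; (there (here refl)) → inj₂ refl ; (there (there (here refl))) → inj₁ refl }) A⊆B
  block-unique (suc j) i≤n A paths with suc j Nat.≟ n
  ... | yes refl = block-unique-last A paths
  ... | no j≢n   = block-unique-interior j A (ℕ.≤∧≢⇒< i≤n j≢n) paths

  -- The first letter of a nonempty gap would have to be readable at both vertices. For yₙ the pair
  -- below is taken, since `pair n` kills the last block.
  gap-empty : ∀ G → (∀ χ h → Valid χ → Path χ G h h) → G ≡ []
  gap-empty [] _ = refl
  gap-empty (m ∷ G) paths with m Nat.≟ n
  ... | no m≢n with σ ∷ _ ← paths (pair m) true (Valid-pair m≢n) with () ← proj₁ (edge-step (pair-fst m) σ)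
  ... | yes refl with σ ∷ _ ← paths (pair p) false (Valid-pair (ℕ.1+n≢n ∘ sym)) with () ← proj₁ (edge-step (pair-snd p) σ)

  next-separator : ∀ (v : List (Letter ℕ)) {x r} → filterᵇ separator? v ≡ x ∷ r →
                   ∃₂ λ G v′ → v ≡ map y G ++ x ∷ v′ × filterᵇ separator? v′ ≡ r
  next-separator (y m ∷ v) eq with G , v′ , refl , eq′ ← next-separator v eq = m ∷ G , v′ , refl , eq′
  next-separator (s i ∷ v) refl = [] , v , refl , refl
  next-separator (t i ∷ v) refl = [] , v , refl , refl

  no-separator : ∀ (v : List (Letter ℕ)) → filterᵇ separator? v ≡ [] → ∃ λ G → v ≡ map y G
  no-separator [] _ = [] , refl
  no-separator (y m ∷ v) eq with G , refl ← no-separator v eq = m ∷ G , refl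

  colour : (ℕ → Colour) → Bool → Bool → Letter ℕ → Colour
  colour χ g h = separate χ g h (block n)

  split-chunk : ∀ {χ g h} G i A v → Path (colour χ g h) (map y G ++ s i ∷ map y A ++ t i ∷ v) h h →
                let x = prod (el ∘ χ) (block n i) in
                Path χ G h h × Path χ A (source g x) (target g x) × Path (colour χ g h) v h h
  split-chunk G i A v π with path-split (map y G) π
  ... | _ , γ , (move ∷ ρ) with path-split (map y A) ρ
  ...   | _ , α , (move ∷ τ) = path-map⁻¹ G γ , path-map⁻¹ A α , τ

  parse : ∀ is v → All (_≤ n) is → filterᵇ separator? v ≡ separators is →
          (∀ χ g h → Valid χ → Path (colour χ g h) v h h) → v ≡ chunks (block n) is
  parse [] v [] eq paths with G , refl ← no-separator v eq =
    cong (map y) (gap-empty G (λ χ h valid → path-map⁻¹ G (paths χ true h valid)))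
  parse (i ∷ is) v (i≤n ∷ is≤n) eq paths
    with G , v′ , refl , eq′ ← next-separator v eq
    with A , v″ , refl , eq″ ← next-separator v′ eq′ =
    trans (cong₂ (λ G A → map y G ++ s i ∷ map y A ++ t i ∷ v″)
            (gap-empty G (λ χ h valid → proj₁ (split χ true h valid)))
            (block-unique i i≤n A (λ χ g valid → proj₁ (proj₂ (split χ g true valid)))))
          (trans (cong (λ u → s i ∷ map y (block n i) ++ t i ∷ u)
                   (parse is v″ is≤n eq″ (λ χ g h valid → proj₂ (proj₂ (split χ g h valid)))))
                 (cong (s i ∷_) (sym (++-assoc (map y (block n i)) (t i ∷ []) _))))
    where
    split : ∀ χ g h → Valid χ → _
    split χ g h valid = split-chunk {χ} {g} {h} G i A v″ (paths χ g h valid)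

  -- First the separators of v are found to be those of w_n in the same order; they cut v into
  -- candidates for blocks and gaps, which `parse` identifies one by one.
  word-isoterm : ∀ {v} → word n ∼ v → v ≡ word n
  word-isoterm {v} w∼v = parse (range 0 (suc n)) v (indices-≤ n)
    (trans (sym (good⇒isoterm-B {w = word n} {v = v}
              (distinct⇒good (letter-≟ Nat._≟_) (filter-word n) (separators-unique (range-unique 0 (suc n)))) w∼v))
           (filter-word n))
    (λ χ g h valid → path-∼ {w = word n} {v = v} w∼v
      (path-chunks {b = block n} {range 0 (suc n)} (All.map (valid _) (indices-≤ n))))

∈-concatMap : ∀ {θ : A → List B} {z x w} → z ∈ w → x ∈ θ z → x ∈ concatMap θ w
∈-concatMap (here refl) x∈ = ∈-++⁺ˡ x∈
∈-concatMap {θ = θ} (there {x = z′} z∈) x∈ = ∈-++⁺ʳ (θ z′) (∈-concatMap z∈ x∈)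

concatMap≡[] : ∀ (θ : A → List B) {z w} → z ∈ w → concatMap θ w ≡ [] → θ z ≡ []
concatMap≡[] θ (here refl) eq = ++-conicalˡ _ _ eq
concatMap≡[] θ (there {x = z′} z∈) eq = concatMap≡[] θ z∈ (++-conicalʳ (θ z′) _ eq)

∈-range : ∀ {a i} k → a ≤ i → i < k + a → i ∈ range a k
∈-range zero a≤i i<a = ⊥-elim (ℕ.<⇒≱ i<a a≤i)
∈-range {a} {i} (suc k) a≤i i< with a Nat.≟ i
... | yes refl = here refl
... | no a≢i = there (∈-range k (ℕ.≤∧≢⇒< a≤i a≢i) (subst (i <_) (sym (ℕ.+-suc k a)) i<))

chunks-split : ∀ (b : I → List ℕ) {i is} → i ∈ is →
               ∃₂ λ α β → chunks b is ≡ α ++ (map y (b i) ++ β)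
chunks-split b {i} (here {xs = is} refl) =
  s i ∷ [] , t i ∷ chunks b is , cong (s i ∷_) (++-assoc (map y (b i)) (t i ∷ []) _)
chunks-split b (there {x = j} i∈) with α , β , eq ← chunks-split b i∈ =
  chunk b j ++ α , β , trans (cong (chunk b j ++_) eq) (sym (++-assoc (chunk b j) α _))

concatMap-chunks : ∀ (θ : Letter I → List B) b {is} →
                   All (λ i → ∀ z → z ∈ b i → θ (y z) ≡ []) is →
                   concatMap θ (chunks b is) ≡ concatMap θ (separators is)
concatMap-chunks θ b [] = refl
concatMap-chunks θ b {i ∷ is} (erased ∷ rest) = begin
  θ (s i) ++ concatMap θ ((map y (b i) ++ t i ∷ []) ++ chunks b is)
    ≡⟨ cong (λ w → θ (s i) ++ concatMap θ w) (++-assoc (map y (b i)) _ _) ⟩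
  θ (s i) ++ concatMap θ (map y (b i) ++ t i ∷ chunks b is)
    ≡⟨ cong (θ (s i) ++_) (concatMap-++ θ (map y (b i)) _) ⟩
  θ (s i) ++ (concatMap θ (map y (b i)) ++ (θ (t i) ++ concatMap θ (chunks b is)))
    ≡⟨ cong₂ (λ u v → θ (s i) ++ (u ++ (θ (t i) ++ v))) (erase (b i) erased) (concatMap-chunks θ b rest) ⟩
  θ (s i) ++ (θ (t i) ++ concatMap θ (separators is)) ∎
  where
  open ≡-Reasoning
  erase : ∀ w → (∀ z → z ∈ w → θ (y z) ≡ []) → concatMap θ (map y w) ≡ []
  erase []      _  = refl
  erase (z ∷ w) eq = trans (cong (_++ concatMap θ (map y w)) (eq z (here refl))) (erase w (λ z′ z∈ → eq z′ (there z∈)))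

-- Avoidability in z∞

-- What the descent needs of a block; it covers both Bᵢ and the doubled letter of w′_n.
Bracketed : ℕ → (ℕ → List ℕ) → Set
Bracketed n b = ∀ i → i ≤ n → ∃ (λ mid → b i ≡ i ∷ mid ++ (i ∷ [])) × (∀ z → z ∈ b i → z ≤ n)

∈-indices : ∀ {n i} → i ≤ n → i ∈ range 0 (suc n)
∈-indices {n} {i} i≤n = ∈-range (suc n) z≤n (subst (i <_) (sym (ℕ.+-identityʳ (suc n))) (s≤s i≤n))

zeros : ∀ {w c d} → shrink w ≡ [] → Path alternate w c d → w ≡ [] ⊎ w ≡ 0 ∷ []
zeros {[]} _ _ = inj₁ refl
zeros {zero ∷ []} _ _ = inj₂ refl
zeros {zero ∷ zero ∷ w} _ (move ∷ () ∷ _)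

module Avoid (n : ℕ) (b : ℕ → List ℕ) (bracketed : Bracketed n b) where

  private
    W : List (Letter ℕ)
    W = chunks b (range 0 (suc n))

    split : ∀ {i} → i ≤ n → ∃₂ λ α β → W ≡ α ++ (map y (b i) ++ β)
    split i≤n = chunks-split b (∈-indices i≤n)

    y∈w : ∀ {i} → i ≤ n → y i ∈ W
    y∈w {i} i≤n with α , β , eq ← split i≤n | (mid , eq′) , _ ← bracketed i i≤n =
      subst (y i ∈_) (sym eq) (∈-++⁺ʳ α (∈-++⁺ˡ (subst (λ u → y i ∈ map y u) (sym eq′) (here refl))))

    -- The values are now powers of x₀, so by alternation a block has at most one x₀ in its image.
    -- But yᵢ stands at both ends of its block and contributes twice.
    finish : ∀ θ {c d} → (∀ i → i ≤ n → shrink (θ (y i)) ≡ []) → Path alternate (concatMap θ W) c d →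
             ∀ i → i ≤ n → θ (y i) ≡ []
    finish θ shr π i i≤n with α , β , eq ← split i≤n | (mid , eq′) , b≤n ← bracketed i i≤n
      with _ , _ , π₁ ← path-split (concatMap θ α) (subst (λ u → Path alternate u _ _) (trans (cong (concatMap θ) eq) (concatMap-++ θ α _)) π)
      with _ , π₂ , _ ← path-split (concatMap θ (map y (b i))) (subst (λ u → Path alternate u _ _) (concatMap-++ θ (map y (b i)) β) π₁) =
      tail (θ (y i)) (concatMap θ (map y mid)) (zeros block-zeros π₂) shape
      where
      shape : concatMap θ (map y (b i)) ≡ θ (y i) ++ (concatMap θ (map y mid) ++ (θ (y i) ++ []))
      shape = trans (cong (concatMap θ ∘ map y) eq′)
        (cong (θ (y i) ++_) (trans (cong (concatMap θ) (map-++ y mid (i ∷ []))) (concatMap-++ θ (map y mid) _)))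
      block-zeros : shrink (concatMap θ (map y (b i))) ≡ []
      block-zeros = trans (shrink-concatMap θ (map y (b i))) (go (b i) b≤n)
        where
        go : ∀ u → (∀ z → z ∈ u → z ≤ n) → concatMap (shrink ∘ θ) (map y u) ≡ []
        go []      _  = refl
        go (z ∷ u) ≤n = trans (cong (_++ concatMap (shrink ∘ θ) (map y u)) (shr z (≤n z (here refl)))) (go u (λ z′ z∈ → ≤n z′ (there z∈)))
      tail : ∀ (u v : Word) {r} → r ≡ [] ⊎ r ≡ 0 ∷ [] → r ≡ u ++ (v ++ (u ++ [])) → u ≡ []
      tail [] v _ _ = refl
      tail (_ ∷ u) v (inj₁ refl) ()
      tail (_ ∷ u) v (inj₂ refl) eq with () ← ++-conicalʳ v _ (++-conicalʳ u _ (sym (∷-injectiveʳ eq)))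

    erased-in : ∀ N θ → Factor (concatMap θ W) (zimin N) → ∀ i → i ≤ n → θ (y i) ≡ []
    erased-in N θ factor = finish θ (shr N factor) (proj₂ (proj₂ (factor⇒path (N , factor))))
      where
      shr : ∀ N → Factor (concatMap θ W) (zimin N) → ∀ i → i ≤ n → shrink (θ (y i)) ≡ []
      shr zero factor i i≤n with p , q , eq ← shrink-factor factor =
        concatMap≡[] (shrink ∘ θ) (y∈w i≤n)
          (trans (sym (shrink-concatMap θ W)) (++-conicalˡ _ q (++-conicalʳ p _ eq)))
      shr (suc N) factor =
        erased-in N (shrink ∘ θ) (subst₂ Factor (shrink-concatMap θ W) (shrink-zimin N) (shrink-factor factor))

  erased-Z : ∀ θ → IsFactor (concatMap θ W) → ∀ i → i ≤ n → θ (y i) ≡ []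
  erased-Z θ (N , factor) = erased-in N θ factor

-- Any block that forces a substitution into a square-free word to erase yᵢ would do.
double : ℕ → List ℕ
double i = i ∷ i ∷ []

word′ : ℕ → List (Letter ℕ)
word′ n = chunks double (range 0 (suc n))

bracketed-double : ∀ n → Bracketed n double
bracketed-double n i i≤n = ([] , refl) , λ { z (here refl) → i≤n ; z (there (here refl)) → i≤n }

neighbours : ℕ → ℕ → List ℕ
neighbours n i = left i ++ (if i <ᵇ n then suc i ∷ [] else [])

block-neighbours : ∀ n i → block n i ≡ i ∷ neighbours n i ++ (i ∷ [])
block-neighbours n i = cong (i ∷_) (sym (++-assoc (left i) _ _))

bracketed : ∀ n → Bracketed n (block n)
bracketed n i i≤n = (neighbours n i , block-neighbours n i) , λ z z∈ → proj₂ (proj₂ (block-bounds n i z∈)) i≤n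

erased⇒≡ : ∀ n (θ : Letter ℕ → List A) → (∀ i → i ≤ n → θ (y i) ≡ []) →
           concatMap θ (word n) ≡ concatMap θ (word′ n)
erased⇒≡ n θ erased = trans
  (concatMap-chunks θ (block n) (All.map (λ i≤n z z∈ → erased z (proj₂ (bracketed n _ i≤n) z z∈)) (indices-≤ n)))
  (sym (concatMap-chunks θ double (All.map (λ i≤n z z∈ → erased z (proj₂ (bracketed-double n _ i≤n) z z∈)) (indices-≤ n))))

square : ∀ x → x ·B x ≡ x ·B (x ·B x)
square e1  = refl
square ea  = refl
square eb  = refl
square eab = refl
square eba = refl
square e0  = refl

isoterm⇒squarefree : ∀ {w : List A} → (∀ {v} → w ∼ v → v ≡ w) → ∀ p a q → p ++ (a ++ (a ++ q)) ≡ w → a ≡ []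
isoterm⇒squarefree {w = w} isoterm p a q eq =
  ++-cancelʳ q a [] (++-cancelˡ a _ _ (++-cancelˡ a _ _ (++-cancelˡ p _ _ (trans (isoterm w∼) (sym eq)))))
  where
  open ≡-Reasoning
  w∼ : w ∼ (p ++ (a ++ (a ++ (a ++ q))))
  w∼ χ = trans (cong (prod χ) (sym eq)) (trans (prod-++ χ p _) (trans (cong (prod χ p ·B_) inner) (sym (prod-++ χ p _))))
    where
    x = prod χ a
    r = prod χ q
    inner : prod χ (a ++ (a ++ q)) ≡ prod χ (a ++ (a ++ (a ++ q)))
    inner = begin
      prod χ (a ++ (a ++ q))        ≡⟨ trans (prod-++ χ a _) (cong (x ·B_) (prod-++ χ a q)) ⟩
      x ·B (x ·B r)                 ≡⟨ sym (·B-assoc x x r) ⟩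
      (x ·B x) ·B r                 ≡⟨ cong (_·B r) (square x) ⟩
      (x ·B (x ·B x)) ·B r          ≡⟨ trans (·B-assoc x _ r) (cong (x ·B_) (·B-assoc x x r)) ⟩
      x ·B (x ·B (x ·B r))          ≡⟨ cong (λ z → x ·B (x ·B z)) (sym (prod-++ χ a q)) ⟩
      x ·B (x ·B prod χ (a ++ q))   ≡⟨ cong (x ·B_) (sym (prod-++ χ a _)) ⟩
      x ·B prod χ (a ++ (a ++ q))   ≡⟨ sym (prod-++ χ a _) ⟩
      prod χ (a ++ (a ++ (a ++ q))) ∎

-- Finding the nonlinear part of one word inside another

unique-split : ∀ {p u} {x : A} → Unique (p ++ (x ∷ u)) → ¬ x ∈ u
unique-split {p = []} (x≢ ∷ _) x∈ = All.lookup x≢ x∈ refl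
unique-split {p = _ ∷ p} (_ ∷ unique) x∈ = unique-split {p = p} unique x∈

unique-last : ∀ α {β : List A} M {x} → Unique (M ++ (x ∷ [])) → α ++ (x ∷ β) ≡ M ++ (x ∷ []) → α ≡ M × β ≡ []
unique-last [] [] _ refl = refl , refl
unique-last [] (m ∷ M) (m≢ ∷ _) refl = ⊥-elim (All.lookup m≢ (∈-++⁺ʳ M (here refl)) refl)
unique-last (_ ∷ α) [] _ eq with () ← ++-conicalʳ α _ (∷-injectiveʳ eq)
unique-last (a ∷ α) (m ∷ M) (_ ∷ unique) eq with refl , eq′ ← ∷-injective eq
  with refl , β≡[] ← unique-last α M unique eq′ = refl , β≡[]

-- Only x occurs twice in x M x, so the two occurrences of u must be its first and its last letter;
-- this leaves no room for p, U and q.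
bracket-unique : ∀ p {u} U V {x : A} {q M} → Unique (M ++ (x ∷ [])) →
                 p ++ ((u ∷ U) ++ (V ++ ((u ∷ U) ++ q))) ≡ x ∷ M ++ (x ∷ []) →
                 p ≡ [] × u ≡ x × U ≡ [] × V ≡ M × q ≡ []
bracket-unique [] {u} U V {x} {q} {M} unique eq with refl , eq′ ← ∷-injective eq
  with α≡M , β≡[] ← unique-last (U ++ V) M unique (trans (++-assoc U V _) eq′)
  with refl ← ++-conicalˡ U q β≡[] = refl , refl , refl , α≡M , β≡[]
bracket-unique (_ ∷ p) {u} U V {x} {q} {M} unique eq with refl , eq′ ← ∷-injective eq =
  ⊥-elim (unique-split {p = p} (subst Unique (sym eq′) unique) (∈-++⁺ʳ U (∈-++⁺ʳ V (here refl))))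

neighbours-unique : ∀ n i → Unique (neighbours n i ++ (i ∷ []))
neighbours-unique n zero with 0 <ᵇ n
... | true  = ((λ ()) ∷ []) ∷ [] ∷ []
... | false = [] ∷ []
neighbours-unique n (suc i) with suc i <ᵇ n
... | true  = (ℕ.<⇒≢ (ℕ.m≤n+m (suc i) 1) ∷ (ℕ.1+n≢n ∘ sym) ∷ []) ∷ (ℕ.1+n≢n ∷ []) ∷ [] ∷ []
... | false = ((ℕ.1+n≢n ∘ sym) ∷ []) ∷ [] ∷ []

locate-prefix : ∀ f {q} B {i : I} {r} → map y f ++ q ≡ map y B ++ (t i ∷ r) →
                ∃ λ q₁ → B ≡ f ++ q₁ × q ≡ map y q₁ ++ (t i ∷ r)
locate-prefix [] B eq = B , refl , eq
locate-prefix (m ∷ f) (z ∷ B) eq with refl , eq′ ← ∷-injective eq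
  with q₁ , refl , eq″ ← locate-prefix f B eq′ = q₁ , refl , eq″

locate-block : ∀ p f {q} B {i : I} {r} → f ≢ [] → p ++ (map y f ++ q) ≡ map y B ++ (t i ∷ r) →
  (∃₂ λ p₁ q₁ → p ≡ map y p₁ × B ≡ p₁ ++ (f ++ q₁) × q ≡ map y q₁ ++ (t i ∷ r)) ⊎
  (∃ λ p′ → p ≡ map y B ++ (t i ∷ p′) × p′ ++ (map y f ++ q) ≡ r)
locate-block [] f B f≢[] eq with q₁ , eq₁ , eq₂ ← locate-prefix f B eq = inj₁ ([] , q₁ , refl , eq₁ , eq₂)
locate-block (_ ∷ p) f [] f≢[] eq with refl , eq′ ← ∷-injective eq = inj₂ (p , refl , eq′)
locate-block (_ ∷ p) f (z ∷ B) f≢[] eq with refl , eq′ ← ∷-injective eq with locate-block p f B f≢[] eq′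
... | inj₁ (p₁ , q₁ , refl , refl , eq″) = inj₁ (z ∷ p₁ , q₁ , refl , refl , eq″)
... | inj₂ (p′ , refl , eq″) = inj₂ (p′ , refl , eq″)

record Location (b : I → List ℕ) (is : List I) (p : List (Letter I)) (f : List ℕ) (q : List (Letter I)) : Set where
  field
    {before after} : List I
    {index}        : I
    {prefix suffix} : List ℕ
    indices : is ≡ before ++ (index ∷ after)
    left≡   : p ≡ chunks b before ++ (s index ∷ map y prefix)
    block≡  : b index ≡ prefix ++ (f ++ suffix)
    right≡  : q ≡ map y suffix ++ (t index ∷ chunks b after)

locate : ∀ (b : I → List ℕ) is p {f q} → f ≢ [] → p ++ (map y f ++ q) ≡ chunks b is → Location b is p f q
locate b [] p {f} f≢[] eq with f
... | [] = ⊥-elim (f≢[] refl)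
... | _ ∷ _ with () ← ++-conicalʳ p _ eq
locate b (i ∷ is) [] {f} f≢[] eq with f
... | [] = ⊥-elim (f≢[] refl)
locate b (i ∷ is) (_ ∷ p) {f} f≢[] eq with refl , eq′ ← ∷-injective eq
  with locate-block p f (b i) f≢[] (trans eq′ (++-assoc (map y (b i)) _ _))
... | inj₁ (p₁ , q₁ , refl , eq₁ , eq₂) =
  record { before = [] ; indices = refl ; left≡ = refl ; block≡ = eq₁ ; right≡ = eq₂ }
... | inj₂ (p′ , refl , eq″) with l ← locate b is p′ f≢[] eq″ = record
  { before = i ∷ before
  ; indices = cong (i ∷_) indices
  ; left≡ = cong (s i ∷_) (trans (cong (λ u → map y (b i) ++ (t i ∷ u)) left≡)
      (trans (sym (++-assoc (map y (b i)) (t i ∷ []) _)) (sym (++-assoc (map y (b i) ++ t i ∷ []) (chunks b before) _))))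
  ; block≡ = block≡ ; right≡ = right≡ }
  where open Location l

range-split : ∀ before {c after} a k → range a k ≡ before ++ (c ∷ after) →
              before ≡ range a (length before) × c ≡ length before + a × after ≡ range (suc c) (length after) ×
              k ≡ length before + suc (length after)
range-split [] a (suc k) refl = refl , refl , cong (range (suc a)) (sym (len (suc a) k)) , cong suc (sym (len (suc a) k))
  where
  len : ∀ a k → length (range a k) ≡ k
  len a zero    = refl
  len a (suc k) = cong suc (len (suc a) k)
range-split (_ ∷ before) a (suc k) eq with refl , eq′ ← ∷-injective eq
  with eq₁ , eq₂ , eq₃ , eq₄ ← range-split before (suc a) k eq′ =
  cong (a ∷_) eq₁ , trans eq₂ (ℕ.+-suc _ a) , eq₃ , cong suc eq₄

∈-filterᵇ : ∀ (p : A → Bool) {x w} → x ∈ w → p x ≡ true → x ∈ filterᵇ p w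
∈-filterᵇ p {x} (here {xs = w} refl) px rewrite filterᵇ-true p x w px = here refl
∈-filterᵇ p (there {x = z} x∈) px with p z
... | true  = there (∈-filterᵇ p x∈ px)
... | false = ∈-filterᵇ p x∈ px

separator-linear : ∀ n P {x R} → P ++ (x ∷ R) ≡ word n → separator? x ≡ true → ¬ x ∈ R
separator-linear n P {x} {R} eq sep x∈ = unique-split {p = filterᵇ separator? P}
  (subst Unique filter≡ (separators-unique (range-unique 0 (suc n))))
  (∈-filterᵇ separator? x∈ sep)
  where
  open ≡-Reasoning
  filter≡ : separators (range 0 (suc n)) ≡ filterᵇ separator? P ++ (x ∷ filterᵇ separator? R)
  filter≡ = begin
    separators (range 0 (suc n))                         ≡⟨ sym (filter-word n) ⟩
    filterᵇ separator? (word n)                          ≡⟨ cong (filterᵇ separator?) (sym eq) ⟩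
    filterᵇ separator? (P ++ (x ∷ R))                    ≡⟨ filter-++ _ P (x ∷ R) ⟩
    filterᵇ separator? P ++ filterᵇ separator? (x ∷ R)   ≡⟨ cong (filterᵇ separator? P ++_) (filterᵇ-true separator? x R sep) ⟩
    filterᵇ separator? P ++ (x ∷ filterᵇ separator? R)   ∎

no-separators : ∀ (w : List (Letter I)) → (∀ x → x ∈ w → separator? x ≡ false) → ∃ λ f → w ≡ map y f
no-separators [] _ = [] , refl
no-separators (y m ∷ w) ¬sep with f , refl ← no-separators w (λ x x∈ → ¬sep x (there x∈)) = m ∷ f , refl
no-separators (s i ∷ w) ¬sep with () ← ¬sep (s i) (here refl)
no-separators (t i ∷ w) ¬sep with () ← ¬sep (t i) (here refl)

neighbours-interior : ∀ {n j} → suc j < n → neighbours n (suc j) ≡ j ∷ suc (suc j) ∷ []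
neighbours-interior {n} {j} j<n with suc j <ᵇ n | ℕ.<⇒<ᵇ j<n
... | true | _ = refl

neighbours-last : ∀ n → neighbours (suc n) (suc n) ≡ n ∷ []
neighbours-last n with suc n <ᵇ suc n in eq
... | false = refl
... | true  = ⊥-elim (ℕ.<-irrefl refl (ℕ.<ᵇ⇒< (suc n) (suc n) (subst T (sym eq) _)))

y∈chunks : ∀ {b : I → List ℕ} {i is m} → i ∈ is → m ∈ b i → y m ∈ chunks b is
y∈chunks {b = b} i∈ m∈ with α , β , eq ← chunks-split b i∈ =
  subst (_ ∈_) (sym eq) (∈-++⁺ʳ α (∈-++⁺ˡ (∈-map⁺ y m∈)))

right∈block : ∀ {n i} → i < n → suc i ∈ block n i
right∈block {n} {i} i<n with i <ᵇ n | ℕ.<⇒<ᵇ i<n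
... | true | _ = there (∈-++⁺ʳ (left i) (here refl))

concatMap-split : ∀ (θ : A → List B) {w} α u β p q {r} → w ≡ α ++ (u ++ β) → p ++ (concatMap θ w ++ q) ≡ r →
                  (p ++ concatMap θ α) ++ (concatMap θ u ++ (concatMap θ β ++ q)) ≡ r
concatMap-split θ α u β p q refl eq = trans (trans (++-assoc p _ _) (cong (p ++_) (begin
  concatMap θ α ++ (concatMap θ u ++ (concatMap θ β ++ q)) ≡⟨ cong (concatMap θ α ++_) (sym (++-assoc (concatMap θ u) _ q)) ⟩
  concatMap θ α ++ ((concatMap θ u ++ concatMap θ β) ++ q) ≡⟨ cong (λ x → concatMap θ α ++ (x ++ q)) (sym (concatMap-++ θ u β)) ⟩
  concatMap θ α ++ (concatMap θ (u ++ β) ++ q)             ≡⟨ sym (++-assoc (concatMap θ α) _ q) ⟩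
  (concatMap θ α ++ concatMap θ (u ++ β)) ++ q             ≡⟨ cong (_++ q) (sym (concatMap-++ θ α (u ++ β))) ⟩
  concatMap θ (α ++ (u ++ β)) ++ q ∎))) eq
  where open ≡-Reasoning

-- Instances of w_n inside w_m

module Occurrence (n′ m′ : ℕ) (θ : Letter ℕ → List (Letter ℕ)) (p q : List (Letter ℕ))
  (occurs : p ++ (concatMap θ (word (suc n′)) ++ q) ≡ word (suc m′)) where

  n m : ℕ
  n = suc n′
  m = suc m′

  before-block after-block : ℕ → List (Letter ℕ)
  before-block i = chunks (block n) (range 0 i) ++ (s i ∷ [])
  after-block i  = t i ∷ chunks (block n) (range (suc i) (n Nat.∸ i))

  word-split : ∀ {i} → i ≤ n → word n ≡ before-block i ++ (map y (block n i) ++ after-block i)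
  word-split {i} i≤n = begin
    word n
      ≡⟨ cong (chunks (block n)) range≡ ⟩
    chunks (block n) (range 0 i ++ (i ∷ range (suc i) (n Nat.∸ i)))
      ≡⟨ concatMap-++ (chunk (block n)) (range 0 i) _ ⟩
    chunks (block n) (range 0 i) ++ (s i ∷ (map y (block n i) ++ t i ∷ []) ++ chunks (block n) (range (suc i) (n Nat.∸ i)))
      ≡⟨ cong (λ w → chunks (block n) (range 0 i) ++ (s i ∷ w)) (++-assoc (map y (block n i)) _ _) ⟩
    chunks (block n) (range 0 i) ++ (s i ∷ (map y (block n i) ++ after-block i))
      ≡⟨ sym (++-assoc (chunks (block n) (range 0 i)) _ _) ⟩
    before-block i ++ (map y (block n i) ++ after-block i) ∎
    where
    open ≡-Reasoning
    range≡ : range 0 (suc n) ≡ range 0 i ++ (i ∷ range (suc i) (n Nat.∸ i))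
    range≡ = begin
      range 0 (suc n) ≡⟨ cong (range 0) (sym (trans (ℕ.+-suc i _) (cong suc (ℕ.m+[n∸m]≡n i≤n)))) ⟩
      range 0 (i + suc (n Nat.∸ i)) ≡⟨ range-++ 0 i _ ⟩
      range 0 i ++ range (i + 0) (suc (n Nat.∸ i)) ≡⟨ cong (λ a → range 0 i ++ range a (suc (n Nat.∸ i))) (ℕ.+-identityʳ i) ⟩
      range 0 i ++ (i ∷ range (suc i) (n Nat.∸ i)) ∎

  occurs-at : ∀ {i} → i ≤ n →
    (p ++ concatMap θ (before-block i)) ++
      (concatMap θ (map y (block n i)) ++ (concatMap θ (after-block i) ++ q)) ≡ word m
  occurs-at {i} i≤n = concatMap-split θ (before-block i) (map y (block n i)) (after-block i) p q (word-split i≤n) occurs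

  block-image : ∀ i → concatMap θ (map y (block n i)) ≡ θ (y i) ++ (concatMap θ (map y (neighbours n i)) ++ θ (y i))
  block-image i = trans (cong (concatMap θ ∘ map y) (block-neighbours n i))
    (cong (θ (y i) ++_) (trans (cong (concatMap θ) (map-++ y (neighbours n i) (i ∷ [])))
      (trans (concatMap-++ θ (map y (neighbours n i)) _) (cong (concatMap θ (map y (neighbours n i)) ++_) (++-identityʳ _)))))

  -- yᵢ occurs twice in its block, so a separator in its value would occur twice in w_m.
  image-y : ∀ {i x} → i ≤ n → x ∈ θ (y i) → separator? x ≡ false
  image-y {i} {x} i≤n x∈ with separator? x in sep | ∈-∃++ x∈
  ... | false | _ = refl
  ... | true  | a , c , eq = ⊥-elim (separator-linear m ((p ++ concatMap θ (before-block i)) ++ a) shape sep (∈-++⁺ʳ c (∈-++⁺ˡ {ys = R} (∈-++⁺ʳ V x∈))))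
    where
    V = concatMap θ (map y (neighbours n i))
    R = concatMap θ (after-block i) ++ q
    shape : ((p ++ concatMap θ (before-block i)) ++ a) ++ (x ∷ (c ++ ((V ++ θ (y i)) ++ R))) ≡ word m
    shape = trans (++-assoc (p ++ concatMap θ (before-block i)) a _)
      (trans (cong ((p ++ concatMap θ (before-block i)) ++_)
        (trans (sym (++-assoc a (x ∷ c) _))
          (trans (cong (_++ ((V ++ θ (y i)) ++ R)) (sym eq))
            (trans (sym (++-assoc (θ (y i)) _ R)) (cong (_++ R) (sym (block-image i)))))))
        (occurs-at i≤n))

  record Image (i : ℕ) : Set where
    field
      {index}    : ℕ
      index≤m    : index ≤ m
      image      : θ (y i) ≡ y index ∷ []
      neighbour-images : concatMap θ (map y (neighbours n i)) ≡ map y (neighbours m index)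
      first      : index ≡ 0 → i ≡ 0
      last       : index ≡ m → i ≡ n

  block-only-y : ∀ {i} → i ≤ n → ∀ w → (∀ z → z ∈ w → z ≤ n) → ∃ λ f → concatMap θ (map y w) ≡ map y f
  block-only-y i≤n [] _ = [] , refl
  block-only-y i≤n (z ∷ w) ≤n
    with f , eq ← no-separators (θ (y z)) (λ x x∈ → image-y (≤n z (here refl)) x∈)
       | g , eq′ ← block-only-y i≤n w (λ z′ z∈ → ≤n z′ (there z∈)) =
    f ++ g , trans (cong₂ _++_ eq eq′) (sym (map-++ y f g))

  neighbour-≤ : ∀ {i} → i ≤ n → ∀ z → z ∈ neighbours n i → z ≤ n
  neighbour-≤ {i} i≤n z z∈ =
    proj₂ (bracketed n i i≤n) z (subst (z ∈_) (sym (block-neighbours n i)) (there (∈-++⁺ˡ z∈)))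

  from-location : ∀ {i u U V} → i ≤ n → θ (y i) ≡ map y (u ∷ U) →
    concatMap θ (map y (neighbours n i)) ≡ map y V →
    Location (block m) (range 0 (suc m)) (p ++ concatMap θ (before-block i)) ((u ∷ U) ++ (V ++ (u ∷ U)))
      (concatMap θ (after-block i) ++ q) → Image i
  from-location {i} {u} {U} {V} i≤n U≡ V≡
    record { before = before ; after = after ; index = index ; prefix = prefix ; suffix = suffix
           ; indices = indices ; left≡ = left≡ ; block≡ = block≡ ; right≡ = right≡ }
    with refl , refl , refl , refl , refl ← bracket-unique prefix U V (neighbours-unique m index)
           (trans (cong (prefix ++_) (sym (trans (++-assoc (u ∷ U) _ suffix) (cong ((u ∷ U) ++_) (++-assoc V _ suffix)))))
             (trans (sym block≡) (block-neighbours m index)))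
    with _ , index≡ , _ , length≡ ← range-split before 0 (suc m) indices = record
      { index≤m = subst₂ _≤_ (sym (trans index≡ (ℕ.+-identityʳ _))) (sym m≡) (ℕ.m≤m+n (length before) (length after))
      ; image = U≡
      ; neighbour-images = V≡
      ; first = first-block before index≡ left≡
      ; last = last-block after m≡ right≡ }
    where
    m≡ : m ≡ length before + length after
    m≡ = ℕ.suc-injective (trans length≡ (ℕ.+-suc _ _))
    -- If i > 0, then yᵢ also occurs in block i-1, so its value must occur again to the left; but
    -- only s₀ stands before block 0 of w_m.
    first-block : ∀ before → index ≡ length before + 0 →
      p ++ concatMap θ (before-block i) ≡ chunks (block m) before ++ (s index ∷ []) → index ≡ 0 → i ≡ 0
    first-block (_ ∷ _) index≡ _ refl with () ← index≡
    first-block [] _ left≡ _ = at i refl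
      where
      at : ∀ j → j ≡ i → i ≡ 0
      at zero    refl = refl
      at (suc j) refl with y∈ ← subst (y index ∈_) left≡
        (∈-++⁺ʳ p (∈-concatMap {θ = θ} {w = before-block (suc j)} (∈-++⁺ˡ (y∈chunks {b = block n} (∈-range (suc j) z≤n (subst (j <_) (sym (ℕ.+-identityʳ (suc j))) ℕ.≤-refl)) (right∈block i≤n)))
          (subst (y index ∈_) (sym U≡) (here refl))))
        with y∈
      ... | here ()
      ... | there ()
    -- If i < n, then yᵢ occurs again in block i+1, while only t_m follows block m of w_m.
    last-block : ∀ after → m ≡ length before + length after →
      concatMap θ (after-block i) ++ q ≡ t index ∷ chunks (block m) after → index ≡ m → i ≡ n
    last-block (_ ∷ after) m≡ _ refl =
      ⊥-elim (ℕ.m≢1+m+n (length before) (trans (sym (trans index≡ (ℕ.+-identityʳ _))) (trans m≡ (ℕ.+-suc _ (length after)))))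
    last-block [] _ right≡ _ with i Nat.≟ n
    ... | yes i≡n = i≡n
    ... | no i≢n with y∈ ← subst (y index ∈_) right≡
      (∈-++⁺ˡ {ys = q} (∈-concatMap {θ = θ} {w = after-block i} (there (y∈chunks {b = block n}
          (∈-range (n Nat.∸ i) ℕ.≤-refl (subst (suc i <_) (sym (trans (ℕ.+-suc _ i) (cong suc (ℕ.m∸n+n≡m i≤n)))) (s≤s (ℕ.≤∧≢⇒< i≤n i≢n))))
          (there (here refl))))
        (subst (y index ∈_) (sym U≡) (here refl))))
      with y∈
    ... | here ()
    ... | there ()

  locate-image : ∀ {i} → i ≤ n → θ (y i) ≢ [] → Image i
  locate-image {i} i≤n θ≢[]
    with no-separators (θ (y i)) (λ x x∈ → image-y i≤n x∈) | block-only-y i≤n (neighbours n i) (neighbour-≤ i≤n)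
  ... | [] , U≡ | _ = ⊥-elim (θ≢[] U≡)
  ... | (u ∷ U) , U≡ | V , V≡ = from-location i≤n U≡ V≡
    (locate (block m) (range 0 (suc m)) (p ++ concatMap θ (before-block i)) (λ ())
      (trans (cong (λ w → (p ++ concatMap θ (before-block i)) ++ (w ++ (concatMap θ (after-block i) ++ q))) (sym f≡)) (occurs-at i≤n)))
    where
    f≡ : concatMap θ (map y (block n i)) ≡ map y ((u ∷ U) ++ (V ++ (u ∷ U)))
    f≡ = trans (block-image i) (trans (cong₂ (λ a c → a ++ (c ++ a)) U≡ V≡)
      (sym (trans (map-++ y (u ∷ U) _) (cong (map y (u ∷ U) ++_) (map-++ y V (u ∷ U))))))

  ∷≢[] : ∀ {x} {w : List (Letter ℕ)} → _≢_ {A = List (Letter ℕ)} (x ∷ w) []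
  ∷≢[] ()

  image-length : ∀ i → i ≤ n → θ (y i) ≡ [] ⊎ ∃ λ c → θ (y i) ≡ y c ∷ []
  image-length i i≤n with θ (y i) in eq
  ... | []    = inj₁ refl
  ... | x ∷ w with I ← locate-image i≤n (λ eq′ → ∷≢[] (trans (sym eq) eq′)) =
    inj₂ (Image.index I , trans (sym eq) (Image.image I))

  not-two : ∀ {i c d} → i ≤ n → concatMap θ (y i ∷ []) ≢ y c ∷ y d ∷ []
  not-two {i} i≤n eq with image-length i i≤n | trans (sym (++-identityʳ (θ (y i)))) eq
  ... | inj₁ eq₁       | eq₂ with () ← trans (sym eq₁) eq₂
  ... | inj₂ (_ , eq₁) | eq₂ with () ← trans (sym eq₁) eq₂

  two : ∀ {i j c d} → i ≤ n → j ≤ n → concatMap θ (y i ∷ y j ∷ []) ≡ y c ∷ y d ∷ [] →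
        θ (y i) ≡ y c ∷ [] × θ (y j) ≡ y d ∷ []
  two {i} {j} i≤n j≤n eq with image-length i i≤n
  ... | inj₁ eq₁ = ⊥-elim (not-two j≤n (trans (cong (_++ (θ (y j) ++ [])) (sym eq₁)) eq))
  ... | inj₂ (_ , eq₁) with refl , eq₂ ← ∷-injective (trans (cong (_++ (θ (y j) ++ [])) (sym eq₁)) eq) =
    eq₁ , trans (sym (++-identityʳ _)) eq₂

  one : ∀ {i c} → concatMap θ (y i ∷ []) ≡ y c ∷ [] → θ (y i) ≡ y c ∷ []
  one eq = trans (sym (++-identityʳ _)) eq

  image-of : ∀ {i c} → i ≤ n → θ (y i) ≡ y c ∷ [] →
             c ≤ m × concatMap θ (map y (neighbours n i)) ≡ map y (neighbours m c) × (c ≡ 0 → i ≡ 0) × (c ≡ m → i ≡ n)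
  image-of i≤n eq with locate-image i≤n (λ eq′ → ∷≢[] (trans (sym eq) eq′))
  ... | record { index≤m = c≤m ; image = eq′ ; neighbour-images = nb ; first = first ; last = last }
    with refl ← trans (sym eq) eq′ = c≤m , nb , first , last

  -- Each letter y has a value of length at most one, so an image of length two needs two
  -- neighbours, which are matched in order.
  two-neighbours : ∀ {i c} → i ≤ n → suc c < m → concatMap θ (map y (neighbours n i)) ≡ map y (neighbours m (suc c)) →
                   ∃ λ j → i ≡ suc j × suc j < n × θ (y j) ≡ y c ∷ [] × θ (y (suc (suc j))) ≡ y (suc (suc c)) ∷ []
  two-neighbours {zero} i≤n c<m nb =
    ⊥-elim (not-two (s≤s z≤n) (trans nb (cong (map y) (neighbours-interior c<m))))
  two-neighbours {suc j} i≤n c<m nb with suc j Nat.≟ n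
  ... | yes refl = ⊥-elim (not-two (ℕ.n≤1+n n′)
          (trans (cong (concatMap θ ∘ map y) (sym (neighbours-last n′))) (trans nb (cong (map y) (neighbours-interior c<m)))))
  ... | no j≢n with j<n ← ℕ.≤∧≢⇒< i≤n j≢n
    with eq₁ , eq₂ ← two (ℕ.<⇒≤ i≤n) j<n
           (trans (cong (concatMap θ ∘ map y) (sym (neighbours-interior j<n))) (trans nb (cong (map y) (neighbours-interior c<m)))) =
    j , refl , j<n , eq₁ , eq₂

  -- Passing to left neighbours lowers both indices together until c = 0, where `first` gives i = 0.
  descend : ∀ c i → i ≤ n → θ (y i) ≡ y c ∷ [] → i ≡ c
  descend zero i i≤n eq = proj₁ (proj₂ (proj₂ (image-of i≤n eq))) refl
  descend (suc c) i i≤n eq with c≤m , nb , _ , last ← image-of i≤n eq | suc c Nat.≟ m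
  ... | no c≢m with j , refl , j<n , eq₁ , _ ← two-neighbours i≤n (ℕ.≤∧≢⇒< c≤m c≢m) nb =
    cong suc (descend c j (ℕ.<⇒≤ i≤n) eq₁)
  ... | yes refl with refl ← last refl =
    cong suc (descend c n′ (ℕ.n≤1+n n′)
      (one (trans (cong (concatMap θ ∘ map y) (sym (neighbours-last n′))) (trans nb (cong (map y) (neighbours-last c))))))

  -- Passing to right neighbours carries yᵢ ↦ yᵢ up to i = m, where `last` gives i = n.
  ascend : ∀ k i → k + i ≡ m → i ≤ n → θ (y i) ≡ y i ∷ [] → n ≡ m
  ascend zero    i refl i≤n eq = sym (proj₂ (proj₂ (proj₂ (image-of i≤n eq))) refl)
  ascend (suc k) zero k≡ i≤n eq =
    ascend k 1 (trans (ℕ.+-suc k 0) k≡) (s≤s z≤n) (one (proj₁ (proj₂ (image-of i≤n eq))))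
  ascend (suc k) (suc i) k≡ i≤n eq
    with .i , refl , i<n , _ , eq₂ ← two-neighbours i≤n (subst (suc i <_) k≡ (s≤s (ℕ.m≤n+m (suc i) k))) (proj₁ (proj₂ (image-of i≤n eq))) =
    ascend k (suc (suc i)) (trans (ℕ.+-suc k (suc i)) k≡) i<n eq₂

  erased : n ≢ m → ∀ i → i ≤ n → θ (y i) ≡ []
  erased n≢m i i≤n with image-length i i≤n
  ... | inj₁ eq = eq
  ... | inj₂ (c , eq) with refl ← descend c i i≤n eq =
    ⊥-elim (n≢m (ascend (m Nat.∸ c) c (ℕ.m∸n+n≡m (proj₁ (image-of i≤n eq))) i≤n eq))

-- Short identities of M(z∞) fix w_n

++-compare : ∀ (u : List A) {v} w {x} → u ++ v ≡ w ++ x →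
             (∃ λ r → u ≡ w ++ r × x ≡ r ++ v) ⊎ (∃ λ r → w ≡ u ++ r × v ≡ r ++ x)
++-compare u       []      eq = inj₁ (u , refl , sym eq)
++-compare []      (z ∷ w) eq = inj₂ (z ∷ w , refl , eq)
++-compare (z ∷ u) (_ ∷ w) eq with refl , eq′ ← ∷-injective eq with ++-compare u w eq′
... | inj₁ (r , refl , eq″) = inj₁ (r , refl , eq″)
... | inj₂ (r , refl , eq″) = inj₂ (r , refl , eq″)

-- Each letter boundary of u can cut only one pair of adjacent chunks.
uncut : ∀ {V : Set} (b : ℕ → List ℕ) (θ : V → List (Letter ℕ)) U a k g →
        concatMap θ U ≡ g ++ chunks b (range a k) → length U + length U < k →
        ∃₂ λ U₁ z → ∃₂ λ U₂ π₁ → ∃₂ λ π₂ j → ∃ λ k′ →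
          U ≡ U₁ ++ (z ∷ U₂) ×
          θ z ≡ π₁ ++ ((chunk b (j + a) ++ chunk b (suc (j + a))) ++ π₂) ×
          concatMap θ U₁ ++ π₁ ≡ g ++ chunks b (range a j) ×
          π₂ ++ concatMap θ U₂ ≡ chunks b (range (2 + (j + a)) k′) ×
          k ≡ j + (2 + k′)
uncut b θ [] a (suc k) g eq _ with () ← ++-conicalʳ g _ (sym eq)
uncut b θ (z ∷ U) a k g eq <k rewrite ℕ.+-suc (length U) (length U) with k | <k
... | suc (suc k) | s≤s (s≤s <k′)
  -- Here g is the pending rest of chunks already cut. Either θ z covers g and the next two chunks,
  -- or these two are charged to z and what θ z leaves uncovered becomes the new g.
  with ++-compare (θ z) (g ++ (chunk b a ++ chunk b (suc a))) (trans eq (trans (cong (g ++_) (sym (++-assoc (chunk b a) _ _))) (sym (++-assoc g _ _))))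
... | inj₁ (r , eq₁ , eq₂) =
  [] , z , U , g , r , 0 , k , refl , trans eq₁ (++-assoc g _ r) , sym (++-identityʳ g) , sym eq₂ , refl
... | inj₂ (r , eq₁ , eq₂)
  with U₁ , z′ , U₂ , π₁ , π₂ , j , k′ , refl , eq₃ , eq₄ , eq₅ , refl ← uncut b θ U (2 + a) k r eq₂ <k′
  rewrite ℕ.+-suc j (suc a) | ℕ.+-suc j a =
  z ∷ U₁ , z′ , U₂ , π₁ , π₂ , 2 + j , k′ , refl , eq₃ ,
  (begin
    (θ z ++ concatMap θ U₁) ++ π₁        ≡⟨ ++-assoc (θ z) _ _ ⟩
    θ z ++ (concatMap θ U₁ ++ π₁)        ≡⟨ cong (θ z ++_) eq₄ ⟩
    θ z ++ (r ++ chunks b (range (2 + a) j)) ≡⟨ sym (++-assoc (θ z) r _) ⟩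
    (θ z ++ r) ++ chunks b (range (2 + a) j) ≡⟨ cong (_++ chunks b (range (2 + a) j)) (sym eq₁) ⟩
    (g ++ (chunk b a ++ chunk b (suc a))) ++ chunks b (range (2 + a) j) ≡⟨ ++-assoc g _ _ ⟩
    g ++ ((chunk b a ++ chunk b (suc a)) ++ chunks b (range (2 + a) j)) ≡⟨ cong (g ++_) (++-assoc (chunk b a) _ _) ⟩
    g ++ chunks b (range a (2 + j)) ∎) ,
  eq₅ , refl
  where open ≡-Reasoning

lift : Letter ℕ → Letter (Maybe ℕ)
lift (y i) = y i
lift (s i) = s (just i)
lift (t i) = t (just i)

-- The fresh separators stand next to each other in place of the two removed chunks; s takes all of
-- their text and t takes none.
restore : List (Letter ℕ) → Letter (Maybe ℕ) → List (Letter ℕ)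
restore w (y i)        = y i ∷ []
restore w (s (just i)) = s i ∷ []
restore w (t (just i)) = t i ∷ []
restore w (s nothing)  = w
restore w (t nothing)  = []

restore-lift : ∀ w u → concatMap (restore w) (map lift u) ≡ u
restore-lift w []        = refl
restore-lift w (y i ∷ u) = cong (y i ∷_) (restore-lift w u)
restore-lift w (s i ∷ u) = cong (s i ∷_) (restore-lift w u)
restore-lift w (t i ∷ u) = cong (t i ∷_) (restore-lift w u)

s∈chunks : ∀ (b : I → List ℕ) {i} is → s i ∈ chunks b is → i ∈ is
s∈chunks b (j ∷ is) (here refl) = here refl
s∈chunks b (j ∷ is) (there s∈) with ∈-++⁻ (map y (b j) ++ (t j ∷ [])) s∈
... | inj₂ s∈′ = there (s∈chunks b is s∈′)
... | inj₁ s∈′ with ∈-++⁻ (map y (b j)) s∈′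
...   | inj₁ s∈″ with _ , _ , () ← ∈-map⁻ y s∈″
...   | inj₂ (here ())

lift-chunks : ∀ n is → map lift (chunks (block n) is) ≡ chunks (contracted n) (map just is)
lift-chunks n []       = refl
lift-chunks n (i ∷ is) = cong (s (just i) ∷_)
  (trans (map-++ lift (map y (block n i) ++ t i ∷ []) _)
    (cong₂ _++_ (trans (map-++ lift (map y (block n i)) _) (cong (_++ (t (just i) ∷ [])) (lift-y (block n i)))) (lift-chunks n is)))
  where
  lift-y : ∀ w → map lift (map y w) ≡ map y w
  lift-y []      = refl
  lift-y (m ∷ w) = cong (y m ∷_) (lift-y w)

concatMap-concatMap : {C : Set} (ρ : B → List C) (θ : A → List B) (w : List A) →
                      concatMap ρ (concatMap θ w) ≡ concatMap (concatMap ρ ∘ θ) w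
concatMap-concatMap ρ θ []      = refl
concatMap-concatMap ρ θ (z ∷ w) =
  trans (concatMap-++ ρ (θ z) _) (cong (concatMap ρ (θ z) ++_) (concatMap-concatMap ρ θ w))

module Contract (n : ℕ) (θ : ℕ → List (Letter ℕ)) (z : ℕ) (U₁ U₂ : List ℕ) (π₁ π₂ : List (Letter ℕ)) (j k : ℕ)
  (θz : θ z ≡ π₁ ++ ((chunk (block n) j ++ chunk (block n) (suc j)) ++ π₂))
  (left≡ : concatMap θ U₁ ++ π₁ ≡ chunks (block n) (range 0 j))
  (right≡ : π₂ ++ concatMap θ U₂ ≡ chunks (block n) (range (2 + j) k)) where

  private
    seg : List (Letter ℕ)
    seg = chunk (block n) j ++ chunk (block n) (suc j)

    s∈θz : s j ∈ θ z
    s∈θz = subst (s j ∈_) (sym θz) (∈-++⁺ʳ π₁ (here refl))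

    z∉U₁ : ∀ {z′} → z′ ∈ U₁ → z′ ≢ z
    z∉U₁ z∈ refl = ℕ.<-irrefl refl (subst (j <_) (ℕ.+-identityʳ j)
      (proj₂ (All.lookup (range-bounds 0 j) (s∈chunks (block n) _ (subst (s j ∈_) left≡ (∈-++⁺ˡ (∈-concatMap z∈ s∈θz)))))))

    z∉U₂ : ∀ {z′} → z′ ∈ U₂ → z′ ≢ z
    z∉U₂ z∈ refl = ℕ.<⇒≱ (ℕ.n<1+n j) (ℕ.<⇒≤
      (proj₁ (All.lookup (range-bounds (2 + j) k) (s∈chunks (block n) _ (subst (s j ∈_) right≡ (∈-++⁺ʳ π₂ (∈-concatMap z∈ s∈θz)))))))

  -- θ z contains sⱼ, which occurs once in w_n. Hence z occurs once in u, and the replacement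
  -- affects a single place.
  contract : ℕ → List (Letter (Maybe ℕ))
  contract z′ with z′ Nat.≟ z
  ... | yes _ = map lift π₁ ++ (s nothing ∷ t nothing ∷ map lift π₂)
  ... | no  _ = map lift (θ z′)

  restore-contract : ∀ z′ → concatMap (restore seg) (contract z′) ≡ θ z′
  restore-contract z′ with z′ Nat.≟ z
  ... | no _ = restore-lift seg (θ z′)
  ... | yes refl = trans (concatMap-++ (restore seg) (map lift π₁) _)
    (trans (cong₂ (λ u v → u ++ (seg ++ v)) (restore-lift seg π₁) (restore-lift seg π₂)) (sym θz))

  contract-other : ∀ U → (∀ {z′} → z′ ∈ U → z′ ≢ z) → concatMap contract U ≡ map lift (concatMap θ U)
  contract-other [] _ = refl
  contract-other (z′ ∷ U) ∉ with z′ Nat.≟ z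
  ... | yes eq = ⊥-elim (∉ (here refl) eq)
  ... | no _ = trans (cong (map lift (θ z′) ++_) (contract-other U (∉ ∘ there))) (sym (map-++ lift (θ z′) _))

  contract-self : contract z ≡ map lift π₁ ++ (s nothing ∷ t nothing ∷ map lift π₂)
  contract-self with z Nat.≟ z
  ... | yes _ = refl
  ... | no z≢z = ⊥-elim (z≢z refl)

  contracted-word : concatMap contract (U₁ ++ (z ∷ U₂)) ≡ chunks (contracted n) (contracted-indices j k)
  contracted-word = begin
    concatMap contract (U₁ ++ (z ∷ U₂))
      ≡⟨ concatMap-++ contract U₁ _ ⟩
    concatMap contract U₁ ++ (contract z ++ concatMap contract U₂)
      ≡⟨ cong₂ _++_ (contract-other U₁ z∉U₁) (cong₂ _++_ contract-self (contract-other U₂ z∉U₂)) ⟩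
    map lift (concatMap θ U₁) ++ ((map lift π₁ ++ (s nothing ∷ t nothing ∷ map lift π₂)) ++ map lift (concatMap θ U₂))
      ≡⟨ cong (map lift (concatMap θ U₁) ++_) (++-assoc (map lift π₁) _ _) ⟩
    map lift (concatMap θ U₁) ++ (map lift π₁ ++ (s nothing ∷ t nothing ∷ (map lift π₂ ++ map lift (concatMap θ U₂))))
      ≡⟨ sym (++-assoc (map lift (concatMap θ U₁)) _ _) ⟩
    (map lift (concatMap θ U₁) ++ map lift π₁) ++ (s nothing ∷ t nothing ∷ (map lift π₂ ++ map lift (concatMap θ U₂)))
      ≡⟨ cong₂ (λ u v → u ++ (s nothing ∷ t nothing ∷ v)) (side (concatMap θ U₁) π₁ (range 0 j) left≡) (side π₂ _ (range (2 + j) k) right≡) ⟩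
    chunks (contracted n) (map just (range 0 j)) ++ chunks (contracted n) (nothing ∷ map just (range (2 + j) k))
      ≡⟨ sym (concatMap-++ (chunk (contracted n)) (map just (range 0 j)) _) ⟩
    chunks (contracted n) (contracted-indices j k) ∎
    where
    open ≡-Reasoning
    side : ∀ u v is → u ++ v ≡ chunks (block n) is → map lift u ++ map lift v ≡ chunks (contracted n) (map just is)
    side u v is eq = trans (sym (map-++ lift u v)) (trans (cong (map lift) eq) (lift-chunks n is))

-- w_n itself is no isoterm for M(z∞), so u and v are compared under `contract`: the image of u is
-- an isoterm, v has the same image, and `restore` turns both back into values under θ.
short-identity : ∀ n {u v : List ℕ} → u ≲ v → length u + length u ≤ n → ∀ θ →
                 concatMap θ u ≡ word n → concatMap θ v ≡ word n
short-identity n {u} {v} u≲v short θ eq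
  with U₁ , z , U₂ , π₁ , π₂ , j , k , refl , θz , left≡ , right≡ , n≡ ← uncut (block n) θ u 0 (suc n) [] eq (s≤s short)
  rewrite ℕ.+-identityʳ j
  -- There are n+1 = j + (2 + k) chunks, so n = suc (k + j), the form fixed in `Contraction`.
  with refl ← ℕ.suc-injective (trans n≡ (trans (ℕ.+-suc j (suc k)) (cong suc (trans (ℕ.+-suc j k) (cong suc (ℕ.+-comm j k)))))) =
  begin
    concatMap θ v                                  ≡⟨ concatMap-cong (sym ∘ restore-contract) v ⟩
    concatMap (concatMap ρ ∘ contract) v           ≡⟨ sym (concatMap-concatMap ρ contract v) ⟩
    concatMap ρ (concatMap contract v)             ≡⟨ cong (concatMap ρ) (Contraction.contraction-isoterm j k {concatMap contract v} d≲) ⟩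
    concatMap ρ (chunks (contracted n) (contracted-indices j k)) ≡⟨ cong (concatMap ρ) (sym contracted-word) ⟩
    concatMap ρ (concatMap contract u)             ≡⟨ concatMap-concatMap ρ contract u ⟩
    concatMap (concatMap ρ ∘ contract) u           ≡⟨ concatMap-cong restore-contract u ⟩
    concatMap θ u                                  ≡⟨ eq ⟩
    word n ∎
  where
  open ≡-Reasoning
  open Contract n θ z U₁ U₂ π₁ π₂ j k θz left≡ right≡
  ρ : Letter (Maybe ℕ) → List (Letter ℕ)
  ρ = restore (chunk (block n) j ++ chunk (block n) (suc j))
  d≲ : chunks (contracted n) (contracted-indices j k) ≲ concatMap contract v
  d≲ ψ factor = begin
    concatMap ψ (concatMap contract v)     ≡⟨ concatMap-concatMap ψ contract v ⟩
    concatMap (concatMap ψ ∘ contract) v   ≡⟨ u≲v (concatMap ψ ∘ contract) (subst IsFactor same factor) ⟩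
    concatMap (concatMap ψ ∘ contract) u   ≡⟨ sym same ⟩
    concatMap ψ (chunks (contracted n) (contracted-indices j k)) ∎
    where
    same : concatMap ψ (chunks (contracted n) (contracted-indices j k)) ≡ concatMap (concatMap ψ ∘ contract) u
    same = trans (cong (concatMap ψ) (sym contracted-word)) (concatMap-concatMap ψ contract u)

-- Syntactic monoids of isoterms

Syntactic : {A : Set} → List A → Monoid 0ℓ 0ℓ
Syntactic {A} w = record
  { Carrier = List A
  ; _≈_ = _≈_
  ; _∙_ = _++_
  ; ε = []
  ; isMonoid = record
    { isSemigroup = record
      { isMagma = record
        { isEquivalence = record
          { refl = λ _ _ → id , id
          ; sym = λ u≈v p q → swap (u≈v p q)
          ; trans = λ u≈v v≈w p q → proj₁ (v≈w p q) ∘ proj₁ (u≈v p q) , proj₂ (u≈v p q) ∘ proj₂ (v≈w p q) }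
        ; ∙-cong = λ {u} {u′} {v} {v′} u≈u′ v≈v′ p q →
            (λ eq → cong-r u′ v v′ p q (proj₁ (v≈v′ (p ++ u′) q)) (cong-l u u′ v p q (proj₁ (u≈u′ p (v ++ q))) eq)) ,
            (λ eq → cong-l u′ u v p q (proj₂ (u≈u′ p (v ++ q))) (cong-r u′ v′ v p q (proj₂ (v≈v′ (p ++ u′) q)) eq)) }
      ; assoc = λ u v x → reflexive (++-assoc u v x) }
    ; identity = (λ _ → reflexive refl) , (λ u → reflexive (++-identityʳ u)) } }
  where
  _≈_ : List A → List A → Set
  u ≈ v = ∀ p q → (p ++ (u ++ q) ≡ w → p ++ (v ++ q) ≡ w) × (p ++ (v ++ q) ≡ w → p ++ (u ++ q) ≡ w)
  reflexive : ∀ {u v} → u ≡ v → u ≈ v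
  reflexive refl _ _ = id , id
  cong-l : ∀ u u′ v p q → (p ++ (u ++ (v ++ q)) ≡ w → p ++ (u′ ++ (v ++ q)) ≡ w) →
         p ++ ((u ++ v) ++ q) ≡ w → p ++ ((u′ ++ v) ++ q) ≡ w
  cong-l u u′ v p q f rewrite ++-assoc u v q | ++-assoc u′ v q = f
  cong-r : ∀ u v v′ p q → ((p ++ u) ++ (v ++ q) ≡ w → (p ++ u) ++ (v′ ++ q) ≡ w) →
          p ++ ((u ++ v) ++ q) ≡ w → p ++ ((u ++ v′) ++ q) ≡ w
  cong-r u v v′ p q f rewrite ++-assoc u v q | ++-assoc u v′ q | ++-assoc p u (v ++ q) | ++-assoc p u (v′ ++ q) = f

eval-concatMap : ∀ (w : List A) θ u → eval (Syntactic w) θ u ≡ concatMap θ u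
eval-concatMap w θ []      = refl
eval-concatMap w θ (z ∷ u) = cong (θ z ++_) (eval-concatMap w θ u)

eval-Z : ∀ θ u → eval M-z∞ θ u ≡ concatMap θ u
eval-Z θ []      = refl
eval-Z θ (z ∷ u) = cong (θ z ++_) (eval-Z θ u)

eval-B : ∀ χ u → eval B₂¹ χ u ≡ prod χ u
eval-B χ []      = refl
eval-B χ (z ∷ u) = cong (χ z ·B_) (eval-B χ u)

Preserves : List A → Word → Word → Set
Preserves w u v = ∀ θ p q → p ++ (concatMap θ u ++ q) ≡ w → p ++ (concatMap θ v ++ q) ≡ w

Syntactic-⊨ : (w : List A) {u v : Word} → Preserves w u v → Preserves w v u → Syntactic w ⊨ (u , v)
Syntactic-⊨ w {u} {v} f g θ p q rewrite eval-concatMap w θ u | eval-concatMap w θ v = f θ p q , g θ p q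

∼-instance : ∀ {u v} → B₂¹ ⊨ (u , v) → (θ : ℕ → List A) → ∀ p q → (p ++ (concatMap θ u ++ q)) ∼ (p ++ (concatMap θ v ++ q))
∼-instance {u = u} {v} u≈v θ p q χ = begin
  prod χ (p ++ (concatMap θ u ++ q))                  ≡⟨ expand-prod u ⟩
  prod χ p ·B (prod (prod χ ∘ θ) u ·B prod χ q)       ≡⟨ cong (λ x → prod χ p ·B (x ·B prod χ q)) (trans (sym (eval-B _ u)) (trans (u≈v _) (eval-B _ v))) ⟩
  prod χ p ·B (prod (prod χ ∘ θ) v ·B prod χ q)       ≡⟨ sym (expand-prod v) ⟩
  prod χ (p ++ (concatMap θ v ++ q))                  ∎
  where
  open ≡-Reasoning
  expand-prod : ∀ u → prod χ (p ++ (concatMap θ u ++ q)) ≡ prod χ p ·B (prod (prod χ ∘ θ) u ·B prod χ q)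
  expand-prod u = trans (prod-++ χ p _) (cong (prod χ p ·B_) (trans (prod-++ χ (concatMap θ u) q) (cong (_·B prod χ q) (prod-concatMap χ θ u))))

Isotermᴮ : List A → Set
Isotermᴮ w = ∀ {v} → w ∼ v → v ≡ w

isoterm-preserves : ∀ {w : List A} u v → Isotermᴮ w → B₂¹ ⊨ (u , v) → Preserves w u v
isoterm-preserves u v isoterm u≈v θ p q refl = isoterm (∼-instance {u = u} {v} u≈v θ p q)

isoterm⇒Syntactic∈𝔹 : ∀ {w : List A} → Isotermᴮ w → 𝔹₂¹ (Syntactic w)
isoterm⇒Syntactic∈𝔹 {w = w} isoterm (u , v) u≈v =
  Syntactic-⊨ w {u} {v} (isoterm-preserves u v isoterm u≈v) (isoterm-preserves v u isoterm (λ θ → sym (u≈v θ)))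

xxy-square : ∀ {w : List A} → Isotermᴮ w → ∀ a b p q → p ++ ((a ++ (a ++ (b ++ []))) ++ q) ≡ w → a ≡ []
xxy-square isoterm a b p q eq = isoterm⇒squarefree isoterm p a ((b ++ []) ++ q)
  (trans (cong (p ++_) (trans (cong (a ++_) (sym (++-assoc a _ q))) (sym (++-assoc a _ q)))) eq)

yxx-square : ∀ {w : List A} → Isotermᴮ w → ∀ a b p q → p ++ ((b ++ (a ++ (a ++ []))) ++ q) ≡ w → a ≡ []
yxx-square isoterm a b p q eq = isoterm⇒squarefree isoterm (p ++ b) a q
  (trans (++-assoc p b _) (trans (cong (p ++_) (trans
    (cong (b ++_) (trans (sym (++-assoc a a q)) (cong (_++ q) (cong (a ++_) (sym (++-identityʳ a))))))
    (sym (++-assoc b _ q)))) eq))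

empty-square : ∀ {a} (b : List A) → a ≡ [] → a ++ (a ++ (b ++ [])) ≡ b ++ (a ++ (a ++ []))
empty-square b refl = refl

isoterm⇒Syntactic⊨x²y≈yx² : ∀ {w : List A} → Isotermᴮ w → ⟦ x²y≈yx² ⟧ (Syntactic w)
isoterm⇒Syntactic⊨x²y≈yx² {w = w} isoterm _ refl = Syntactic-⊨ w {0 ∷ 0 ∷ 1 ∷ []} {1 ∷ 0 ∷ 0 ∷ []} xxy yxx
  where
  xxy : Preserves w (0 ∷ 0 ∷ 1 ∷ []) (1 ∷ 0 ∷ 0 ∷ [])
  xxy θ p q eq =
    trans (cong (λ u → p ++ (u ++ q)) (sym (empty-square (θ 1) (xxy-square isoterm (θ 0) (θ 1) p q eq)))) eq
  yxx : Preserves w (1 ∷ 0 ∷ 0 ∷ []) (0 ∷ 0 ∷ 1 ∷ [])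
  yxx θ p q eq =
    trans (cong (λ u → p ++ (u ++ q)) (empty-square (θ 1) (yxx-square isoterm (θ 0) (θ 1) p q eq))) eq

-- Identities of M(z∞)

Z-⊨ : ∀ {u v} → u ≲ v → v ≲ u → M-z∞ ⊨ (u , v)
Z-⊨ {u} {v} u≲v v≲u θ rewrite eval-Z θ u | eval-Z θ v with ≡-dec Nat._≟_ (concatMap θ u) (concatMap θ v)
... | yes eq = inj₁ eq
... | no ≢   = inj₂ ((λ factor → ≢ (sym (u≲v θ factor))) , (λ factor → ≢ (v≲u θ factor)))

⊨⇒≲ : ∀ {u v} → M-z∞ ⊨ (u , v) → u ≲ v
⊨⇒≲ {u} {v} u≈v θ factor with u≈v θ
... | inj₁ eq = sym (trans (sym (eval-Z θ u)) (trans eq (eval-Z θ v)))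
... | inj₂ (¬factor , _) = ⊥-elim (¬factor (subst IsFactor (sym (eval-Z θ u)) factor))

-- The isoterm is zₙ as a whole: the value of u is completed to zₙ by its context, u is exchanged
-- for v there, and the context is cancelled.
B⇒≲ : ∀ {u v} → B₂¹ ⊨ (u , v) → u ≲ v
B⇒≲ {u} {v} u≈v θ (n , p , q , eq) =
  ++-cancelʳ q _ _ (++-cancelˡ p _ _ (trans (isoterm-preserves u v (zimin-isoterm n) u≈v θ p q eq) (sym eq)))
  where open import Data.List.Properties using (++-cancelˡ; ++-cancelʳ)

Z∈𝔹 : ∀ e → B₂¹ ⊨ e → M-z∞ ⊨ e
Z∈𝔹 (u , v) u≈v = Z-⊨ {u} {v} (B⇒≲ {u} {v} u≈v) (B⇒≲ {v} {u} (λ θ → sym (u≈v θ)))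

Z⊨x²y≈yx² : ∀ e → x²y≈yx² e → M-z∞ ⊨ e
Z⊨x²y≈yx² _ refl = Z-⊨ {0 ∷ 0 ∷ 1 ∷ []} {1 ∷ 0 ∷ 0 ∷ []} xxy yxx
  where
  xxy : (0 ∷ 0 ∷ 1 ∷ []) ≲ (1 ∷ 0 ∷ 0 ∷ [])
  xxy θ (n , p , q , eq) = sym (empty-square (θ 1) (xxy-square (zimin-isoterm n) (θ 0) (θ 1) p q eq))
  yxx : (1 ∷ 0 ∷ 0 ∷ []) ≲ (0 ∷ 0 ∷ 1 ∷ [])
  yxx θ (n , p , q , eq) = empty-square (θ 1) (yxx-square (zimin-isoterm n) (θ 0) (θ 1) p q eq)

factor-of-factor : ∀ {u} p q → IsFactor (p ++ (u ++ q)) → IsFactor u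
factor-of-factor {u} p q (n , p′ , q′ , eq) = n , p′ ++ p , q ++ q′ ,
  trans (++-assoc p′ p _) (trans (cong (p′ ++_) (trans (cong (p ++_) (sym (++-assoc u q q′))) (sym (++-assoc p _ q′)))) eq)

-- The contexts p and q of an instance are absorbed as values of the new letters 0 and 1.
framed : Word → Word
framed u = 0 ∷ map (2 +_) u ++ (1 ∷ [])

concatMap-framed : ∀ (ψ : ℕ → List A) u → concatMap ψ (framed u) ≡ ψ 0 ++ (concatMap (ψ ∘ (2 +_)) u ++ ψ 1)
concatMap-framed ψ u = cong (ψ 0 ++_) (trans (concatMap-++ ψ (map (2 +_) u) (1 ∷ []))
  (cong₂ _++_ (concatMap-map ψ (2 +_) u) (++-identityʳ (ψ 1))))

framed-≲ : ∀ {u v} → u ≲ v → framed u ≲ framed v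
framed-≲ {u} {v} u≲v ψ factor rewrite concatMap-framed ψ u | concatMap-framed ψ v =
  cong (λ w → ψ 0 ++ (w ++ ψ 1)) (u≲v (ψ ∘ (2 +_)) (factor-of-factor (ψ 0) (ψ 1) factor))

frame : (p q : List A) → (ℕ → List A) → ℕ → List A
frame p q θ 0             = p
frame p q θ 1             = q
frame p q θ (suc (suc z)) = θ z

short⇒preserves : ∀ n u v → u ≲ v → (2 + length u) + (2 + length u) ≤ n → Preserves (word n) u v
short⇒preserves n u v u≲v short θ p q eq =
  trans (sym (concatMap-framed (frame p q θ) v))
    (short-identity n {framed u} {framed v} (framed-≲ {u} {v} u≲v) (subst (λ k → k + k ≤ n) (sym framed-length) short)
      (frame p q θ) (trans (concatMap-framed (frame p q θ) u) eq))
  where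
  framed-length : length (framed u) ≡ 2 + length u
  framed-length = cong suc (trans (length-++ (map (2 +_) u)) (trans (cong (_+ 1) (length-map (2 +_) u)) (ℕ.+-comm _ 1)))

-- The critical identities

-- n ≡ 1 (mod 3) is needed for κ, and n ≥ 5 for a pair of letters that misses a given block.
size : ℕ → ℕ
size zero    = 7
size (suc k) = 3 + size k

size-injective : ∀ {j k} → size j ≡ size k → j ≡ k
size-injective {zero}  {zero}  _ = refl
size-injective {suc j} {suc k} eq = cong suc (size-injective (ℕ.+-cancelˡ-≡ 3 _ _ eq))
size-injective {zero}  {suc k} eq = ⊥-elim (ℕ.<⇒≢ (s≤s (s≤s (s≤s (7≤size k)))) eq)
  where
  7≤size : ∀ k → 5 ≤ size k
  7≤size zero    = ℕ.m≤m+n 5 2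
  7≤size (suc k) = ℕ.m≤n⇒m≤o+n 3 (7≤size k)
size-injective {suc j} {zero} eq = sym (size-injective (sym eq))

4≤size-pred : ∀ k → ∃ λ p → size k ≡ suc p × 4 ≤ p
4≤size-pred zero    = 6 , refl , ℕ.m≤m+n 4 2
4≤size-pred (suc k) with p , eq , 4≤p ← 4≤size-pred k = 3 + p , cong (3 +_) eq , ℕ.m≤n⇒m≤o+n 3 4≤p

κ-size : ∀ k → κ (size k) ≡ (false ⟶ true)
κ-size zero    = refl
κ-size (suc k) = κ-size k

size-isoterm : ∀ k → Isotermᴮ (word (size k))
size-isoterm k {v} with size k | 4≤size-pred k | κ-size k
... | _ | p , refl , 4≤p | κn = Isoterm.word-isoterm p 4≤p κn {v}

double-erased : ∀ (w : List A) → Isotermᴮ w → ∀ n (θ : Letter ℕ → List A) p q →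
                p ++ (concatMap θ (word′ n) ++ q) ≡ w → ∀ i → i ≤ n → θ (y i) ≡ []
double-erased w isoterm n θ p q eq i i≤n with α , β , split ← chunks-split double (∈-indices i≤n) =
  isoterm⇒squarefree isoterm (p ++ concatMap θ α) (θ (y i)) (concatMap θ β ++ q)
    (trans (cong ((p ++ concatMap θ α) ++_) (trans (sym (++-assoc (θ (y i)) _ _)) (trans (sym (++-assoc (θ (y i) ++ θ (y i)) (concatMap θ β) q)) (trans (cong (_++ q) (cong (_++ concatMap θ β) (cong (θ (y i) ++_) (sym (++-identityʳ (θ (y i))))))) (++-assoc _ (concatMap θ β) q)))))
      (concatMap-split θ α (map y (double i)) β p q split eq))

-- Residues modulo 3 tell y, s and t apart.
code : Letter ℕ → ℕ
code (y zero)    = 0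
code (s zero)    = 1
code (t zero)    = 2
code (y (suc i)) = 3 + code (y i)
code (s (suc i)) = 3 + code (s i)
code (t (suc i)) = 3 + code (t i)

next : Letter ℕ → Letter ℕ
next (y i) = y (suc i)
next (s i) = s (suc i)
next (t i) = t (suc i)

decode : ℕ → Letter ℕ
decode 0 = y 0
decode 1 = s 0
decode 2 = t 0
decode (suc (suc (suc m))) = next (decode m)

decode-code : ∀ x → decode (code x) ≡ x
decode-code (y zero)    = refl
decode-code (s zero)    = refl
decode-code (t zero)    = refl
decode-code (y (suc i)) = cong next (decode-code (y i))
decode-code (s (suc i)) = cong next (decode-code (s i))
decode-code (t (suc i)) = cong next (decode-code (t i))

critical : ℕ → Identity
critical n = map code (word n) , map code (word′ n)

Z⊨critical : ∀ n → M-z∞ ⊨ critical n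
Z⊨critical n = Z-⊨ {map code (word n)} {map code (word′ n)} to from
  where
  to : map code (word n) ≲ map code (word′ n)
  to θ factor rewrite concatMap-map θ code (word n) | concatMap-map θ code (word′ n) =
    sym (erased⇒≡ n (θ ∘ code) (Avoid.erased-Z n (block n) (bracketed n) (θ ∘ code) factor))
  from : map code (word′ n) ≲ map code (word n)
  from θ factor rewrite concatMap-map θ code (word n) | concatMap-map θ code (word′ n) =
    erased⇒≡ n (θ ∘ code) (Avoid.erased-Z n double (bracketed-double n) (θ ∘ code) factor)

Syntactic⊨critical : ∀ {j k} → j ≢ k → Syntactic (word (size j)) ⊨ critical (size k)
Syntactic⊨critical {j} {k} j≢k = Syntactic-⊨ (word m) {map code (word n)} {map code (word′ n)} to from
  where
  m n : ℕ
  m = size j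
  n = size k
  erased : ∀ θ p q → p ++ (concatMap θ (word n) ++ q) ≡ word m → ∀ i → i ≤ n → θ (y i) ≡ []
  erased θ p q eq with m | n | 4≤size-pred j | 4≤size-pred k | size-injective {j} {k}
  ... | _ | _ | m′ , refl , _ | n′ , refl , _ | injective =
    Occurrence.erased n′ m′ θ p q eq (λ n≡m → j≢k (injective (sym n≡m)))
  to : Preserves (word m) (map code (word n)) (map code (word′ n))
  to θ p q eq rewrite concatMap-map θ code (word n) | concatMap-map θ code (word′ n) =
    trans (cong (λ u → p ++ (u ++ q)) (sym (erased⇒≡ n (θ ∘ code) (erased (θ ∘ code) p q eq)))) eq
  from : Preserves (word m) (map code (word′ n)) (map code (word n))
  from θ p q eq rewrite concatMap-map θ code (word n) | concatMap-map θ code (word′ n) =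
    trans (cong (λ u → p ++ (u ++ q)) (erased⇒≡ n (θ ∘ code) (double-erased (word m) (size-isoterm j) n (θ ∘ code) p q eq))) eq

-- The third letters already differ: y₀ in w′_n and y₁ in w_n.
word′≢word : ∀ k → word′ (size k) ≢ word (size k)
word′≢word k eq with size k | 4≤size-pred k
word′≢word k () | _ | p , refl , _

-- Under decoding, with empty contexts, the left side takes the value w_n; the identity would then
-- make w′_n equal to w_n.
Syntactic⊭critical : ∀ k → ¬ (Syntactic (word (size k)) ⊨ critical (size k))
Syntactic⊭critical k ⊨e = word′≢word k (trans (sym (trans (++-identityʳ _) (decoded (word′ n))))
  (proj₁ (⊨e θ [] []) (trans (++-identityʳ _) (decoded (word n)))))
  where
  n : ℕ
  n = size k
  θ : ℕ → List (Letter ℕ)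
  θ m = decode m ∷ []
  decoded : ∀ w → eval (Syntactic (word n)) θ (map code w) ≡ w
  decoded []      = refl
  decoded (x ∷ w) = cong₂ _∷_ (decode-code x) (decoded w)

Syntactic⊨short : ∀ k e → M-z∞ ⊨ e → length (proj₁ e) + length (proj₂ e) ≤ k → Syntactic (word (size k)) ⊨ e
Syntactic⊨short k (u , v) u≈v short = Syntactic-⊨ (word (size k)) {u} {v}
  (short⇒preserves (size k) u v (⊨⇒≲ {u} {v} u≈v) (bound (length u) (ℕ.≤-trans (ℕ.m≤m+n _ _) short)))
  (short⇒preserves (size k) v u (⊨⇒≲ {v} {u} (λ θ → Monoid.sym M-z∞ (u≈v θ))) (bound (length v) (ℕ.≤-trans (ℕ.m≤n+m _ _) short)))
  where
  -- The 2 stands for the two framing letters; since `size k` is 7 + 3k, it leaves room for twice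
  -- the framed length.
  4+2k≤size : ∀ k → (2 + k) + (2 + k) ≤ size k
  4+2k≤size zero    = ℕ.m≤m+n 4 3
  4+2k≤size (suc k) = subst (_≤ 3 + size k) (sym (cong suc (ℕ.+-suc (2 + k) (2 + k)))) (ℕ.m≤n⇒m≤1+n (s≤s (s≤s (4+2k≤size k))))
  bound : ∀ l → l ≤ k → (2 + l) + (2 + l) ≤ size k
  bound l l≤k = ℕ.≤-trans (ℕ.+-mono-≤ (ℕ.+-monoʳ-≤ 2 l≤k) (ℕ.+-monoʳ-≤ 2 l≤k)) (4+2k≤size k)

total-length : List Identity → ℕ
total-length []            = 0
total-length ((u , v) ∷ E) = (length u + length v) + total-length E

∈⇒short : ∀ {u v E} → (u , v) ∈ E → length u + length v ≤ total-length E
∈⇒short (here refl)              = ℕ.m≤m+n _ _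
∈⇒short (there {x = u′ , v′} e∈) = ℕ.m≤n⇒m≤o+n (length u′ + length v′) (∈⇒short e∈)

-- The two conclusions

data Basis (f : ℕ → Bool) : Identity → Set where
  brandt   : ∀ {e} → B₂¹ ⊨ e → Basis f e
  squares  : ∀ {e} → x²y≈yx² e → Basis f e
  selected : ∀ {k} → f k ≡ true → Basis f (critical (size k))

basis-sound : ∀ f → 𝕄z∞ ⊆ ⟦ Basis f ⟧
basis-sound f M M∈ e (brandt B⊨e)       = M∈ e (Z∈𝔹 e B⊨e)
basis-sound f M M∈ e (squares e≡)        = M∈ e (Z⊨x²y≈yx² e e≡)
basis-sound f M M∈ _ (selected {k} _)   = M∈ (critical (size k)) (Z⊨critical (size k))

Syntactic∈⟦Basis⟧ : ∀ f k → f k ≡ false → ⟦ Basis f ⟧ (Syntactic (word (size k)))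
Syntactic∈⟦Basis⟧ f k fk e (brandt B⊨e) = isoterm⇒Syntactic∈𝔹 (size-isoterm k) e B⊨e
Syntactic∈⟦Basis⟧ f k fk e (squares e≡)  = isoterm⇒Syntactic⊨x²y≈yx² (size-isoterm k) e e≡
Syntactic∈⟦Basis⟧ f k fk _ (selected {j} fj) = Syntactic⊨critical {k} {j} λ { refl → case (trans (sym fk) fj) }
  where
  case : ¬ false ≡ true
  case ()

-- If f selects k and g does not, the syntactic monoid of `word (size k)` lies in `⟦ Basis g ⟧` but
-- violates a member of `Basis f`.
basis-monotone : ∀ f g → ⟦ Basis g ⟧ ⊆ ⟦ Basis f ⟧ → ∀ k → f k ≡ true → g k ≢ false
basis-monotone f g ⊆ k fk gk = Syntactic⊭critical k (⊆ (Syntactic (word (size k))) (Syntactic∈⟦Basis⟧ g k gk) (critical (size k)) (selected fk))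

basis-injective : ∀ f g → ⟦ Basis f ⟧ ≋ ⟦ Basis g ⟧ → ∀ k → f k ≡ g k
basis-injective f g (f⊆g , g⊆f) k with f k in fk | g k in gk
... | true  | true  = refl
... | false | false = refl
... | true  | false = ⊥-elim (basis-monotone f g g⊆f k fk gk)
... | false | true  = ⊥-elim (basis-monotone g f f⊆g k gk fk)

mainTheorem2 : (Σ[ W ∈ ((ℕ → Bool) → Identity → Set) ]
    (((f : ℕ → Bool) → (𝕄z∞ ⊆ ⟦ W f ⟧) × (⟦ W f ⟧ ⊆ (⟦ x²y≈yx² ⟧ ∧ 𝔹₂¹)))
    × ((f g : ℕ → Bool) → ⟦ W f ⟧ ≋ ⟦ W g ⟧ → (i : ℕ) → f i ≡ g i)))
    × (¬ (Σ[ Σ' ∈ List Identity ] (𝕄z∞ ≋ (𝔹₂¹ ∧ ⟦ Σ' ⟧fin))))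
mainTheorem2 =
  (Basis , (λ f → basis-sound f , λ M M∈ → (λ e e≡ → M∈ e (squares e≡)) , (λ e B⊨e → M∈ e (brandt B⊨e))) , basis-injective) ,
  λ { (E , 𝕄⊆ , ⊆𝕄) →
    -- The total length bounds both sides of every identity in E at once. These identities hold in
    -- M(z∞) because `M-z∞` belongs to the variety it generates.
    let k = total-length E
        Z⊨E = proj₂ (𝕄⊆ M-z∞ (λ e Z⊨e → Z⊨e))
    in Syntactic⊭critical k (⊆𝕄 (Syntactic (word (size k)))
         (isoterm⇒Syntactic∈𝔹 (size-isoterm k) , λ e e∈ → Syntactic⊨short k e (Z⊨E e e∈) (∈⇒short e∈))
         (critical (size k)) (Z⊨critical (size k))) }
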